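{- Let $\Gamma$ be a finite connected tetravalent graph such that $\mathrm{Aut}(\Gamma)$ has a subgroup $G$ which is half-arc-transitive on $\Gamma$. Assume that the stabilizer $G_v$ of a vertex $v\in V(\Gamma)$ in $G$ is a non-abelian group of order at least $2^9$. If $p\geq |G|$ is a prime, then there exists a finite connected tetravalent half-arc-transitive graph $\Sigma$ such that $\mathrm{Aut}(\Sigma)$ has a normal $p$-subgroup $P$ with $\mathrm{Aut}(\Sigma)/P\cong G$.
   Context: All graphs are finite, simple, undirected. For $G\leq \mathrm{Aut}(\Gamma)$, $\Gamma$ is $G$-half-arc-transitive ($G$ is half-arc-transitive on $\Gamma$) if $G$ is transitive on vertices and on edges but not on arcs (ordered pairs of adjacent vertices). A graph is half-arc-transitive if it is $\mathrm{Aut}(\Gamma)$-half-arc-transitive. -}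

module Defs where

open import Algebra.Bundles using (Group)
open import Algebra.Definitions using (Commutative)
open import Algebra.Morphism.Structures using (module GroupMorphisms)
import Algebra.Properties.Group as GroupProperties
open import Data.Fin using (Fin)
open import Data.Fin.Permutation using (Permutation′; _⟨$⟩ʳ_; _∘ₚ_; flip; inverseˡ; inverseʳ) renaming (id to idₚ; _≈_ to _≈ₚ_)
open import Data.List using (length; filter; allFin)
open import Data.Nat using (ℕ; _^_)
open import Data.Product using (Σ; ∃-syntax; _×_; _,_; proj₁)
open import Data.Sum using (_⊎_)
open import Data.Unit using (⊤; tt)
open import Function.Bundles using (_⇔_; mk⇔; Equivalence; Inverse)
open import Level using (0ℓ)
open import Relation.Binary.Construct.Closure.ReflexiveTransitive using (Star)
open import Relation.Binary.Core using (Rel)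
open import Relation.Binary.Definitions using (Symmetric; Irreflexive; Decidable)
open import Relation.Binary.PropositionalEquality as ≡ using (_≡_; refl; cong; subst₂)
import Relation.Binary.Reasoning.Setoid as SetoidReasoning
open import Relation.Nullary using (¬_)

Grp : Set₁
Grp = Group 0ℓ 0ℓ

infix 4 _≅_

_≅_ : Grp → Grp → Set
A ≅ B = ∃[ f ] IsGroupIsomorphism f
  where open GroupMorphisms (Group.rawGroup A) (Group.rawGroup B)

HasOrder : Grp → ℕ → Set
HasOrder A n = Inverse (≡.setoid (Fin n)) (Group.setoid A)

IsAbelian : Grp → Set
IsAbelian A = Commutative _≈_ _∙_
  where open Group A

-- For finite groups only: the order is a power of p (possibly p ^ 0).
IsPGroup : ℕ → Grp → Set
IsPGroup p A = ∃[ k ] HasOrder A (p ^ k)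

record Subgroup (A : Grp) : Set₁ where
  open Group A
  field
    Mem       : Carrier → Set
    ∈-resp-≈  : ∀ {x y} → x ≈ y → Mem x → Mem y
    ε-closed  : Mem ε
    ∙-closed  : ∀ {x y} → Mem x → Mem y → Mem (x ∙ y)
    ⁻¹-closed : ∀ {x} → Mem x → Mem (x ⁻¹)

infix 4 _∈_

_∈_ : {A : Grp} → Group.Carrier A → Subgroup A → Set
x ∈ H = Subgroup.Mem H x

whole : (A : Grp) → Subgroup A
whole A = record
  { Mem       = λ _ → ⊤
  ; ∈-resp-≈  = λ _ _ → tt
  ; ε-closed  = tt
  ; ∙-closed  = λ _ _ → tt
  ; ⁻¹-closed = λ _ → tt
  }

⟪_⟫ : {A : Grp} → Subgroup A → Grp
⟪_⟫ {A} H = record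
  { Carrier = Σ Carrier Mem
  ; _≈_     = λ x y → proj₁ x ≈ proj₁ y
  ; _∙_     = λ (x , x∈) (y , y∈) → x ∙ y , ∙-closed x∈ y∈
  ; ε       = ε , ε-closed
  ; _⁻¹     = λ (x , x∈) → x ⁻¹ , ⁻¹-closed x∈
  ; isGroup = record
    { isMonoid = record
      { isSemigroup = record
        { isMagma = record
          { isEquivalence = record { refl = Group.refl A ; sym = sym ; trans = trans }
          ; ∙-cong        = ∙-cong
          }
        ; assoc = λ x y z → assoc (proj₁ x) (proj₁ y) (proj₁ z)
        }
      ; identity = (λ x → identityˡ (proj₁ x)) , (λ x → identityʳ (proj₁ x))
      }
    ; inverse = (λ x → inverseˡ′ (proj₁ x)) , (λ x → inverseʳ′ (proj₁ x))
    ; ⁻¹-cong = ⁻¹-cong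
    }
  }
  where
  open Group A renaming (inverseˡ to inverseˡ′; inverseʳ to inverseʳ′)
  open Subgroup H

IsNormal : {A : Grp} → Subgroup A → Set
IsNormal {A} N = ∀ g {x} → x ∈ N → (g ∙ x ∙ g ⁻¹) ∈ N
  where open Group A

-- The quotient has the elements of A as representatives, with x and y
-- identified when they lie in the same coset: x ⁻¹ ∙ y ∈ N.
module Quotient (A : Grp) (N : Subgroup A) (N-normal : IsNormal N) where
  open Group A renaming (inverseˡ to inverseˡ′; inverseʳ to inverseʳ′; refl to ≈-refl)
  open Subgroup N
  open GroupProperties A using (⁻¹-anti-homo-∙; ⁻¹-involutive)
  open SetoidReasoning setoid

  infix 4 _~_

  _~_ : Rel Carrier 0ℓ
  x ~ y = Mem (x ⁻¹ ∙ y)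

  private
    ≈⇒~ : ∀ {x y} → x ≈ y → x ~ y
    ≈⇒~ {x} {y} x≈y = ∈-resp-≈ (trans (sym (inverseˡ′ x)) (∙-congˡ x≈y)) ε-closed

    cancel-mid : ∀ x y z → (x ∙ y) ∙ (y ⁻¹ ∙ z) ≈ x ∙ z
    cancel-mid x y z = begin
      (x ∙ y) ∙ (y ⁻¹ ∙ z)  ≈⟨ assoc x y _ ⟩
      x ∙ (y ∙ (y ⁻¹ ∙ z))  ≈⟨ ∙-congˡ (assoc y _ z) ⟨
      x ∙ (y ∙ y ⁻¹ ∙ z)    ≈⟨ ∙-congˡ (∙-congʳ (inverseʳ′ y)) ⟩
      x ∙ (ε ∙ z)           ≈⟨ ∙-congˡ (identityˡ z) ⟩
      x ∙ z                 ∎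

    ~-sym : ∀ {x y} → x ~ y → y ~ x
    ~-sym {x} {y} p = ∈-resp-≈ eq (⁻¹-closed p)
      where
      eq : (x ⁻¹ ∙ y) ⁻¹ ≈ y ⁻¹ ∙ x
      eq = trans (⁻¹-anti-homo-∙ (x ⁻¹) y) (∙-congˡ (⁻¹-involutive x))

    ~-trans : ∀ {x y z} → x ~ y → y ~ z → x ~ z
    ~-trans {x} {y} {z} p q = ∈-resp-≈ (cancel-mid (x ⁻¹) y z) (∙-closed p q)

    ~-∙-cong : ∀ {x y u v} → x ~ y → u ~ v → x ∙ u ~ y ∙ v
    ~-∙-cong {x} {y} {u} {v} p q = ∈-resp-≈ eq (∙-closed (N-normal (u ⁻¹) p) q)
      where
      eq : (u ⁻¹ ∙ (x ⁻¹ ∙ y) ∙ u ⁻¹ ⁻¹) ∙ (u ⁻¹ ∙ v) ≈ (x ∙ u) ⁻¹ ∙ (y ∙ v)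
      eq = begin
        (u ⁻¹ ∙ (x ⁻¹ ∙ y) ∙ u ⁻¹ ⁻¹) ∙ (u ⁻¹ ∙ v)  ≈⟨ ∙-congʳ (∙-congˡ (⁻¹-involutive u)) ⟩
        (u ⁻¹ ∙ (x ⁻¹ ∙ y) ∙ u) ∙ (u ⁻¹ ∙ v)        ≈⟨ cancel-mid _ u v ⟩
        u ⁻¹ ∙ (x ⁻¹ ∙ y) ∙ v                       ≈⟨ ∙-congʳ (assoc (u ⁻¹) (x ⁻¹) y) ⟨
        u ⁻¹ ∙ x ⁻¹ ∙ y ∙ v                         ≈⟨ assoc _ y v ⟩
        u ⁻¹ ∙ x ⁻¹ ∙ (y ∙ v)                       ≈⟨ ∙-congʳ (⁻¹-anti-homo-∙ x u) ⟨
        (x ∙ u) ⁻¹ ∙ (y ∙ v)                        ∎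

    ~-⁻¹-cong : ∀ {x y} → x ~ y → x ⁻¹ ~ y ⁻¹
    ~-⁻¹-cong {x} {y} p = ~-sym (∈-resp-≈ eq (N-normal x p))
      where
      eq : x ∙ (x ⁻¹ ∙ y) ∙ x ⁻¹ ≈ y ⁻¹ ⁻¹ ∙ x ⁻¹
      eq = begin
        x ∙ (x ⁻¹ ∙ y) ∙ x ⁻¹  ≈⟨ ∙-congʳ (assoc x _ y) ⟨
        x ∙ x ⁻¹ ∙ y ∙ x ⁻¹    ≈⟨ ∙-congʳ (∙-congʳ (inverseʳ′ x)) ⟩
        ε ∙ y ∙ x ⁻¹           ≈⟨ ∙-congʳ (identityˡ y) ⟩
        y ∙ x ⁻¹               ≈⟨ ∙-congʳ (⁻¹-involutive y) ⟨
        y ⁻¹ ⁻¹ ∙ x ⁻¹         ∎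

  quotient : Grp
  quotient = record
    { Carrier = Carrier
    ; _≈_     = _~_
    ; _∙_     = _∙_
    ; ε       = ε
    ; _⁻¹     = _⁻¹
    ; isGroup = record
      { isMonoid = record
        { isSemigroup = record
          { isMagma = record
            { isEquivalence = record
              { refl  = ≈⇒~ ≈-refl
              ; sym   = ~-sym
              ; trans = ~-trans
              }
            ; ∙-cong = ~-∙-cong
            }
          ; assoc = λ x y z → ≈⇒~ (assoc x y z)
          }
        ; identity = (λ x → ≈⇒~ (identityˡ x)) , (λ x → ≈⇒~ (identityʳ x))
        }
      ; inverse = (λ x → ≈⇒~ (inverseˡ′ x)) , (λ x → ≈⇒~ (inverseʳ′ x))
      ; ⁻¹-cong = ~-⁻¹-cong
      }
    }

open Quotient public using () renaming (quotient to _/_by_)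

record Graph : Set₁ where
  field
    order : ℕ

  Vertex : Set
  Vertex = Fin order

  field
    Adj        : Rel Vertex 0ℓ
    Adj?       : Decidable Adj
    Adj-sym    : Symmetric Adj
    Adj-irrefl : Irreflexive _≡_ Adj

open Graph using (Vertex)

module _ (Γ : Graph) where
  open Graph Γ hiding (Vertex)

  degree : Vertex Γ → ℕ
  degree v = length (filter (Adj? v) (allFin order))

  Tetravalent : Set
  Tetravalent = ∀ v → degree v ≡ 4

  Connected : Set
  Connected = ∀ u v → Star Adj u v

  record Automorphism : Set where
    field
      perm      : Permutation′ order
      preserves : ∀ u v → Adj u v ⇔ Adj (perm ⟨$⟩ʳ u) (perm ⟨$⟩ʳ v)

  open Automorphism

  private
    inverse-preserves : ∀ (g : Automorphism) u v → Adj u v ⇔ Adj (flip (perm g) ⟨$⟩ʳ u) (flip (perm g) ⟨$⟩ʳ v)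
    inverse-preserves g u v = mk⇔
      (λ a → Equivalence.from (preserves g _ _) (subst₂ Adj (≡.sym (inverseʳ (perm g))) (≡.sym (inverseʳ (perm g))) a))
      (λ a → subst₂ Adj (inverseʳ (perm g)) (inverseʳ (perm g)) (Equivalence.to (preserves g _ _) a))

    inverse-cong : ∀ (g h : Automorphism) → perm g ≈ₚ perm h → flip (perm g) ≈ₚ flip (perm h)
    inverse-cong g h g≈h i = begin
      π⁻¹ i            ≡⟨ cong π⁻¹ (inverseʳ (perm h)) ⟨
      π⁻¹ (ρ (ρ⁻¹ i))  ≡⟨ cong π⁻¹ (g≈h (ρ⁻¹ i)) ⟨
      π⁻¹ (π (ρ⁻¹ i))  ≡⟨ inverseˡ (perm g) ⟩
      ρ⁻¹ i            ∎
      where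
      open ≡.≡-Reasoning
      π = perm g ⟨$⟩ʳ_
      ρ = perm h ⟨$⟩ʳ_
      π⁻¹ = flip (perm g) ⟨$⟩ʳ_
      ρ⁻¹ = flip (perm h) ⟨$⟩ʳ_

  -- Products act from the left, (g ∙ h) v = g (h v), whereas _∘ₚ_
  -- composes in diagrammatic order.
  Aut : Grp
  Aut = record
    { Carrier = Automorphism
    ; _≈_     = λ g h → perm g ≈ₚ perm h
    ; _∙_     = λ g h → record
      { perm      = perm h ∘ₚ perm g
      ; preserves = λ u v → mk⇔
          (λ a → Equivalence.to (preserves g _ _) (Equivalence.to (preserves h _ _) a))
          (λ a → Equivalence.from (preserves h _ _) (Equivalence.from (preserves g _ _) a))
      }
    ; ε       = record { perm = idₚ ; preserves = λ u v → mk⇔ (λ a → a) (λ a → a) }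
    ; _⁻¹     = λ g → record { perm = flip (perm g) ; preserves = inverse-preserves g }
    ; isGroup = record
      { isMonoid = record
        { isSemigroup = record
          { isMagma = record
            { isEquivalence = record
              { refl  = λ i → refl
              ; sym   = λ p i → ≡.sym (p i)
              ; trans = λ p q i → ≡.trans (p i) (q i)
              }
            ; ∙-cong = λ {g} {g′} {h} {h′} p q i →
                ≡.trans (cong (perm g ⟨$⟩ʳ_) (q i)) (p (perm h′ ⟨$⟩ʳ i))
            }
          ; assoc = λ g h k i → refl
          }
        ; identity = (λ g i → refl) , (λ g i → refl)
        }
      ; inverse = (λ g i → inverseˡ (perm g)) , (λ g i → inverseʳ (perm g))
      ; ⁻¹-cong = λ {g} {h} → inverse-cong g h
      }
    }

infixr 8 _·_

_·_ : {Γ : Graph} → Automorphism Γ → Vertex Γ → Vertex Γ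
g · v = Automorphism.perm g ⟨$⟩ʳ v

module _ {Γ : Graph} where
  open Graph Γ using (Adj)

  stabilizer : Subgroup (Aut Γ) → Vertex Γ → Subgroup (Aut Γ)
  stabilizer G v = record
    { Mem       = λ g → g ∈ G × g · v ≡ v
    ; ∈-resp-≈  = λ g≈h (g∈ , gv) → ∈-resp-≈ g≈h g∈ , ≡.trans (≡.sym (g≈h v)) gv
    ; ε-closed  = ε-closed , refl
    ; ∙-closed  = λ {g} (g∈ , gv) (h∈ , hv) → ∙-closed g∈ h∈ , ≡.trans (cong (g ·_) hv) gv
    ; ⁻¹-closed = λ {g} (g∈ , gv) → ⁻¹-closed g∈ ,
        ≡.trans (cong (flip (Automorphism.perm g) ⟨$⟩ʳ_) (≡.sym gv)) (inverseˡ (Automorphism.perm g))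
    }
    where open Subgroup G

  VertexTransitive : Subgroup (Aut Γ) → Set
  VertexTransitive G = ∀ u v → ∃[ g ] g ∈ G × g · u ≡ v

  -- An edge is given by an adjacent pair; {g u , g v} = {x , y} as unordered pairs.
  EdgeTransitive : Subgroup (Aut Γ) → Set
  EdgeTransitive G = ∀ {u v x y} → Adj u v → Adj x y →
    ∃[ g ] g ∈ G × ((g · u ≡ x × g · v ≡ y) ⊎ (g · u ≡ y × g · v ≡ x))

  ArcTransitive : Subgroup (Aut Γ) → Set
  ArcTransitive G = ∀ {u v x y} → Adj u v → Adj x y →
    ∃[ g ] g ∈ G × (g · u ≡ x × g · v ≡ y)

  IsHalfArcTransitiveOn : Subgroup (Aut Γ) → Set
  IsHalfArcTransitiveOn G = VertexTransitive G × EdgeTransitive G × ¬ ArcTransitive G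

HalfArcTransitive : Graph → Set
HalfArcTransitive Γ = IsHalfArcTransitiveOn (whole (Aut Γ))

{-# OPTIONS --safe #-}

-- Σ is the regular cover of Γ whose vertices are the walks from a base vertex modulo a G-invariant
-- subgroup N of p-power index in the group of closed walks.  Membership in N asks that the Magnus
-- coefficients modulo p vanish on all words shorter than some s and on the G-translates of one word
-- w of length s, and that the net number of passages of every edge is divisible by a large power q
-- of p.  A suitable nested commutator of p-power powers of loops has a nonzero coefficient on w but
-- zero coefficients on the translates of w by all other automorphisms of Γ, so only the elements of
-- G preserve N.
--
-- It remains to see that every automorphism of Σ permutes the fibres.  Take one which moves every
-- vertex by a distance small compared with q.  The net counts of its displacement, paired with a
-- cycle, form a harmonic function, which is therefore constant.  As Γ has no edge cut of size at
-- most two (by uncrossing a minimal cut), this forces the automorphism to fix every fibre, so it is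
-- a deck transformation.  The deck transformations of small displacement generate the deck group,
-- and conjugation preserves displacements, so the deck group P is normal.

module Submission where

open import Defs
open import Algebra.Bundles using (CommutativeMonoid; CommutativeRing; Group; Semiring)
import Algebra.Properties.Group as GroupProperties
import Algebra.Properties.Semiring.Mult as SemiringMult
open import Data.Empty using (⊥; ⊥-elim)
open import Data.Fin using (Fin; zero; suc; toℕ)
import Data.Fin.Properties as Fin
import Data.Integer as ℤ
import Data.Integer.Properties as ℤₚ
open import Data.Integer.Tactic.RingSolver using (solve-∀)
open import Data.List using (List; []; _∷_; _++_; length; replicate; map)
import Data.Nat as ℕ
open import Data.Nat using (ℕ; zero; suc; _≤_; _<_; z≤n; s≤s)
import Data.Nat.Divisibility as ℕ∣
open import Data.Nat.Primality using (Prime; prime⇒nonZero; prime⇒nonTrivial)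
import Data.Nat.Properties as ℕ
open import Data.Product using (Σ-syntax; ∃-syntax; _×_; _,_; proj₁; proj₂)
open import Data.Sum using (_⊎_; inj₁; inj₂)
open import Data.Unit using (⊤; tt)
open import Function using (_∘_)
open import Function.Bundles using (Equivalence; Inverse; mk⇔)
open import Level using (0ℓ)
open import Relation.Binary.PropositionalEquality as ≡ using (_≡_; _≢_)
open import Relation.Nullary using (Dec; yes; no; does; ¬_; contradiction)
open import Relation.Nullary.Decidable using (_×-dec_; ¬?; dec-true; dec-false; does-⇔; decidable-stable)

-- The two kinds of conditions on N must not interfere. Divisibility by q gives closed walks in Σ
-- shorter than q net counts exactly zero; the word conditions make N asymmetric. The loop used for
-- the asymmetry is a commutator, so its net counts vanish and it satisfies the divisibility for
-- every q. The obstacle is that q has to exceed the displacements of generators of the deck group,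
-- while Σ itself depends on q. The deck transformation of a loop Y moves the end point of a walk W
-- by the conjugate of Y by W, whose length is unbounded as W varies. Let C be the subgroup given by
-- the word conditions alone. A commutator of an element of C with any loop lies in C and has zero
-- net counts, hence lies in N: C/N is central. So only the class of W modulo C matters, and these
-- classes are finite in number and independent of q. Once P is normal, an automorphism of Σ induces
-- some α of Γ which preserves N. If α is not in G, neither is its inverse β, so the β-translate of
-- the selective loop has zero coefficients on all G-translates of the word and lies in N. Applying
-- α puts the loop itself into N, against its non-zero coefficient on the word.

-- Finite sums in commutative monoids

module FiniteSums where
  open import Data.Fin using (combine; _↑ˡ_; _↑ʳ_)
  open ≡ using (refl)

  module Sums (M : CommutativeMonoid 0ℓ 0ℓ) where
    open CommutativeMonoid M renaming (_∙_ to _+_; ε to 0#; refl to ≈-refl; trans to ≈-trans; sym to ≈-sym)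
    open import Algebra.Properties.CommutativeMonoid.Sum M public using (sum; sum-cong-≋; ∑-comm; ∑-distrib-+; sum-replicate-zero; sum-permute)

    sum-zero : ∀ {n} {f : Fin n → Carrier} → (∀ i → f i ≈ 0#) → sum f ≈ 0#
    sum-zero {n} h = ≈-trans (sum-cong-≋ h) (sum-replicate-zero n)

    sum-single : ∀ {n} {f : Fin n → Carrier} a → (∀ i → ¬ (i ≡ a) → f i ≈ 0#) → sum f ≈ f a
    sum-single zero    off = ≈-trans (∙-congˡ (sum-zero (λ i → off (suc i) (λ ())))) (identityʳ _)
    sum-single (suc a) off = ≈-trans (∙-cong (off zero (λ ())) (sum-single a (λ i ne → off (suc i) (λ { refl → ne refl })))) (identityˡ _)

    sum-++ : ∀ m {n} (f : Fin (m ℕ.+ n) → Carrier) → sum f ≈ sum (λ i → f (i ↑ˡ n)) + sum (λ j → f (m ↑ʳ j))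
    sum-++ zero    f = ≈-sym (identityˡ _)
    sum-++ (suc m) f = ≈-trans (∙-congˡ (sum-++ m (f ∘ suc))) (≈-sym (assoc _ _ _))

    sum-combine : ∀ m {n} (f : Fin (m ℕ.* n) → Carrier) → sum f ≈ sum (λ i → sum (λ j → f (combine {m} i j)))
    sum-combine zero    f = ≈-refl
    sum-combine (suc m) {n} f = ≈-trans (sum-++ n f) (∙-congˡ (sum-combine m (λ i → f (n ↑ʳ i))))

open FiniteSums

-- Arithmetic modulo a prime

module ModularArithmetic where
  open import Data.Integer using (ℤ; +_; -_; _+_; _*_; _-_; 0ℤ; 1ℤ; ∣_∣)
  open import Data.Integer.Divisibility.Signed using (_∣_; divides; ∣m∣n⇒∣m+n; ∣m⇒∣-m; ∣n⇒∣m*n; ∣m⇒∣m*n; _∣?_; ∣⇒∣ᵤ; ∣ᵤ⇒∣)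
  import Data.Integer.Properties as ℤ
  open import Data.Nat.Primality using (euclidsLemma; prime⇒irreducible)
  open import Data.Nat.DivMod using (m<n⇒m%n≡m)
  open import Data.Integer.DivMod using (_%ℕ_; _/ℕ_; n%ℕd<d; a≡a%ℕn+[a/ℕn]*n)
  open import Data.Fin using (fromℕ<)
  open import Data.Fin.Properties using (toℕ<n; toℕ-fromℕ<; toℕ-injective)
  import Data.Sum as Sum
  open ≡ using (refl; sym; trans; cong; cong₂; subst)

  module Modular (m : ℤ) where
    infix 4 _≋_

    -- A record, so that the modulus and both sides stay visible to unification.
    record _≋_ (x y : ℤ) : Set where
      constructor mk≋
      field un≋ : m ∣ (x - y)
    open _≋_ public

    ≡⇒≋ : ∀ {x y} → x ≡ y → x ≋ y
    ≡⇒≋ {x} refl = mk≋ (divides 0ℤ (trans (ℤ.+-inverseʳ x) (sym (ℤ.*-zeroˡ m))))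

    ≋-sym : ∀ {x y} → x ≋ y → y ≋ x
    ≋-sym {x} {y} (mk≋ d) = mk≋ (subst (m ∣_) (eq x y) (∣m⇒∣-m d))
      where
      eq : ∀ x y → - (x - y) ≡ y - x
      eq = solve-∀

    ≋-trans : ∀ {x y z} → x ≋ y → y ≋ z → x ≋ z
    ≋-trans {x} {y} {z} (mk≋ d) (mk≋ e) = mk≋ (subst (m ∣_) (eq x y z) (∣m∣n⇒∣m+n d e))
      where
      eq : ∀ x y z → (x - y) + (y - z) ≡ x - z
      eq = solve-∀

    ≋-+-cong : ∀ {x y u v} → x ≋ y → u ≋ v → x + u ≋ y + v
    ≋-+-cong {x} {y} {u} {v} (mk≋ d) (mk≋ e) = mk≋ (subst (m ∣_) (eq x y u v) (∣m∣n⇒∣m+n d e))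
      where
      eq : ∀ x y u v → (x - y) + (u - v) ≡ (x + u) - (y + v)
      eq = solve-∀

    ≋-*-cong : ∀ {x y u v} → x ≋ y → u ≋ v → x * u ≋ y * v
    ≋-*-cong {x} {y} {u} {v} (mk≋ d) (mk≋ e) =
      mk≋ (subst (m ∣_) (eq x y u v) (∣m∣n⇒∣m+n (∣m⇒∣m*n u d) (∣n⇒∣m*n y e)))
      where
      eq : ∀ x y u v → (x - y) * u + y * (u - v) ≡ x * u - y * v
      eq = solve-∀

    ≋-neg-cong : ∀ {x y} → x ≋ y → - x ≋ - y
    ≋-neg-cong {x} {y} (mk≋ d) = mk≋ (subst (m ∣_) (eq x y) (∣m⇒∣-m d))
      where
      eq : ∀ x y → - (x - y) ≡ - x - - y
      eq = solve-∀

    ∣⇒≋0 : ∀ {x} → m ∣ x → x ≋ 0ℤ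
    ∣⇒≋0 {x} d = mk≋ (subst (m ∣_) (sym (ℤ.+-identityʳ x)) d)

    ≋0⇒∣ : ∀ {x} → x ≋ 0ℤ → m ∣ x
    ≋0⇒∣ {x} (mk≋ d) = subst (m ∣_) (ℤ.+-identityʳ x) d

    _≋?_ : ∀ x y → Dec (x ≋ y)
    x ≋? y = map′ mk≋ un≋ (m ∣? (x - y))
      where open import Relation.Nullary.Decidable using (map′)

    ring : CommutativeRing 0ℓ 0ℓ
    ring = record
      { Carrier = ℤ ; _≈_ = _≋_ ; _+_ = _+_ ; _*_ = _*_ ; -_ = -_ ; 0# = 0ℤ ; 1# = 1ℤ
      ; isCommutativeRing = record
        { isRing = record
          { +-isAbelianGroup = record
            { isGroup = record
              { isMonoid = record
                { isSemigroup = record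
                  { isMagma = record
                    { isEquivalence = record { refl = ≡⇒≋ refl ; sym = ≋-sym ; trans = ≋-trans }
                    ; ∙-cong = ≋-+-cong }
                  ; assoc = λ x y z → ≡⇒≋ (ℤ.+-assoc x y z) }
                ; identity = (λ x → ≡⇒≋ (ℤ.+-identityˡ x)) , (λ x → ≡⇒≋ (ℤ.+-identityʳ x)) }
              ; inverse = (λ x → ≡⇒≋ (ℤ.+-inverseˡ x)) , (λ x → ≡⇒≋ (ℤ.+-inverseʳ x))
              ; ⁻¹-cong = ≋-neg-cong }
            ; comm = λ x y → ≡⇒≋ (ℤ.+-comm x y) }
          ; *-cong = ≋-*-cong
          ; *-assoc = λ x y z → ≡⇒≋ (ℤ.*-assoc x y z)
          ; *-identity = (λ x → ≡⇒≋ (ℤ.*-identityˡ x)) , (λ x → ≡⇒≋ (ℤ.*-identityʳ x))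
          ; distrib = (λ x y z → ≡⇒≋ (ℤ.*-distribˡ-+ x y z)) , (λ x y z → ≡⇒≋ (ℤ.*-distribʳ-+ x y z)) }
        ; *-comm = λ x y → ≡⇒≋ (ℤ.*-comm x y) }
      }

  module ModPrime (p : ℕ) (p-prime : Prime p) where
    open Modular (+ p) public

    ≋-domain : ∀ x y → x * y ≋ 0ℤ → x ≋ 0ℤ ⊎ y ≋ 0ℤ
    ≋-domain x y d = Sum.map (λ e → ∣⇒≋0 (∣ᵤ⇒∣ e)) (λ e → ∣⇒≋0 (∣ᵤ⇒∣ e))
      (euclidsLemma ∣ x ∣ ∣ y ∣ p-prime (subst (p ℕ∣.∣_) (ℤ.abs-* x y) (∣⇒∣ᵤ (≋0⇒∣ d))))

    1≉0 : ¬ (1ℤ ≋ 0ℤ)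
    1≉0 e = prime⇒≢1 (ℕ∣.∣1⇒≡1 (∣⇒∣ᵤ (≋0⇒∣ e)))
      where
      open import Data.Nat.Primality using (¬prime[1])
      prime⇒≢1 : ¬ (p ≡ 1)
      prime⇒≢1 eq = ¬prime[1] (subst Prime eq p-prime)

  -- ℤ/p is abstracted into a record so that integer arithmetic does not unfold.
  record Coefficients (p : ℕ) : Set₁ where
    field
      ring : CommutativeRing 0ℓ 0ℓ
    open CommutativeRing ring using (Carrier; _≈_; 0#; 1#) renaming (_+_ to _+ᴿ_; _*_ to _*ᴿ_; -_ to -ᴿ_)
    open SemiringMult (CommutativeRing.semiring ring) using () renaming (_×_ to _⋆_)
    field
      ι       : ℤ → Carrier
      ι-+     : ∀ x y → ι (x + y) ≈ ι x +ᴿ ι y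
      ι-neg   : ∀ x → ι (- x) ≈ -ᴿ ι x
      ι-0     : ι 0ℤ ≈ 0#
      ι-1     : ι 1ℤ ≈ 1#
      ι-ker   : ∀ {x} → ι x ≈ 0# → (+ p) ∣ x
      ker-ι   : ∀ {x} → (+ p) ∣ x → ι x ≈ 0#
      domain  : ∀ x y → x *ᴿ y ≈ 0# → x ≈ 0# ⊎ y ≈ 0#
      1≉0     : ¬ (1# ≈ 0#)
      ≈0?     : ∀ x → Dec (x ≈ 0#)
      char    : ∀ x → p ⋆ x ≈ 0#
      -- This and `multiple-unique` number the cosets of the kernel of a character by `Fin p`: the
      -- multiples of one non-zero value run through all residues exactly once.
      multiple : ∀ {t} → ¬ (t ≈ 0#) → ∀ b → Σ[ k ∈ Fin p ] toℕ k ⋆ t ≈ b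
      multiple-unique : ∀ {t} → ¬ (t ≈ 0#) → ∀ (j k : Fin p) → toℕ j ⋆ t ≈ toℕ k ⋆ t → j ≡ k

  module _ (p : ℕ) (p-prime : Prime p) where
    open ModPrime p p-prime
    open CommutativeRing ring using (semiring) renaming (refl to ≈-refl)
    open SemiringMult semiring using () renaming (_×_ to _⋆_)

    private
      ⋆≡* : ∀ n x → n ⋆ x ≡ + n * x
      ⋆≡* ℕ.zero    x = refl
      ⋆≡* (ℕ.suc n) x = trans (cong (λ z → x + z) (⋆≡* n x)) (sym (trans (cong (_* x) (ℤ.pos-+ 1 n)) (trans (ℤ.*-distribʳ-+ x 1ℤ (+ n)) (cong (λ z → z + + n * x) (ℤ.*-identityˡ x)))))

      instance
        nonZero : ℕ.NonZero p
        nonZero = prime⇒nonZero p-prime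

      -- Bézout's identity for `p` and the absolute value of `t`, whose gcd is 1 because `p` is
      -- irreducible; `sgn` puts the sign of `t` into the inverse.
      bezout : ∀ {t} → ¬ (t ≋ 0ℤ) → Σ[ u ∈ ℤ ] u * t ≋ 1ℤ
      bezout {t} t≉0 = case (Bézout.identity (gcd-GCD p ∣ t ∣))
        where
        open import Data.Nat.GCD using (gcd-GCD; module Bézout; gcd[m,n]∣m; gcd[m,n]∣n; gcd)
        g≡1 : gcd p ∣ t ∣ ≡ 1
        g≡1 with prime⇒irreducible p-prime (gcd[m,n]∣m p ∣ t ∣)
        ... | inj₁ eq = eq
        ... | inj₂ eq = ⊥-elim (t≉0 (∣⇒≋0 (∣ᵤ⇒∣ (subst (ℕ∣._∣ ∣ t ∣) eq (gcd[m,n]∣n p ∣ t ∣)))))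
        sgn : Σ[ s ∈ ℤ ] s * t ≡ + ∣ t ∣
        sgn with ℤ.+∣i∣≡i⊎+∣i∣≡-i t
        ... | inj₁ eq = 1ℤ , trans (ℤ.*-identityˡ t) (sym eq)
        ... | inj₂ eq = - 1ℤ , trans (ℤ.-1*i≡-i t) (sym eq)
        s = proj₁ sgn
        case : Bézout.Identity (gcd p ∣ t ∣) p ∣ t ∣ → Σ[ u ∈ ℤ ] u * t ≋ 1ℤ
        case (Bézout.+- x y eq) = - (+ y) * s , mk≋ (divides (- (+ x)) (trans
            (cong (λ z → z - 1ℤ) (trans (ℤ.*-assoc (- (+ y)) s t) (cong (λ z → - (+ y) * z) (proj₂ sgn))))
            (trans (rearr (+ y) (+ ∣ t ∣)) (trans (cong -_ (eqℤ eq)) (ℤ.neg-distribˡ-* (+ x) (+ p))))))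
          where
          rearr : ∀ a b → - a * b - 1ℤ ≡ - (1ℤ + a * b)
          rearr = solve-∀
          eqℤ : gcd p ∣ t ∣ ℕ.+ y ℕ.* ∣ t ∣ ≡ x ℕ.* p → 1ℤ + + y * + ∣ t ∣ ≡ + x * + p
          eqℤ e = trans (trans (cong (λ z → 1ℤ + z) (sym (ℤ.pos-* y ∣ t ∣))) (trans (sym (ℤ.pos-+ 1 (y ℕ.* ∣ t ∣))) (cong +_ (trans (cong (ℕ._+ y ℕ.* ∣ t ∣) (sym g≡1)) e)))) (ℤ.pos-* x p)
        case (Bézout.-+ x y eq) = + y * s , mk≋ (divides (+ x) (trans
            (cong (λ z → z - 1ℤ) (trans (ℤ.*-assoc (+ y) s t) (trans (cong (λ z → + y * z) (proj₂ sgn)) (sym (eqℤ eq)))))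
            (rearr (+ x * + p))))
          where
          rearr : ∀ a → 1ℤ + a - 1ℤ ≡ a
          rearr = solve-∀
          eqℤ : gcd p ∣ t ∣ ℕ.+ x ℕ.* p ≡ y ℕ.* ∣ t ∣ → 1ℤ + + x * + p ≡ + y * + ∣ t ∣
          eqℤ e = trans (trans (cong (λ z → 1ℤ + z) (sym (ℤ.pos-* x p))) (trans (sym (ℤ.pos-+ 1 (x ℕ.* p))) (cong +_ (trans (cong (ℕ._+ x ℕ.* p) (sym g≡1)) e)))) (ℤ.pos-* y ∣ t ∣)

      mult : ∀ {t} → ¬ (t ≋ 0ℤ) → ∀ b → Σ[ k ∈ Fin p ] toℕ k ⋆ t ≋ b
      mult {t} t≉0 b with bezout t≉0
      ... | u , ut≋1 = fromℕ< lt , ≋-trans (≡⇒≋ (trans (cong (_⋆ t) (toℕ-fromℕ< lt)) (⋆≡* r t))) (≋-trans (≋-*-cong r≋ (≡⇒≋ {t} refl)) (≋-trans (≡⇒≋ (ℤ.*-assoc b u t)) (≋-trans (≋-*-cong (≡⇒≋ {b} refl) ut≋1) (≡⇒≋ (ℤ.*-identityʳ b)))))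
        where
        r = (b * u) %ℕ p
        lt : r ℕ.< p
        lt = n%ℕd<d (b * u) p
        r≋ : + r ≋ b * u
        r≋ = mk≋ (divides (- ((b * u) /ℕ p)) (trans (cong (λ z → + r - z) (a≡a%ℕn+[a/ℕn]*n (b * u) p)) (rearr (+ r) ((b * u) /ℕ p) (+ p))))
          where
          rearr : ∀ x q m → x - (x + q * m) ≡ - q * m
          rearr = solve-∀

      mult-unique : ∀ {t} → ¬ (t ≋ 0ℤ) → ∀ (j k : Fin p) → toℕ j ⋆ t ≋ toℕ k ⋆ t → j ≡ k
      mult-unique {t} t≉0 j k (mk≋ d) = toℕ-injective (ℤ.+-injective (ℤ.i-j≡0⇒i≡j _ _ (small (+ toℕ j - + toℕ k) bound dvd)))
        where
        prod : (+ toℕ j - + toℕ k) * t ≋ 0ℤ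
        prod = ∣⇒≋0 (subst (λ z → + p ∣ z) (trans (cong₂ _-_ (⋆≡* (toℕ j) t) (⋆≡* (toℕ k) t)) (rearr (+ toℕ j) (+ toℕ k) t)) d)
          where
          rearr : ∀ a b c → a * c - b * c ≡ (a - b) * c
          rearr = solve-∀
        dvd : p ℕ∣.∣ ∣ + toℕ j - + toℕ k ∣
        dvd = Sum.[ (λ e → ∣⇒∣ᵤ (≋0⇒∣ e)) , (λ e → ⊥-elim (t≉0 e)) ] (≋-domain (+ toℕ j - + toℕ k) t prod)
        bound : ∣ + toℕ j - + toℕ k ∣ ℕ.< p
        bound = subst (ℕ._< p) (sym (cong ∣_∣ (ℤ.[+m]-[+n]≡m⊖n (toℕ j) (toℕ k))))
          (ℕ.≤-<-trans (ℤ.∣m⊝n∣≤m⊔n (toℕ j) (toℕ k)) (ℕ.⊔-lub (toℕ<n j) (toℕ<n k)))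
        small : ∀ z → ∣ z ∣ ℕ.< p → p ℕ∣.∣ ∣ z ∣ → z ≡ 0ℤ
        small z lt dv = ℤ.∣i∣≡0⇒i≡0 (ℕ∣.n∣m⇒m%n≡0 _ _ dv ⟫ lt)
          where
          _⟫_ : ∣ z ∣ ℕ.% p ≡ 0 → ∣ z ∣ ℕ.< p → ∣ z ∣ ≡ 0
          e ⟫ l = trans (sym (m<n⇒m%n≡m l)) e

    coefficients : Coefficients p
    coefficients = record
      { ring = ring
      ; ι = λ x → x
      ; ι-+ = λ x y → ≈-refl
      ; ι-neg = λ x → ≈-refl
      ; ι-0 = ≈-refl
      ; ι-1 = ≈-refl
      ; ι-ker = ≋0⇒∣
      ; ker-ι = ∣⇒≋0
      ; domain = ≋-domain
      ; 1≉0 = 1≉0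
      ; ≈0? = _≋? 0ℤ
      ; char = λ x → ∣⇒≋0 (divides x (trans (⋆≡* p x) (ℤ.*-comm (+ p) x)))
      ; multiple = mult
      ; multiple-unique = mult-unique
      }

open ModularArithmetic

-- Noncommutative power series and leading terms of commutators

module NoncommutativeSeries where
  open import Data.List.Properties using (length-++)

  module Convolution (R : CommutativeRing 0ℓ 0ℓ) (L : Set) where
    open CommutativeRing R hiding (_≉_)
    open import Algebra.Solver.Ring.NaturalCoefficients.Default commutativeSemiring
    open import Relation.Binary.Reasoning.Setoid setoid

    Word : Set
    Word = List L

    Series : Set
    Series = Word → Carrier

    infix 4 _≗_
    _≗_ : Series → Series → Set
    φ ≗ ψ = ∀ ℓ → φ ℓ ≈ ψ ℓ

    ∂ : L → Series → Series
    ∂ l φ ℓ = φ (l ∷ ℓ)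

    infixl 6 _⊕_
    infixl 7 _⊛_ _⊙_

    _⊕_ : Series → Series → Series
    (φ ⊕ ψ) ℓ = φ ℓ + ψ ℓ

    _⊙_ : Carrier → Series → Series
    (a ⊙ φ) ℓ = a * φ ℓ

    𝟘 : Series
    𝟘 _ = 0#

    𝟙 : Series
    𝟙 []      = 1#
    𝟙 (_ ∷ _) = 0#

    -- The Cauchy product, a sum over all splittings of the word, computed letter by letter: the
    -- left factor is empty or begins with the first letter.
    _⊛_ : Series → Series → Series
    (φ ⊛ ψ) []      = φ [] * ψ []
    (φ ⊛ ψ) (l ∷ ℓ) = φ [] * ψ (l ∷ ℓ) + (∂ l φ ⊛ ψ) ℓ

    ⊛-cong : ∀ {φ φ′ ψ ψ′} → φ ≗ φ′ → ψ ≗ ψ′ → φ ⊛ ψ ≗ φ′ ⊛ ψ′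
    ⊛-cong p q []      = *-cong (p []) (q [])
    ⊛-cong p q (l ∷ ℓ) = +-cong (*-cong (p []) (q (l ∷ ℓ))) (⊛-cong (λ m → p (l ∷ m)) q ℓ)

    ⊛-congˡ : ∀ φ {ψ ψ′} → ψ ≗ ψ′ → φ ⊛ ψ ≗ φ ⊛ ψ′
    ⊛-congˡ φ = ⊛-cong {φ} (λ _ → refl)

    ⊛-congʳ : ∀ ψ {φ φ′} → φ ≗ φ′ → φ ⊛ ψ ≗ φ′ ⊛ ψ
    ⊛-congʳ ψ e = ⊛-cong {ψ = ψ} e (λ _ → refl)

    ⊛-distribʳ : ∀ ψ φ φ′ → (φ ⊕ φ′) ⊛ ψ ≗ φ ⊛ ψ ⊕ φ′ ⊛ ψ
    ⊛-distribʳ ψ φ φ′ []      = distribʳ _ _ _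
    ⊛-distribʳ ψ φ φ′ (l ∷ ℓ) = begin
      (φ [] + φ′ []) * ψ (l ∷ ℓ) + (∂ l (φ ⊕ φ′) ⊛ ψ) ℓ
        ≈⟨ +-congˡ (⊛-distribʳ ψ (∂ l φ) (∂ l φ′) ℓ) ⟩
      (φ [] + φ′ []) * ψ (l ∷ ℓ) + ((∂ l φ ⊛ ψ) ℓ + (∂ l φ′ ⊛ ψ) ℓ)
        ≈⟨ solve 5 (λ a b c d e → (a :+ b) :* c :+ (d :+ e) := (a :* c :+ d) :+ (b :* c :+ e)) refl _ _ _ _ _ ⟩
      (φ [] * ψ (l ∷ ℓ) + (∂ l φ ⊛ ψ) ℓ) + (φ′ [] * ψ (l ∷ ℓ) + (∂ l φ′ ⊛ ψ) ℓ) ∎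

    ⊛-distribˡ : ∀ φ ψ ψ′ → φ ⊛ (ψ ⊕ ψ′) ≗ φ ⊛ ψ ⊕ φ ⊛ ψ′
    ⊛-distribˡ φ ψ ψ′ []      = distribˡ _ _ _
    ⊛-distribˡ φ ψ ψ′ (l ∷ ℓ) = begin
      φ [] * (ψ (l ∷ ℓ) + ψ′ (l ∷ ℓ)) + (∂ l φ ⊛ (ψ ⊕ ψ′)) ℓ
        ≈⟨ +-congˡ (⊛-distribˡ (∂ l φ) ψ ψ′ ℓ) ⟩
      φ [] * (ψ (l ∷ ℓ) + ψ′ (l ∷ ℓ)) + ((∂ l φ ⊛ ψ) ℓ + (∂ l φ ⊛ ψ′) ℓ)
        ≈⟨ solve 5 (λ a b c d e → a :* (b :+ c) :+ (d :+ e) := (a :* b :+ d) :+ (a :* c :+ e)) refl _ _ _ _ _ ⟩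
      (φ [] * ψ (l ∷ ℓ) + (∂ l φ ⊛ ψ) ℓ) + (φ [] * ψ′ (l ∷ ℓ) + (∂ l φ ⊛ ψ′) ℓ) ∎

    ⊙-⊛ : ∀ a φ ψ → (a ⊙ φ) ⊛ ψ ≗ a ⊙ (φ ⊛ ψ)
    ⊙-⊛ a φ ψ []      = *-assoc _ _ _
    ⊙-⊛ a φ ψ (l ∷ ℓ) = begin
      a * φ [] * ψ (l ∷ ℓ) + (∂ l (a ⊙ φ) ⊛ ψ) ℓ    ≈⟨ +-congˡ (⊙-⊛ a (∂ l φ) ψ ℓ) ⟩
      a * φ [] * ψ (l ∷ ℓ) + a * (∂ l φ ⊛ ψ) ℓ
        ≈⟨ solve 4 (λ a b c d → a :* b :* c :+ a :* d := a :* (b :* c :+ d)) refl _ _ _ _ ⟩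
      a * (φ [] * ψ (l ∷ ℓ) + (∂ l φ ⊛ ψ) ℓ)        ∎

    ⊛-assoc : ∀ φ ψ χ → (φ ⊛ ψ) ⊛ χ ≗ φ ⊛ (ψ ⊛ χ)
    ⊛-assoc φ ψ χ []      = *-assoc _ _ _
    ⊛-assoc φ ψ χ (l ∷ ℓ) = begin
      φ [] * ψ [] * χ (l ∷ ℓ) + ((φ [] ⊙ ∂ l ψ ⊕ ∂ l φ ⊛ ψ) ⊛ χ) ℓ
        ≈⟨ +-congˡ (⊛-distribʳ χ (φ [] ⊙ ∂ l ψ) (∂ l φ ⊛ ψ) ℓ) ⟩
      φ [] * ψ [] * χ (l ∷ ℓ) + (((φ [] ⊙ ∂ l ψ) ⊛ χ) ℓ + ((∂ l φ ⊛ ψ) ⊛ χ) ℓ)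
        ≈⟨ +-congˡ (+-cong (⊙-⊛ (φ []) (∂ l ψ) χ ℓ) (⊛-assoc (∂ l φ) ψ χ ℓ)) ⟩
      φ [] * ψ [] * χ (l ∷ ℓ) + (φ [] * (∂ l ψ ⊛ χ) ℓ + (∂ l φ ⊛ (ψ ⊛ χ)) ℓ)
        ≈⟨ solve 5 (λ a b c d e → a :* b :* c :+ (a :* d :+ e) := a :* (b :* c :+ d) :+ e) refl _ _ _ _ _ ⟩
      φ [] * (ψ [] * χ (l ∷ ℓ) + (∂ l ψ ⊛ χ) ℓ) + (∂ l φ ⊛ (ψ ⊛ χ)) ℓ ∎

    ⊛-zeroˡ : ∀ {φ} ψ → φ ≗ 𝟘 → φ ⊛ ψ ≗ 𝟘
    ⊛-zeroˡ ψ p []      = trans (*-congʳ (p [])) (zeroˡ _)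
    ⊛-zeroˡ ψ p (l ∷ ℓ) = trans (+-cong (trans (*-congʳ (p [])) (zeroˡ _)) (⊛-zeroˡ ψ (λ m → p (l ∷ m)) ℓ)) (+-identityˡ 0#)

    ⊛-zeroʳ : ∀ φ {ψ} → ψ ≗ 𝟘 → φ ⊛ ψ ≗ 𝟘
    ⊛-zeroʳ φ p []      = trans (*-congˡ (p [])) (zeroʳ _)
    ⊛-zeroʳ φ p (l ∷ ℓ) = trans (+-cong (trans (*-congˡ (p (l ∷ ℓ))) (zeroʳ _)) (⊛-zeroʳ (∂ l φ) p ℓ)) (+-identityˡ 0#)

    ⊛-identityˡ : ∀ φ → 𝟙 ⊛ φ ≗ φ
    ⊛-identityˡ φ []      = *-identityˡ _
    ⊛-identityˡ φ (l ∷ ℓ) = trans (+-cong (*-identityˡ _) (⊛-zeroˡ φ (λ _ → refl) ℓ)) (+-identityʳ _)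

    ⊛-identityʳ : ∀ φ → φ ⊛ 𝟙 ≗ φ
    ⊛-identityʳ φ []      = *-identityʳ _
    ⊛-identityʳ φ (l ∷ ℓ) = trans (+-cong (zeroʳ _) (⊛-identityʳ (∂ l φ) ℓ)) (+-identityˡ _)

    seriesSemiring : Semiring 0ℓ 0ℓ
    seriesSemiring = record
      { Carrier = Series ; _≈_ = _≗_ ; _+_ = _⊕_ ; _*_ = _⊛_ ; 0# = 𝟘 ; 1# = 𝟙
      ; isSemiring = record
        { isSemiringWithoutAnnihilatingZero = record
          { +-isCommutativeMonoid = record
            { isMonoid = record
              { isSemigroup = record
                { isMagma = record
                  { isEquivalence = record
                    { refl = λ _ → refl ; sym = λ p ℓ → sym (p ℓ) ; trans = λ p q ℓ → trans (p ℓ) (q ℓ) }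
                  ; ∙-cong = λ p q ℓ → +-cong (p ℓ) (q ℓ) }
                ; assoc = λ _ _ _ _ → +-assoc _ _ _ }
              ; identity = (λ _ _ → +-identityˡ _) , (λ _ _ → +-identityʳ _) }
            ; comm = λ _ _ _ → +-comm _ _ }
          ; *-cong = ⊛-cong
          ; *-assoc = ⊛-assoc
          ; *-identity = ⊛-identityˡ , ⊛-identityʳ
          ; distrib = ⊛-distribˡ , ⊛-distribʳ }
        ; zero = (λ ψ → ⊛-zeroˡ ψ (λ _ → refl)) , (λ φ → ⊛-zeroʳ φ (λ _ → refl)) }
      }

    Ord : ℕ → Series → Set
    Ord k φ = ∀ ℓ → length ℓ < k → φ ℓ ≈ 0#

    Ord-cong : ∀ {k φ ψ} → φ ≗ ψ → Ord k φ → Ord k ψ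
    Ord-cong eq o ℓ h = trans (sym (eq ℓ)) (o ℓ h)

    Ord-mono : ∀ {j k φ} → j ≤ k → Ord k φ → Ord j φ
    Ord-mono j≤k o ℓ h = o ℓ (ℕ.≤-trans h j≤k)

    ⊛-Ordʳ : ∀ φ {k ψ} → Ord k ψ → Ord k (φ ⊛ ψ)
    ⊛-Ordʳ φ o []      h = trans (*-congˡ (o [] h)) (zeroʳ _)
    ⊛-Ordʳ φ o (l ∷ ℓ) h = trans (+-cong (trans (*-congˡ (o (l ∷ ℓ) h)) (zeroʳ _))
      (⊛-Ordʳ (∂ l φ) o ℓ (ℕ.<-trans (ℕ.n<1+n _) h))) (+-identityˡ 0#)

    ⊛-Ord : ∀ a {b φ ψ} → Ord a φ → Ord b ψ → Ord (a ℕ.+ b) (φ ⊛ ψ)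
    ⊛-Ord zero    {φ = φ} o o′ = ⊛-Ordʳ φ o′
    ⊛-Ord (suc a) o o′ []      h = trans (*-congʳ (o [] (s≤s z≤n))) (zeroˡ _)
    ⊛-Ord (suc a) o o′ (l ∷ ℓ) (s≤s h) = trans
      (+-cong (trans (*-congʳ (o [] (s≤s z≤n))) (zeroˡ _)) (⊛-Ord a (λ m k → o (l ∷ m) (s≤s k)) o′ ℓ h))
      (+-identityˡ 0#)

    ⊛-head : ∀ φ {b ψ} → Ord b ψ → ∀ ℓ → length ℓ ≡ b → (φ ⊛ ψ) ℓ ≈ φ [] * ψ ℓ
    ⊛-head φ o []      h = refl
    ⊛-head φ o (l ∷ ℓ) ≡.refl = trans (+-congˡ (⊛-Ordʳ (∂ l φ) o ℓ (ℕ.n<1+n _))) (+-identityʳ _)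

    -- Of all splittings of the word only the one after `a` letters has both factors long enough to
    -- have non-zero coefficients.
    ⊛-lead : ∀ {a b φ ψ} → Ord a φ → Ord b ψ → ∀ ℓ m → length ℓ ≡ a → length m ≡ b →
             (φ ⊛ ψ) (ℓ ++ m) ≈ φ ℓ * ψ m
    ⊛-lead {φ = φ} o o′ []      m ≡.refl eq = ⊛-head φ o′ m eq
    ⊛-lead o o′ (l ∷ ℓ) m ≡.refl eq = trans
      (+-cong (trans (*-congʳ (o [] (s≤s z≤n))) (zeroˡ _))
              (⊛-lead (λ k h → o (l ∷ k) (s≤s h)) o′ ℓ m ≡.refl eq))
      (+-identityˡ _)

    -- For a series with constant term 1 this is the series minus 1, obtained without subtraction.
    _° : Series → Series
    (φ °) []      = 0#
    (φ °) (l ∷ ℓ) = φ (l ∷ ℓ)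

    °-cong : ∀ {φ ψ} → φ ≗ ψ → φ ° ≗ ψ °
    °-cong eq []      = refl
    °-cong eq (l ∷ ℓ) = eq (l ∷ ℓ)

    °-Ord1 : ∀ φ → Ord 1 (φ °)
    °-Ord1 φ [] h = refl
    °-Ord1 φ (x ∷ ℓ) (s≤s ())

    1+° : ∀ {φ} → φ [] ≈ 1# → φ ≗ 𝟙 ⊕ φ °
    1+° u []      = trans u (sym (+-identityʳ _))
    1+° u (l ∷ ℓ) = sym (+-identityˡ _)

    °-⊛ : ∀ {φ ψ} → φ [] ≈ 1# → ψ [] ≈ 1# → (φ ⊛ ψ) ° ≗ φ ° ⊕ ψ ° ⊕ φ ° ⊛ ψ °
    °-⊛ u v []      = sym (trans (+-cong (+-identityˡ _) (zeroˡ _)) (+-identityˡ _))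
    °-⊛ {φ} {ψ} u v (l ∷ ℓ) = begin
      φ [] * ψ (l ∷ ℓ) + (∂ l φ ⊛ ψ) ℓ
        ≈⟨ +-cong (trans (*-congʳ u) (*-identityˡ _))
            (trans (⊛-congˡ (∂ l φ) (1+° v) ℓ) (⊛-distribˡ (∂ l φ) 𝟙 (ψ °) ℓ)) ⟩
      ψ (l ∷ ℓ) + ((∂ l φ ⊛ 𝟙) ℓ + (∂ l φ ⊛ ψ °) ℓ)
        ≈⟨ +-congˡ (+-congʳ (⊛-identityʳ (∂ l φ) ℓ)) ⟩
      ψ (l ∷ ℓ) + (φ (l ∷ ℓ) + (∂ l φ ⊛ ψ °) ℓ)
        ≈⟨ solve 3 (λ a b c → a :+ (b :+ c) := b :+ a :+ (con 0 :* a :+ c)) refl _ _ _ ⟩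
      φ (l ∷ ℓ) + ψ (l ∷ ℓ) + (0# * ψ (l ∷ ℓ) + (∂ l φ ⊛ ψ °) ℓ) ∎

    -- The hypothesis `eq` says that `w` is the group commutator of `x` and `y`, in a form that
    -- needs no inverses of series.
    module Commutator {x y w : Series} (x₀ : x [] ≈ 1#) (y₀ : y [] ≈ 1#) (w₀ : w [] ≈ 1#)
                      (eq : w ⊛ (y ⊛ x) ≗ x ⊛ y) where

      unit₂ : ∀ {φ ψ} → φ [] ≈ 1# → ψ [] ≈ 1# → (φ ⊛ ψ) [] ≈ 1#
      unit₂ u v = trans (*-cong u v) (*-identityˡ _)

      -- Writing every series as 1 plus its `°` part, the linear terms on both sides of `eq` cancel.
      -- What remains is that `w °` times `y ⊛ x` is the ring commutator of `x °` and `y °`, with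
      -- the negative term moved to the left.
      °-eq : ∀ ℓ → (w °) ℓ + (w ° ⊛ (y ⊛ x) °) ℓ + (y ° ⊛ x °) ℓ ≈ (x ° ⊛ y °) ℓ
      °-eq ℓ = +-cancelˡ ((x °) ℓ + (y °) ℓ) _ _ (begin
        (x °) ℓ + (y °) ℓ + ((w °) ℓ + (w ° ⊛ (y ⊛ x) °) ℓ + (y ° ⊛ x °) ℓ)
          ≈⟨ solve 5 (λ a b c d e → a :+ b :+ (c :+ d :+ e) := c :+ (b :+ a :+ e) :+ d) refl _ _ _ _ _ ⟩
        (w °) ℓ + ((y °) ℓ + (x °) ℓ + (y ° ⊛ x °) ℓ) + (w ° ⊛ (y ⊛ x) °) ℓ
          ≈⟨ +-congʳ (+-congˡ (°-⊛ y₀ x₀ ℓ)) ⟨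
        (w °) ℓ + ((y ⊛ x) °) ℓ + (w ° ⊛ (y ⊛ x) °) ℓ
          ≈⟨ °-⊛ w₀ (unit₂ {y} {x} y₀ x₀) ℓ ⟨
        ((w ⊛ (y ⊛ x)) °) ℓ   ≈⟨ °-cong eq ℓ ⟩
        ((x ⊛ y) °) ℓ         ≈⟨ °-⊛ x₀ y₀ ℓ ⟩
        (x °) ℓ + (y °) ℓ + (x ° ⊛ y °) ℓ ∎)
        where open import Algebra.Properties.Group +-group renaming (∙-cancelˡ to +-cancelˡ)

      -- A bootstrap: if `w °` has order `k`, the error term `w ° ⊛ (y ⊛ x) °` has order `k + 1`, so
      -- `°-eq` raises the order of `w °` until it reaches that of the ring commutator.
      Ord-commutator : ∀ {a b} → Ord a (x °) → Ord b (y °) → ∀ k → k ≤ a ℕ.+ b → Ord k (w °)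
      Ord-commutator {a} {b} ox oy zero    h ℓ ()
      Ord-commutator {a} {b} ox oy (suc k) h ℓ l< = begin
        (w °) ℓ                                                   ≈⟨ trans (+-identityʳ _) (+-identityʳ _) ⟨
        (w °) ℓ + 0# + 0#                                         ≈⟨ +-cong (+-congˡ wyx) yx ⟨
        (w °) ℓ + (w ° ⊛ (y ⊛ x) °) ℓ + (y ° ⊛ x °) ℓ             ≈⟨ °-eq ℓ ⟩
        (x ° ⊛ y °) ℓ                                             ≈⟨ ⊛-Ord a ox oy ℓ (ℕ.≤-trans l< h) ⟩
        0#                                                        ∎
        where
        wyx : (w ° ⊛ (y ⊛ x) °) ℓ ≈ 0#
        wyx = ⊛-Ord k (Ord-commutator ox oy k (ℕ.≤-trans (ℕ.n≤1+n k) h)) (°-Ord1 (y ⊛ x)) ℓ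
                (ℕ.≤-trans l< (ℕ.≤-reflexive (ℕ.+-comm 1 k)))
        yx : (y ° ⊛ x °) ℓ ≈ 0#
        yx = ⊛-Ord b oy ox ℓ (ℕ.≤-trans l< (ℕ.≤-trans h (ℕ.≤-reflexive (ℕ.+-comm a b))))

      -- In degree `a + b` the error term of `°-eq` is gone, and each of the two products of the
      -- ring commutator is read at its only relevant splitting. The splittings differ, since the
      -- orders occur once as `a`, `b` and once as `b`, `a`.
      commutator-lead : ∀ {a b} → Ord a (x °) → Ord b (y °) → ∀ ℓ ℓ₁ ℓ₂ m₁ m₂ →
        ℓ ≡ ℓ₁ ++ ℓ₂ → ℓ ≡ m₁ ++ m₂ →
        length ℓ₁ ≡ a → length ℓ₂ ≡ b → length m₁ ≡ b → length m₂ ≡ a →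
        (w °) ℓ + (y °) m₁ * (x °) m₂ ≈ (x °) ℓ₁ * (y °) ℓ₂
      commutator-lead {a} {b} ox oy ℓ ℓ₁ ℓ₂ m₁ m₂ e₁ e₂ l₁ l₂ k₁ k₂ = begin
        (w °) ℓ + (y °) m₁ * (x °) m₂
          ≈⟨ +-congˡ (⊛-lead oy ox m₁ m₂ k₁ k₂) ⟨
        (w °) ℓ + (y ° ⊛ x °) (m₁ ++ m₂)
          ≡⟨ ≡.cong (λ z → (w °) ℓ + (y ° ⊛ x °) z) e₂ ⟨
        (w °) ℓ + (y ° ⊛ x °) ℓ
          ≈⟨ +-congʳ (trans (+-congˡ wyx) (+-identityʳ _)) ⟨
        (w °) ℓ + (w ° ⊛ (y ⊛ x) °) ℓ + (y ° ⊛ x °) ℓ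
          ≈⟨ °-eq ℓ ⟩
        (x ° ⊛ y °) ℓ
          ≡⟨ ≡.cong (x ° ⊛ y °) e₁ ⟩
        (x ° ⊛ y °) (ℓ₁ ++ ℓ₂)
          ≈⟨ ⊛-lead ox oy ℓ₁ ℓ₂ l₁ l₂ ⟩
        (x °) ℓ₁ * (y °) ℓ₂ ∎
        where
        len : length ℓ ≡ a ℕ.+ b
        len = ≡.trans (≡.cong length e₁) (≡.trans (length-++ ℓ₁) (≡.cong₂ ℕ._+_ l₁ l₂))
        wyx : (w ° ⊛ (y ⊛ x) °) ℓ ≈ 0#
        wyx = ⊛-Ord (a ℕ.+ b) (Ord-commutator ox oy (a ℕ.+ b) ℕ.≤-refl) (°-Ord1 (y ⊛ x)) ℓ
                (ℕ.≤-reflexive (≡.trans (≡.cong suc len) (ℕ.+-comm 1 (a ℕ.+ b))))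

    -- On the powers of one letter the product is the commutative product of power series in one variable.
    ⊛-last : ∀ f φ ψ k → (φ ⊛ ψ) (replicate (suc k) f) ≈ (φ ⊛ ∂ f ψ) (replicate k f) + φ (replicate (suc k) f) * ψ []
    ⊛-last f φ ψ zero    = refl
    ⊛-last f φ ψ (suc k) = trans (+-congˡ (⊛-last f (∂ f φ) ψ k)) (sym (+-assoc _ _ _))

    ⊛-comm-power : ∀ f φ ψ k → (φ ⊛ ψ) (replicate k f) ≈ (ψ ⊛ φ) (replicate k f)
    ⊛-comm-power f φ ψ zero    = *-comm _ _
    ⊛-comm-power f φ ψ (suc k) = begin
      φ [] * ψ (replicate (suc k) f) + (∂ f φ ⊛ ψ) (replicate k f)  ≈⟨ +-cong (*-comm _ _) (⊛-comm-power f (∂ f φ) ψ k) ⟩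
      ψ (replicate (suc k) f) * φ [] + (ψ ⊛ ∂ f φ) (replicate k f)  ≈⟨ +-comm _ _ ⟩
      (ψ ⊛ ∂ f φ) (replicate k f) + ψ (replicate (suc k) f) * φ []  ≈⟨ ⊛-last f ψ φ k ⟨
      (ψ ⊛ φ) (replicate (suc k) f) ∎

    ⊛-zero-powers : ∀ f φ {ψ} k → (∀ j → j ≤ k → ψ (replicate j f) ≈ 0#) → (φ ⊛ ψ) (replicate k f) ≈ 0#
    ⊛-zero-powers f φ zero    h = trans (*-congˡ (h 0 z≤n)) (zeroʳ _)
    ⊛-zero-powers f φ (suc k) h = trans
      (+-cong (trans (*-congˡ (h (suc k) ℕ.≤-refl)) (zeroʳ _)) (⊛-zero-powers f (∂ f φ) k (λ j j≤k → h j (ℕ.≤-trans j≤k (ℕ.n≤1+n k)))))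
      (+-identityˡ 0#)

    -- On the powers of one letter multiplication is commutative, so there `w ⊛ z` equals `z` for
    -- `z = y ⊛ x`, whence `z ⊛ w °` vanishes. As `z` has constant term 1, the coefficients of `w °`
    -- vanish one after the other; `k` bounds the length for this strong induction.
    commutator-powers : ∀ {x y w} → x [] ≈ 1# → y [] ≈ 1# → w [] ≈ 1# → w ⊛ (y ⊛ x) ≗ x ⊛ y →
      ∀ f k j → j ≤ k → (w °) (replicate j f) ≈ 0#
    commutator-powers x₀ y₀ w₀ eq f k zero h = refl
    commutator-powers {x} {y} {w} x₀ y₀ w₀ eq f (suc k) (suc j) (s≤s h) = begin
      w (replicate (suc j) f)                                       ≈⟨ trans (*-congˡ z₀) (*-identityʳ _) ⟨
      w (replicate (suc j) f) * z []                                ≈⟨ *-comm _ _ ⟩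
      z [] * (w °) (replicate (suc j) f)                            ≈⟨ +-identityʳ _ ⟨
      z [] * (w °) (replicate (suc j) f) + 0#                       ≈⟨ +-congˡ lower ⟨
      (z ⊛ w °) (replicate (suc j) f)                               ≈⟨ ⊛-comm-power f z (w °) (suc j) ⟩
      (w ° ⊛ z) (replicate (suc j) f)                               ≈⟨ zero-product ⟩
      0#                                                            ∎
      where
      open import Algebra.Properties.Group +-group renaming (∙-cancelˡ to +-cancelˡ)
      z : Series
      z = y ⊛ x
      z₀ : z [] ≈ 1#
      z₀ = trans (*-cong y₀ x₀) (*-identityˡ _)
      lower : (∂ f z ⊛ w °) (replicate j f) ≈ 0#
      lower = ⊛-zero-powers f (∂ f z) j
        (λ i i≤j → commutator-powers x₀ y₀ w₀ eq f k i (ℕ.≤-trans i≤j h))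
      F = replicate (suc j) f
      zero-product : (w ° ⊛ z) F ≈ 0#
      zero-product = +-cancelˡ (z F) _ _ (begin
        z F + (w ° ⊛ z) F                 ≈⟨ +-congʳ (⊛-identityˡ z F) ⟨
        (𝟙 ⊛ z) F + (w ° ⊛ z) F           ≈⟨ ⊛-distribʳ z 𝟙 (w °) F ⟨
        ((𝟙 ⊕ w °) ⊛ z) F                 ≈⟨ ⊛-congʳ z (1+° {w} w₀) F ⟨
        (w ⊛ z) F                         ≈⟨ eq F ⟩
        (x ⊛ y) F                         ≈⟨ ⊛-comm-power f x y (suc j) ⟩
        z F                               ≈⟨ +-identityʳ _ ⟨
        z F + 0#                          ∎)

open NoncommutativeSeries

-- The Frobenius identity in a semiring of prime characteristic

module FrobeniusPowers where
  open import Data.Fin using (inject₁; fromℕ)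
  open import Data.Fin.Properties using (toℕ<n; toℕ-inject₁; toℕ-fromℕ)
  open import Data.Nat using (_∸_; _!; z<s)
  open import Data.Nat.Combinatorics using (_C_; nCk≡n!/k![n-k]!; k![n∸k]!∣n!; nCn≡1)
  open import Data.Nat.DivMod using (m/n*n≡m)
  open import Data.Nat.Divisibility using (_∣_; divides; m∣m*n; ∣⇒≤; ∣1⇒≡1)
  open import Data.Nat.Primality using (euclidsLemma; ¬prime[0]; ¬prime[1])

  prime∤! : ∀ {p} → Prime p → ∀ k → k < p → ¬ (p ∣ k !)
  prime∤! pr zero    k<p d = ¬prime[1] (≡.subst Prime (∣1⇒≡1 d) pr)
  prime∤! pr (suc k) k<p d with euclidsLemma (suc k) (k !) pr d
  ... | inj₁ e = ℕ.<⇒≱ k<p (∣⇒≤ e)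
  ... | inj₂ e = prime∤! pr k (ℕ.<-trans (ℕ.n<1+n k) k<p) e

  prime∣C : ∀ {p} → Prime p → ∀ k → 0 < k → k < p → p ∣ p C k
  prime∣C {zero}  pr k 0<k k<p = ⊥-elim (¬prime[0] pr)
  prime∣C {suc r} pr k 0<k k<p with euclidsLemma (suc r C k) (k ! ℕ.* (suc r ∸ k) !) pr
      (≡.subst (suc r ∣_) (≡.sym eq) (m∣m*n (r !)))
    where
    instance _ = ℕ._!*_!≢0 k (suc r ∸ k)
    eq : (suc r C k) ℕ.* (k ! ℕ.* (suc r ∸ k) !) ≡ suc r !
    eq = ≡.trans (≡.cong (ℕ._* (k ! ℕ.* (suc r ∸ k) !)) (nCk≡n!/k![n-k]! (ℕ.<⇒≤ k<p)))
                 (m/n*n≡m (k![n∸k]!∣n! (ℕ.<⇒≤ k<p)))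
  ... | inj₁ e = e
  ... | inj₂ e with euclidsLemma (k !) ((suc r ∸ k) !) pr e
  ...   | inj₁ f = ⊥-elim (prime∤! pr k k<p f)
  ...   | inj₂ f = ⊥-elim (prime∤! pr (suc r ∸ k) (ℕ.∸-monoʳ-< 0<k (ℕ.<⇒≤ k<p)) f)

  module Frobenius {a ℓ} (S : Semiring a ℓ) {p} (p-prime : Prime p) where
    open Semiring S hiding (zero)
    open import Algebra.Properties.Semiring.Mult S renaming (_×_ to _⋆_)
    open import Algebra.Properties.Semiring.Exp S
    open import Algebra.Properties.Semiring.Sum S
    open import Relation.Binary.Reasoning.Setoid setoid

    1^ : ∀ n → 1# ^ n ≈ 1#
    1^ zero    = refl
    1^ (suc n) = trans (*-identityˡ _) (1^ n)

    module _ (char : ∀ s → p ⋆ s ≈ 0#) where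

      ∣⇒×≈0 : ∀ {n} → p ∣ n → ∀ s → n ⋆ s ≈ 0#
      ∣⇒×≈0 (divides q ≡.refl) s = trans (sym (×-assocˡ s q p)) (trans (×-congʳ q (char s)) (×0 q))
        where
        ×0 : ∀ n → n ⋆ 0# ≈ 0#
        ×0 zero    = refl
        ×0 (suc n) = trans (+-identityˡ _) (×0 n)

      -- The semiring need not be commutative: `x` commutes with 1, which is enough for the binomial
      -- theorem, and `p` divides the inner binomial coefficients.
      frobenius : ∀ x → (x + 1#) ^ p ≈ 1# + x ^ p
      frobenius x = go p ≡.refl
        where
        open import Algebra.Properties.Semiring.Binomial S x 1#
        go : ∀ q → q ≡ p → (x + 1#) ^ q ≈ 1# + x ^ q
        go zero    eq = ⊥-elim (¬prime[0] (≡.subst Prime (≡.sym eq) p-prime))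
        go (suc q) ≡.refl = begin
          (x + 1#) ^ suc q                     ≈⟨ theorem (trans (*-identityʳ x) (sym (*-identityˡ x))) (suc q) ⟩
          T zero + sum (λ i → T (suc i))       ≈⟨ +-cong first (trans (sum-init-last (λ i → T (suc i))) (trans (+-cong middle last′) (+-identityˡ _))) ⟩
          1# + x ^ suc q                       ∎
          where
          T = binomialTerm (suc q)
          first : T zero ≈ 1#
          first = trans (+-identityʳ _) (trans (*-identityˡ _) (1^ (suc q)))
          vanish : ∀ (i : Fin q) → T (suc (inject₁ i)) ≈ 0#
          vanish i = ∣⇒×≈0 (prime∣C p-prime _ z<s (s≤s (≡.subst (_< q) (≡.sym (toℕ-inject₁ i)) (toℕ<n i)))) _
          middle : sum (λ i → T (suc (inject₁ i))) ≈ 0#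
          middle = trans (sum-cong-≋ vanish) (sum-replicate-zero q)
          last′ : T (suc (fromℕ q)) ≈ x ^ suc q
          last′ rewrite toℕ-fromℕ q | nCn≡1 (suc q) | ℕ.n∸n≡0 q = trans (+-identityʳ _) (*-identityʳ _)

open FrobeniusPowers

-- Prime power powers of series

module SeriesPowers where
  open import Data.List.Properties using (length-replicate)

  module SeriesPower (R : CommutativeRing 0ℓ 0ℓ) (L : Set) {p : ℕ} (p-prime : Prime p) where
    open CommutativeRing R hiding (_≉_; zero)
    open Convolution R L
    open import Algebra.Properties.Semiring.Mult (CommutativeRing.semiring R) using () renaming (_×_ to _⋆_)
    open import Algebra.Properties.Semiring.Exp (CommutativeRing.semiring R) using () renaming (_^_ to _^ᴿ_; ^-congˡ to ^ᴿ-congˡ; ^-assocʳ to ^ᴿ-assocʳ)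
    open import Algebra.Properties.Semiring.Exp seriesSemiring using (_^_; ^-congˡ; ^-assocʳ)
    open import Algebra.Properties.Semiring.Mult seriesSemiring using () renaming (_×_ to _⋆ˢ_)

    replicate-+ : ∀ m n (f : L) → replicate (m ℕ.+ n) f ≡ replicate m f ++ replicate n f
    replicate-+ zero    n f = ≡.refl
    replicate-+ (suc m) n f = ≡.cong (f ∷_) (replicate-+ m n f)

    ^-Ord : ∀ {a φ} k → Ord a φ → Ord (k ℕ.* a) (φ ^ k)
    ^-Ord zero    o ℓ ()
    ^-Ord {a} (suc k) o = ⊛-Ord a o (^-Ord k o)

    ^-lead : ∀ {a φ} k f → Ord a φ → (φ ^ k) (replicate (k ℕ.* a) f) ≈ φ (replicate a f) ^ᴿ k
    ^-lead zero    f o = refl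
    ^-lead {a} {φ} (suc k) f o = trans
      (reflexive (≡.cong (φ ⊛ φ ^ k) (replicate-+ a (k ℕ.* a) f)))
      (trans (⊛-lead o (^-Ord k o) (replicate a f) (replicate (k ℕ.* a) f) (length-replicate a) (length-replicate (k ℕ.* a)))
             (*-congˡ (^-lead k f o)))

    ^-unit : ∀ {φ} k → φ [] ≈ 1# → (φ ^ k) [] ≈ 1#
    ^-unit zero    u = refl
    ^-unit (suc k) u = trans (*-cong u (^-unit k u)) (*-identityˡ _)

    module _ (char : ∀ a → p ⋆ a ≈ 0#) where

      ⋆-point : ∀ n φ ℓ → (n ⋆ˢ φ) ℓ ≈ n ⋆ φ ℓ
      ⋆-point zero    φ ℓ = refl
      ⋆-point (suc n) φ ℓ = +-congˡ (⋆-point n φ ℓ)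

      °-^p : ∀ {φ} → φ [] ≈ 1# → (φ ^ p) ° ≗ (φ °) ^ p
      °-^p {φ} u ℓ = trans (°-cong (λ m → trans (^-congˡ p (λ k → trans (1+° u k) (+-comm _ _)) m) (frobenius ser-char (φ °) m)) ℓ) (go ℓ)
        where
        open Frobenius seriesSemiring p-prime using (frobenius)
        ser-char : ∀ s → p ⋆ˢ s ≗ 𝟘
        ser-char s m = trans (⋆-point p s m) (char (s m))
        go : ((𝟙 ⊕ (φ °) ^ p) °) ≗ (φ °) ^ p
        go []      = sym (^-Ord p (°-Ord1 φ) [] (≡.subst (0 <_) (≡.sym (ℕ.*-identityʳ p)) p>0))
          where
          p>0 : 0 < p
          p>0 = ℕ.>-nonZero⁻¹ p {{prime⇒nonZero p-prime}}
        go (l ∷ m) = +-identityˡ _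

      -- Iterating `°-^p` gives 1 plus the `p ^ k`-th power of `φ °`. So a group element is pushed
      -- deep into the filtration while its leading coefficients on powers of one letter stay
      -- explicit: they are powers of its linear coefficients.
      °-^pᵏ : ∀ {φ} → φ [] ≈ 1# → ∀ k → Ord (p ℕ.^ k) ((φ ^ (p ℕ.^ k)) °) ×
        (∀ f → ((φ ^ (p ℕ.^ k)) °) (replicate (p ℕ.^ k) f) ≈ φ (f ∷ []) ^ᴿ (p ℕ.^ k))
      °-^pᵏ {φ} u zero = °-Ord1 _ , λ f → trans (⊛-identityʳ φ (f ∷ [])) (sym (*-identityʳ _))
      °-^pᵏ {φ} u (suc k) with °-^pᵏ u k
      ... | o , lead = Ord-cong step (^-Ord p o) ,
        λ f → trans (sym (step _)) (trans (^-lead p f o) (trans (^ᴿ-congˡ p (lead f))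
          (trans (^ᴿ-assocʳ _ (p ℕ.^ k) p) (reflexive (≡.cong (φ (f ∷ []) ^ᴿ_) (ℕ.*-comm (p ℕ.^ k) p))))))
        where
        step : ((φ ^ (p ℕ.^ k)) °) ^ p ≗ (φ ^ (p ℕ.^ suc k)) °
        step ℓ = trans (sym (°-^p (^-unit (p ℕ.^ k) u) ℓ)) (°-cong (λ m →
          trans (^-assocʳ φ (p ℕ.^ k) p m) (reflexive (≡.cong (λ j → (φ ^ j) m) (ℕ.*-comm (p ℕ.^ k) p)))) ℓ)

open SeriesPowers

-- Magnus series and net counts of walks

module MagnusExpansion where
  open import Data.Integer using (ℤ; 0ℤ; 1ℤ)
  open import Data.Product.Properties using (≡-dec)
  open import Relation.Binary.Construct.Closure.ReflexiveTransitive using (Star; ε; _◅_; _◅◅_; gmap)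
  open import Relation.Binary.Construct.Closure.ReflexiveTransitive.Properties using (◅◅-assoc)

  module Walking (Γ : Graph) {p : ℕ} (coeff : Coefficients p) where
    open Graph Γ public using (Vertex; Adj; Adj-sym; Adj?; Adj-irrefl)
    open Coefficients coeff public using (ι; ι-+; ι-neg; ι-0; ι-1)

    Walk : Vertex → Vertex → Set
    Walk = Star Adj

    Letter : Set
    Letter = Vertex × Vertex

    _≟ᴸ_ : (a b : Letter) → Dec (a ≡ b)
    _≟ᴸ_ = ≡-dec Fin._≟_ Fin._≟_

    open CommutativeRing (Coefficients.ring coeff) hiding (_≉_; _-_)
    open Convolution (Coefficients.ring coeff) Letter public
    open import Algebra.Properties.Ring (CommutativeRing.ring (Coefficients.ring coeff)) using (-1*x≈-x)
    open import Relation.Binary.Reasoning.Setoid setoid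

    [_] : ∀ {P : Set} → Dec P → Carrier
    [ yes _ ] = 1#
    [ no _ ]  = 0#

    [_]ᶻ : ∀ {P : Set} → Dec P → ℤ
    [ yes _ ]ᶻ = 1ℤ
    [ no _ ]ᶻ  = 0ℤ

    ι-[] : ∀ {P : Set} (d : Dec P) → [ d ] ≈ ι [ d ]ᶻ
    ι-[] (yes _) = sym ι-1
    ι-[] (no _)  = sym ι-0

    []-cong : ∀ {A : Set} (f : ∀ {P : Set} → Dec P → A) → (∀ {P Q : Set} (x : P) (y : Q) → f (yes x) ≡ f (yes y)) →
      (∀ {P Q : Set} (x : ¬ P) (y : ¬ Q) → f (no x) ≡ f (no y)) →
      ∀ {P Q : Set} (d : Dec P) (e : Dec Q) → (P → Q) → (Q → P) → f d ≡ f e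
    []-cong f y n (yes a) (yes b) g h = y a b
    []-cong f y n (yes a) (no ¬b) g h = contradiction (g a) ¬b
    []-cong f y n (no ¬a) (yes b) g h = contradiction (h b) ¬a
    []-cong f y n (no a)  (no b)  g h = n a b

    -- The series 1 + X and (1 + X)⁻¹ in the variable X of a letter.
    up dn : Letter → Series
    up a []      = 1#
    up a (l ∷ ℓ) = [ l ≟ᴸ a ] * 𝟙 ℓ
    dn a []      = 1#
    dn a (l ∷ ℓ) = [ l ≟ᴸ a ] * - dn a ℓ

    up⊛dn : ∀ a → up a ⊛ dn a ≗ 𝟙
    up⊛dn a []      = *-identityˡ 1#
    up⊛dn a (l ∷ ℓ) = begin
      1# * (i * - dn a ℓ) + ((i ⊙ 𝟙) ⊛ dn a) ℓ
        ≈⟨ +-cong (*-identityˡ _) (trans (⊙-⊛ i 𝟙 (dn a) ℓ) (*-congˡ (⊛-identityˡ (dn a) ℓ))) ⟩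
      i * - dn a ℓ + i * dn a ℓ      ≈⟨ distribˡ i _ _ ⟨
      i * (- dn a ℓ + dn a ℓ)        ≈⟨ *-congˡ (-‿inverseˡ _) ⟩
      i * 0#                         ≈⟨ zeroʳ i ⟩
      0#                             ∎
      where i = [ l ≟ᴸ a ]

    dn⊛up : ∀ a → dn a ⊛ up a ≗ 𝟙
    dn⊛up a []      = *-identityˡ 1#
    dn⊛up a (l ∷ ℓ) = begin
      1# * (i * 𝟙 ℓ) + ((i ⊙ (λ m → - dn a m)) ⊛ up a) ℓ
        ≈⟨ +-cong (*-identityˡ _) (⊙-⊛ i (λ m → - dn a m) (up a) ℓ) ⟩
      i * 𝟙 ℓ + i * ((λ m → - dn a m) ⊛ up a) ℓ
        ≈⟨ +-congˡ (*-congˡ (trans (⊛-congʳ (up a) (λ m → sym (-1*x≈-x (dn a m))) ℓ)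
              (trans (⊙-⊛ (- 1#) (dn a) (up a) ℓ) (trans (*-congˡ (dn⊛up a ℓ)) (-1*x≈-x (𝟙 ℓ)))))) ⟩
      i * 𝟙 ℓ + i * - 𝟙 ℓ            ≈⟨ distribˡ i _ _ ⟨
      i * (𝟙 ℓ + - 𝟙 ℓ)              ≈⟨ *-congˡ (-‿inverseʳ _) ⟩
      i * 0#                         ≈⟨ zeroʳ i ⟩
      0#                             ∎
      where i = [ l ≟ᴸ a ]

    -- Each arc has its own variable, and a step contributes that of the arc and inversely that of
    -- the opposite arc. Thus opposite steps are inverse to each other, no orientation of the edges
    -- is chosen, and automorphisms act by permuting the variables.
    stepSeries : Vertex → Vertex → Series
    stepSeries u v = up (u , v) ⊛ dn (v , u)

    -- Depends on the vertices only, not on the proofs of adjacency.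
    magnus : ∀ {u v} → Walk u v → Series
    magnus ε                   = 𝟙
    magnus (_◅_ {u} {v} _ W)   = stepSeries u v ⊛ magnus W

    stepNet : Vertex → Vertex → Letter → ℤ
    stepNet u v l = [ l ≟ᴸ (u , v) ]ᶻ ℤ.- [ l ≟ᴸ (v , u) ]ᶻ

    net : ∀ {u v} → Walk u v → Letter → ℤ
    net ε l                 = 0ℤ
    net (_◅_ {u} {v} _ W) l = stepNet u v l ℤ.+ net W l

    rev : ∀ {u v} → Walk u v → Walk v u
    rev ε       = ε
    rev (a ◅ W) = rev W ◅◅ (Adj-sym a ◅ ε)

    infix 4 _≐_
    -- A substitute for homotopy of walks. Cancelling a backtrack changes neither invariant, and the
    -- kernels are defined by these two invariants alone, so reduced walks never have to be formed.
    record _≐_ {u v} (W W′ : Walk u v) : Set where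
      constructor mk≐
      field
        magnus≗ : magnus W ≗ magnus W′
        net≡    : ∀ l → net W l ≡ net W′ l
    open _≐_ public

    magnus-◅◅ : ∀ {u v w} (W : Walk u v) (W′ : Walk v w) → magnus (W ◅◅ W′) ≗ magnus W ⊛ magnus W′
    magnus-◅◅ ε W′ ℓ = sym (⊛-identityˡ (magnus W′) ℓ)
    magnus-◅◅ (_◅_ {u} {v} a W) W′ ℓ = trans
      (⊛-congˡ (stepSeries u v) (magnus-◅◅ W W′) ℓ)
      (sym (⊛-assoc (stepSeries u v) (magnus W) (magnus W′) ℓ))

    net-◅◅ : ∀ {u v w} (W : Walk u v) (W′ : Walk v w) l → net (W ◅◅ W′) l ≡ net W l ℤ.+ net W′ l
    net-◅◅ ε W′ l = ≡.sym (ℤₚ.+-identityˡ _)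
    net-◅◅ (_◅_ {u} {v} a W) W′ l = ≡.trans (≡.cong (λ z → stepNet u v l ℤ.+ z) (net-◅◅ W W′ l))
      (≡.sym (ℤₚ.+-assoc (stepNet u v l) (net W l) (net W′ l)))

    magnus-[] : ∀ {u v} (W : Walk u v) → magnus W [] ≈ 1#
    magnus-[] ε       = refl
    magnus-[] (a ◅ W) = trans (*-cong (*-identityˡ 1#) (magnus-[] W)) (*-identityˡ 1#)

    stepSeries-inv : ∀ u v → stepSeries u v ⊛ stepSeries v u ≗ 𝟙
    stepSeries-inv u v ℓ = begin
      ((A ⊛ B′) ⊛ (B ⊛ A′)) ℓ   ≈⟨ ⊛-assoc A B′ (B ⊛ A′) ℓ ⟩
      (A ⊛ (B′ ⊛ (B ⊛ A′))) ℓ   ≈⟨ ⊛-congˡ A (λ m → trans (sym (⊛-assoc B′ B A′ m))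
          (trans (⊛-congʳ A′ (dn⊛up (v , u)) m) (⊛-identityˡ A′ m))) ℓ ⟩
      (A ⊛ A′) ℓ                ≈⟨ up⊛dn (u , v) ℓ ⟩
      𝟙 ℓ                       ∎
      where
      A = up (u , v)
      A′ = dn (u , v)
      B = up (v , u)
      B′ = dn (v , u)

    ⊛-unit-mid : ∀ φ {ψ ψ′} χ → ψ ⊛ ψ′ ≗ 𝟙 → (φ ⊛ ψ) ⊛ (ψ′ ⊛ χ) ≗ φ ⊛ χ
    ⊛-unit-mid φ {ψ} {ψ′} χ eq ℓ = begin
      ((φ ⊛ ψ) ⊛ (ψ′ ⊛ χ)) ℓ   ≈⟨ ⊛-assoc φ ψ (ψ′ ⊛ χ) ℓ ⟩
      (φ ⊛ (ψ ⊛ (ψ′ ⊛ χ))) ℓ   ≈⟨ ⊛-congˡ φ (λ m → trans (sym (⊛-assoc ψ ψ′ χ m))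
          (trans (⊛-congʳ χ eq m) (⊛-identityˡ χ m))) ℓ ⟩
      (φ ⊛ χ) ℓ                ∎

    magnus-rev : ∀ {u v} (W : Walk u v) → magnus (rev W) ⊛ magnus W ≗ 𝟙
    magnus-rev ε = ⊛-identityˡ 𝟙
    magnus-rev (_◅_ {u} {v} a W) ℓ = begin
      (magnus (rev W ◅◅ (Adj-sym a ◅ ε)) ⊛ (stepSeries u v ⊛ magnus W)) ℓ
        ≈⟨ ⊛-congʳ (stepSeries u v ⊛ magnus W) (λ m → trans (magnus-◅◅ (rev W) (Adj-sym a ◅ ε) m)
             (⊛-congˡ (magnus (rev W)) (⊛-identityʳ (stepSeries v u)) m)) ℓ ⟩
      ((magnus (rev W) ⊛ stepSeries v u) ⊛ (stepSeries u v ⊛ magnus W)) ℓ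
        ≈⟨ ⊛-unit-mid (magnus (rev W)) (magnus W) (stepSeries-inv v u) ℓ ⟩
      (magnus (rev W) ⊛ magnus W) ℓ ≈⟨ magnus-rev W ℓ ⟩
      𝟙 ℓ ∎

    magnus-rev′ : ∀ {u v} (W : Walk u v) → magnus W ⊛ magnus (rev W) ≗ 𝟙
    magnus-rev′ ε = ⊛-identityˡ 𝟙
    magnus-rev′ (_◅_ {u} {v} a W) ℓ = begin
      ((S ⊛ magnus W) ⊛ magnus (rev W ◅◅ (Adj-sym a ◅ ε))) ℓ
        ≈⟨ ⊛-congˡ (S ⊛ magnus W) (λ m → trans (magnus-◅◅ (rev W) (Adj-sym a ◅ ε) m)
             (⊛-congˡ (magnus (rev W)) (⊛-identityʳ S′) m)) ℓ ⟩
      ((S ⊛ magnus W) ⊛ (magnus (rev W) ⊛ S′)) ℓ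
        ≈⟨ ⊛-unit-mid S S′ (magnus-rev′ W) ℓ ⟩
      (S ⊛ S′) ℓ ≈⟨ stepSeries-inv u v ℓ ⟩
      𝟙 ℓ ∎
      where
      S = stepSeries u v
      S′ = stepSeries v u

    stepNet-rev : ∀ u v l → stepNet v u l ≡ ℤ.- stepNet u v l
    stepNet-rev u v l = eq [ l ≟ᴸ (u , v) ]ᶻ [ l ≟ᴸ (v , u) ]ᶻ
      where
      eq : ∀ x y → y ℤ.- x ≡ ℤ.- (x ℤ.- y)
      eq = solve-∀

    net-rev : ∀ {u v} (W : Walk u v) l → net (rev W) l ≡ ℤ.- net W l
    net-rev ε l = ≡.refl
    net-rev (_◅_ {u} {v} a W) l = ≡.trans (net-◅◅ (rev W) (Adj-sym a ◅ ε) l)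
      (≡.trans (≡.cong₂ ℤ._+_ (net-rev W l) (≡.cong (ℤ._+ 0ℤ) (stepNet-rev u v l))) (eq (net W l) (stepNet u v l)))
      where
      eq : ∀ x y → ℤ.- x ℤ.+ (ℤ.- y ℤ.+ 0ℤ) ≡ ℤ.- (y ℤ.+ x)
      eq = solve-∀

    ≐-refl : ∀ {u v} {W : Walk u v} → W ≐ W
    ≐-refl = mk≐ (λ _ → refl) (λ _ → ≡.refl)

    ≡⇒≐ : ∀ {u v} {W W′ : Walk u v} → W ≡ W′ → W ≐ W′
    ≡⇒≐ ≡.refl = ≐-refl

    ≐-sym : ∀ {u v} {W W′ : Walk u v} → W ≐ W′ → W′ ≐ W
    ≐-sym (mk≐ c n) = mk≐ (λ ℓ → sym (c ℓ)) (λ l → ≡.sym (n l))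

    ≐-trans : ∀ {u v} {W W′ W″ : Walk u v} → W ≐ W′ → W′ ≐ W″ → W ≐ W″
    ≐-trans (mk≐ c n) (mk≐ c′ n′) = mk≐ (λ ℓ → trans (c ℓ) (c′ ℓ)) (λ l → ≡.trans (n l) (n′ l))

    ◅◅-cong : ∀ {u v w} {W W′ : Walk u v} {Y Y′ : Walk v w} → W ≐ W′ → Y ≐ Y′ → W ◅◅ Y ≐ W′ ◅◅ Y′
    ◅◅-cong {W = W} {W′} {Y} {Y′} (mk≐ c n) (mk≐ c′ n′) = mk≐
      (λ ℓ → trans (magnus-◅◅ W Y ℓ) (trans (⊛-cong c c′ ℓ) (sym (magnus-◅◅ W′ Y′ ℓ))))
      (λ l → ≡.trans (net-◅◅ W Y l) (≡.trans (≡.cong₂ ℤ._+_ (n l) (n′ l)) (≡.sym (net-◅◅ W′ Y′ l))))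

    ◅◅-congˡ : ∀ {u v w} (W : Walk u v) {Y Y′ : Walk v w} → Y ≐ Y′ → W ◅◅ Y ≐ W ◅◅ Y′
    ◅◅-congˡ W = ◅◅-cong (≐-refl {W = W})

    ◅◅-congʳ : ∀ {u v w} (Y : Walk v w) {W W′ : Walk u v} → W ≐ W′ → W ◅◅ Y ≐ W′ ◅◅ Y
    ◅◅-congʳ Y e = ◅◅-cong e (≐-refl {W = Y})

    ≐-assoc : ∀ {u v w x} (W : Walk u v) (Y : Walk v w) (Z : Walk w x) → (W ◅◅ Y) ◅◅ Z ≐ W ◅◅ (Y ◅◅ Z)
    ≐-assoc W Y Z = ≡⇒≐ (◅◅-assoc W Y Z)

    ≐-assoc⁻¹ : ∀ {u v w x} (W : Walk u v) (Y : Walk v w) (Z : Walk w x) → W ◅◅ (Y ◅◅ Z) ≐ (W ◅◅ Y) ◅◅ Z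
    ≐-assoc⁻¹ W Y Z = ≐-sym (≐-assoc W Y Z)

    ◅◅-identityʳ : ∀ {u v} (W : Walk u v) → W ◅◅ ε ≡ W
    ◅◅-identityʳ ε       = ≡.refl
    ◅◅-identityʳ (a ◅ W) = ≡.cong (a ◅_) (◅◅-identityʳ W)

    ≐-identityʳ : ∀ {u v} (W : Walk u v) → W ◅◅ ε ≐ W
    ≐-identityʳ W = ≡⇒≐ (◅◅-identityʳ W)

    rev-inverseˡ : ∀ {u v} (W : Walk u v) → rev W ◅◅ W ≐ ε
    rev-inverseˡ W = mk≐ (λ ℓ → trans (magnus-◅◅ (rev W) W ℓ) (magnus-rev W ℓ))
      (λ l → ≡.trans (net-◅◅ (rev W) W l) (≡.trans (≡.cong (ℤ._+ net W l) (net-rev W l)) (ℤₚ.+-inverseˡ (net W l))))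

    rev-inverseʳ : ∀ {u v} (W : Walk u v) → W ◅◅ rev W ≐ ε
    rev-inverseʳ W = mk≐ (λ ℓ → trans (magnus-◅◅ W (rev W) ℓ) (magnus-rev′ W ℓ))
      (λ l → ≡.trans (net-◅◅ W (rev W) l) (≡.trans (≡.cong (λ z → net W l ℤ.+ z) (net-rev W l)) (ℤₚ.+-inverseʳ (net W l))))

    rev-cong : ∀ {u v} {W W′ : Walk u v} → W ≐ W′ → rev W ≐ rev W′
    rev-cong {W = W} {W′} (mk≐ c n) = mk≐
      (λ ℓ → begin
        magnus (rev W) ℓ                                        ≈⟨ ⊛-identityʳ (magnus (rev W)) ℓ ⟨
        (magnus (rev W) ⊛ 𝟙) ℓ                                  ≈⟨ ⊛-congˡ (magnus (rev W)) (magnus-rev′ W′) ℓ ⟨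
        (magnus (rev W) ⊛ (magnus W′ ⊛ magnus (rev W′))) ℓ      ≈⟨ ⊛-assoc (magnus (rev W)) (magnus W′) (magnus (rev W′)) ℓ ⟨
        ((magnus (rev W) ⊛ magnus W′) ⊛ magnus (rev W′)) ℓ      ≈⟨ ⊛-congʳ (magnus (rev W′)) (λ m → trans
            (⊛-congˡ (magnus (rev W)) (λ k → sym (c k)) m) (magnus-rev W m)) ℓ ⟩
        (𝟙 ⊛ magnus (rev W′)) ℓ                                 ≈⟨ ⊛-identityˡ (magnus (rev W′)) ℓ ⟩
        magnus (rev W′) ℓ                                       ∎)
      (λ l → ≡.trans (net-rev W l) (≡.trans (≡.cong ℤ.-_ (n l)) (≡.sym (net-rev W′ l))))

    step-irrelevant : ∀ {u v} (a b : Adj u v) → (a ◅ ε) ≐ (b ◅ ε)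
    step-irrelevant a b = mk≐ (λ _ → refl) (λ _ → ≡.refl)

    -- Walks through the same vertices, whose end points need not be definitionally equal.
    data Same : ∀ {u v u′ v′} → Walk u v → Walk u′ v′ → Set where
      same-ε : ∀ {u u′} → u ≡ u′ → Same (ε {x = u}) (ε {x = u′})
      same-◅ : ∀ {u v w u′ v′ w′} {a : Adj u v} {a′ : Adj u′ v′} {W : Walk v w} {W′ : Walk v′ w′} →
               u ≡ u′ → v ≡ v′ → Same W W′ → Same (a ◅ W) (a′ ◅ W′)

    same-end : ∀ {u v u′ v′} {W : Walk u v} {W′ : Walk u′ v′} → Same W W′ → v ≡ v′
    same-end (same-ε e)     = e
    same-end (same-◅ _ _ S) = same-end S

    same-magnus : ∀ {u v u′ v′} {W : Walk u v} {W′ : Walk u′ v′} → Same W W′ → magnus W ≗ magnus W′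
    same-magnus (same-ε _) ℓ = refl
    same-magnus (same-◅ {u} {v} ≡.refl ≡.refl S) ℓ = ⊛-congˡ (stepSeries u v) (same-magnus S) ℓ

    same-net : ∀ {u v u′ v′} {W : Walk u v} {W′ : Walk u′ v′} → Same W W′ → ∀ l → net W l ≡ net W′ l
    same-net (same-ε _) l = ≡.refl
    same-net (same-◅ {u} {v} ≡.refl ≡.refl S) l = ≡.cong (λ z → stepNet u v l ℤ.+ z) (same-net S l)

    same⇒≐ : ∀ {u v} {W W′ : Walk u v} → Same W W′ → W ≐ W′
    same⇒≐ S = mk≐ (same-magnus S) (same-net S)

    same-refl : ∀ {u v} (W : Walk u v) → Same W W
    same-refl ε       = same-ε ≡.refl
    same-refl (a ◅ W) = same-◅ ≡.refl ≡.refl (same-refl W)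

    same-trans : ∀ {u v u′ v′ u″ v″} {W : Walk u v} {W′ : Walk u′ v′} {W″ : Walk u″ v″} → Same W W′ → Same W′ W″ → Same W W″
    same-trans (same-ε e) (same-ε e′) = same-ε (≡.trans e e′)
    same-trans (same-◅ e f S) (same-◅ e′ f′ S′) = same-◅ (≡.trans e e′) (≡.trans f f′) (same-trans S S′)

    same-◅◅ : ∀ {u v w u′ v′ w′} {W : Walk u v} {Z : Walk v w} {W′ : Walk u′ v′} {Z′ : Walk v′ w′} → Same W W′ → Same Z Z′ → Same (W ◅◅ Z) (W′ ◅◅ Z′)
    same-◅◅ (same-ε _) T = T
    same-◅◅ (same-◅ e f S) T = same-◅ e f (same-◅◅ S T)

    same-sym : ∀ {u v u′ v′} {W : Walk u v} {W′ : Walk u′ v′} → Same W W′ → Same W′ W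
    same-sym (same-ε e)     = same-ε (≡.sym e)
    same-sym (same-◅ e f S) = same-◅ (≡.sym e) (≡.sym f) (same-sym S)

    same-rev : ∀ {u v u′ v′} {W : Walk u v} {W′ : Walk u′ v′} → Same W W′ → Same (rev W) (rev W′)
    same-rev (same-ε e)     = same-ε e
    same-rev (same-◅ e f S) = same-◅◅ (same-rev S) (same-◅ f e (same-ε e))

    same-rev-rev : ∀ {u v} (W : Walk u v) → Same (rev (rev W)) W
    same-rev-rev ε       = same-ε ≡.refl
    same-rev-rev (a ◅ W) = same-trans (rev-snoc (rev W) (Adj-sym a)) (same-◅ ≡.refl ≡.refl (same-rev-rev W))
      where
      rev-snoc : ∀ {u v w} (X : Walk u v) (b : Adj v w) → Same (rev (X ◅◅ (b ◅ ε))) (Adj-sym b ◅ rev X)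
      rev-snoc ε       b = same-refl _
      rev-snoc (c ◅ X) b = same-◅◅ (rev-snoc X b) (same-refl (Adj-sym c ◅ ε))

    same-subst : ∀ {u u′ v} (e : u ≡ u′) (W : Walk u v) → Same (≡.subst (λ z → Walk z v) e W) W
    same-subst ≡.refl W = same-refl W

    -- Linear coefficients add under products of series with constant term 1, and a single step
    -- contributes 1 at its arc and -1 at the opposite arc. This ties the leading terms of powers of
    -- loops to their net counts.
    magnus-letter : ∀ {u v} (W : Walk u v) l → magnus W (l ∷ []) ≈ ι (net W l)
    magnus-letter ε l = sym ι-0
    magnus-letter (_◅_ {u} {v} a W) l = begin
      1# * 1# * magnus W (l ∷ []) + (1# * (y * - 1#) + x * 1# * 1#) * magnus W []
        ≈⟨ +-cong (trans (*-congʳ (*-identityˡ 1#)) (trans (*-identityˡ _) (magnus-letter W l)))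
             (trans (*-congˡ (magnus-[] W)) (trans (*-identityʳ _) (+-cong (trans (*-identityˡ _) (trans (*-comm _ _) (-1*x≈-x y)))
               (trans (*-identityʳ _) (*-identityʳ _))))) ⟩
      ι (net W l) + (- y + x)   ≈⟨ +-congˡ (+-comm _ _) ⟩
      ι (net W l) + (x + - y)   ≈⟨ +-comm _ _ ⟩
      (x + - y) + ι (net W l)
        ≈⟨ +-congʳ (trans (+-cong (ι-[] (l ≟ᴸ (u , v))) (trans (-‿cong (ι-[] (l ≟ᴸ (v , u)))) (sym (ι-neg _)))) (sym (ι-+ _ _))) ⟩
      ι (stepNet u v l) + ι (net W l)   ≈⟨ ι-+ _ _ ⟨
      ι (stepNet u v l ℤ.+ net W l)     ∎
      where
      x = [ l ≟ᴸ (u , v) ]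
      y = [ l ≟ᴸ (v , u) ]

    module _ (π : Vertex → Vertex) (π-inj : ∀ {u v} → π u ≡ π v → u ≡ v) where
      mapᴸ : Letter → Letter
      mapᴸ (u , v) = π u , π v

      mapᴸ-inj : ∀ {l a} → mapᴸ l ≡ mapᴸ a → l ≡ a
      mapᴸ-inj e = ≡.cong₂ _,_ (π-inj (≡.cong proj₁ e)) (π-inj (≡.cong proj₂ e))

      mapᴸ-[] : ∀ l a → [ mapᴸ l ≟ᴸ mapᴸ a ] ≡ [ l ≟ᴸ a ]
      mapᴸ-[] l a = []-cong [_] (λ _ _ → ≡.refl) (λ _ _ → ≡.refl) (mapᴸ l ≟ᴸ mapᴸ a) (l ≟ᴸ a) mapᴸ-inj (≡.cong mapᴸ)

      mapᴸ-[]ᶻ : ∀ l a → [ mapᴸ l ≟ᴸ mapᴸ a ]ᶻ ≡ [ l ≟ᴸ a ]ᶻ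
      mapᴸ-[]ᶻ l a = []-cong [_]ᶻ (λ _ _ → ≡.refl) (λ _ _ → ≡.refl) (mapᴸ l ≟ᴸ mapᴸ a) (l ≟ᴸ a) mapᴸ-inj (≡.cong mapᴸ)

      up-map : ∀ a ℓ → up (mapᴸ a) (map mapᴸ ℓ) ≡ up a ℓ
      up-map a []            = ≡.refl
      up-map a (l ∷ [])      = ≡.cong (_* 1#) (mapᴸ-[] l a)
      up-map a (l ∷ k ∷ ℓ)   = ≡.cong (_* 0#) (mapᴸ-[] l a)

      dn-map : ∀ a ℓ → dn (mapᴸ a) (map mapᴸ ℓ) ≡ dn a ℓ
      dn-map a []      = ≡.refl
      dn-map a (l ∷ ℓ) = ≡.cong₂ (λ x y → x * - y) (mapᴸ-[] l a) (dn-map a ℓ)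

      ⊛-map : ∀ (f : Letter → Letter) φ ψ ℓ → (φ ⊛ ψ) (map f ℓ) ≡ ((λ m → φ (map f m)) ⊛ (λ m → ψ (map f m))) ℓ
      ⊛-map f φ ψ []      = ≡.refl
      ⊛-map f φ ψ (l ∷ ℓ) = ≡.cong (φ [] * ψ (f l ∷ map f ℓ) +_) (⊛-map f (∂ (f l) φ) ψ ℓ)

      module _ (π-adj : ∀ {u v} → Adj u v → Adj (π u) (π v)) where
        mapᵂ : ∀ {u v} → Walk u v → Walk (π u) (π v)
        mapᵂ = gmap π π-adj

        -- An injective map of vertices renames the variables of every step; injectivity keeps
        -- distinct letters distinct.
        magnus-map : ∀ {u v} (W : Walk u v) ℓ → magnus (mapᵂ W) (map mapᴸ ℓ) ≈ magnus W ℓ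
        magnus-map ε []      = refl
        magnus-map ε (l ∷ ℓ) = refl
        magnus-map (_◅_ {u} {v} a W) ℓ = trans (reflexive (⊛-map mapᴸ (stepSeries (π u) (π v)) (magnus (mapᵂ W)) ℓ))
          (⊛-cong (λ m → trans (reflexive (⊛-map mapᴸ (up (π u , π v)) (dn (π v , π u)) m))
              (⊛-cong (λ k → reflexive (up-map (u , v) k)) (λ k → reflexive (dn-map (v , u) k)) m))
            (magnus-map W) ℓ)

        net-map : ∀ {u v} (W : Walk u v) l → net (mapᵂ W) (mapᴸ l) ≡ net W l
        net-map ε l = ≡.refl
        net-map (_◅_ {u} {v} a W) l = ≡.cong₂ ℤ._+_
          (≡.cong₂ ℤ._-_ (mapᴸ-[]ᶻ l (u , v)) (mapᴸ-[]ᶻ l (v , u))) (net-map W l)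

open MagnusExpansion

-- Nested commutators that are selective on the translates of a word

module SelectiveLoops where
  open import Data.Integer using (ℤ; 0ℤ)
  open import Data.List.Properties using (length-++; length-replicate; length-map; map-++; map-replicate; map-id; ++-assoc)
  open import Data.List.Relation.Unary.All using (All; []; _∷_)
  open import Data.Nat using (_∸_; _^_)
  open import Relation.Binary.Construct.Closure.ReflexiveTransitive using (ε; _◅◅_)

  n<m^n : ∀ {m} → 2 ≤ m → ∀ n → n < m ^ n
  n<m^n 2≤m zero    = s≤s z≤n
  n<m^n {m} 2≤m (suc n) = ℕ.≤-trans (s≤s (n<m^n 2≤m n)) (ℕ.≤-trans
    (ℕ.≤-trans (ℕ.+-monoˡ-≤ (m ^ n) (ℕ.≤-trans (s≤s z≤n) (n<m^n 2≤m n)))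
      (ℕ.≤-reflexive (≡.cong (m ^ n ℕ.+_) (≡.sym (ℕ.+-identityʳ _)))))
    (ℕ.*-monoˡ-≤ (m ^ n) 2≤m))

  module Separator (Γ : Graph) {p : ℕ} (p-prime : Prime p) (coeff : Coefficients p) where
    open Walking Γ coeff
    open Coefficients coeff using (domain; 1≉0; char)
    open CommutativeRing (Coefficients.ring coeff) hiding (_≉_; _-_; zero)
    open SeriesPower (Coefficients.ring coeff) Letter p-prime
    open import Algebra.Properties.Semiring.Exp (CommutativeRing.semiring (Coefficients.ring coeff)) using () renaming (_^_ to _^ᴿ_; ^-congˡ to ^ᴿ-congˡ)
    open import Algebra.Properties.Semiring.Exp seriesSemiring using () renaming (_^_ to _^ˢ_)
    open import Relation.Binary.Reasoning.Setoid setoid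

    pow : ∀ {v} → Walk v v → ℕ → Walk v v
    pow W zero    = ε
    pow W (suc k) = W ◅◅ pow W k

    magnus-pow : ∀ {v} (W : Walk v v) k → magnus (pow W k) ≗ magnus W ^ˢ k
    magnus-pow W zero    ℓ = refl
    magnus-pow W (suc k) ℓ = trans (magnus-◅◅ W (pow W k) ℓ) (⊛-congˡ (magnus W) (magnus-pow W k) ℓ)

    commutator : ∀ {v} → Walk v v → Walk v v → Walk v v
    commutator x y = (x ◅◅ y) ◅◅ (rev x ◅◅ rev y)

    magnus-commutator : ∀ {v} (x y : Walk v v) → magnus (commutator x y) ⊛ (magnus y ⊛ magnus x) ≗ magnus x ⊛ magnus y
    magnus-commutator x y ℓ = begin
      (magnus (commutator x y) ⊛ (Y ⊛ X)) ℓ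
        ≈⟨ ⊛-congʳ (Y ⊛ X) (λ m → trans (magnus-◅◅ (x ◅◅ y) (rev x ◅◅ rev y) m)
              (⊛-cong (magnus-◅◅ x y) (magnus-◅◅ (rev x) (rev y)) m)) ℓ ⟩
      (((X ⊛ Y) ⊛ (X′ ⊛ Y′)) ⊛ (Y ⊛ X)) ℓ      ≈⟨ ⊛-assoc (X ⊛ Y) (X′ ⊛ Y′) (Y ⊛ X) ℓ ⟩
      ((X ⊛ Y) ⊛ ((X′ ⊛ Y′) ⊛ (Y ⊛ X))) ℓ
        ≈⟨ ⊛-congˡ (X ⊛ Y) (λ m → trans (⊛-unit-mid X′ X (magnus-rev y) m) (magnus-rev x m)) ℓ ⟩
      ((X ⊛ Y) ⊛ 𝟙) ℓ                          ≈⟨ ⊛-identityʳ (X ⊛ Y) ℓ ⟩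
      (X ⊛ Y) ℓ                                ∎
      where
      X = magnus x
      Y = magnus y
      X′ = magnus (rev x)
      Y′ = magnus (rev y)

    net-commutator : ∀ {v} (x y : Walk v v) l → net (commutator x y) l ≡ 0ℤ
    net-commutator x y l = ≡.trans (net-◅◅ (x ◅◅ y) (rev x ◅◅ rev y) l)
      (≡.trans (≡.cong₂ ℤ._+_ (net-◅◅ x y l) (≡.trans (net-◅◅ (rev x) (rev y) l) (≡.cong₂ ℤ._+_ (net-rev x l) (net-rev y l))))
        (eq (net x l) (net y l)))
      where
      eq : ∀ a b → (a ℤ.+ b) ℤ.+ (ℤ.- a ℤ.+ ℤ.- b) ≡ 0ℤ
      eq = solve-∀

    ≉-^ : ∀ {x} → ¬ (x ≈ 0#) → ∀ k → ¬ (x ^ᴿ k ≈ 0#)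
    ≉-^ x≉0 zero    e = 1≉0 e
    ≉-^ {x} x≉0 (suc k) e with domain x (x ^ᴿ k) e
    ... | inj₁ e₁ = x≉0 e₁
    ... | inj₂ e₂ = ≉-^ x≉0 k e₂

    ^-≈0 : ∀ {x} → x ≈ 0# → ∀ k → 0 < k → x ^ᴿ k ≈ 0#
    ^-≈0 x≈0 (suc k) _ = trans (*-congʳ x≈0) (zeroˡ _)

    module _ (v₀ : Vertex) where

      -- A test excludes the letter maps that send `letter` to a letter where the net count of
      -- `loop` is divisible by `p`; `detected` ensures that the identity passes.
      record Test : Set where
        constructor test
        field
          letter   : Letter
          loop     : Walk v₀ v₀
          detected : ¬ (ι (net loop letter) ≈ 0#)
      open Test

      -- The invariant of the iterated commutators. `net≡0` puts the loop into kernels with any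
      -- modulus for the net counts, `powers` kills the second term of the next bracket, and
      -- `selective` collects the tests passed by every letter map under which the coefficient
      -- survives.
      record Witness (tests : List Test) : Set where
        field
          word      : Word
          loop      : Walk v₀ v₀
          net≡0     : ∀ l → net loop l ≡ 0ℤ
          ord       : Ord (length word) (magnus loop °)
          powers    : ∀ f k → (magnus loop °) (replicate k f) ≈ 0#
          nonzero   : ¬ ((magnus loop °) word ≈ 0#)
          selective : ∀ (π : Letter → Letter) → ¬ ((magnus loop °) (map π word) ≈ 0#) →
                      All (λ t → ¬ (ι (net (Test.loop t) (π (letter t))) ≈ 0#)) tests

      -- The coefficient of the commutator on the word `ab` is the product of the counts of `x` at
      -- `a` and `y` at `b` minus that of `y` at `a` and `x` at `b`. The second product is zero
      -- since `x` does not see `b`.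
      witness-base : ∀ (x y : Walk v₀ v₀) a b → ¬ (ι (net x a) ≈ 0#) → ι (net x b) ≈ 0# → ¬ (ι (net y b) ≈ 0#) → Witness []
      witness-base x y a b xa xb yb = record
        { word = a ∷ b ∷ []
        ; loop = w
        ; net≡0 = net-commutator x y
        ; ord = Ord-commutator (°-Ord1 (magnus x)) (°-Ord1 (magnus y)) 2 ℕ.≤-refl
        ; powers = λ f k → commutator-powers (magnus-[] x) (magnus-[] y) (magnus-[] w) (magnus-commutator x y) f k k ℕ.≤-refl
        ; nonzero = λ e → nz (trans (sym lead) (trans (+-cong e (trans (*-congˡ (trans (magnus-letter x b) xb)) (zeroʳ _))) (+-identityˡ 0#)))
        ; selective = λ _ _ → []
        }
        where
        w = commutator x y
        open Commutator (magnus-[] x) (magnus-[] y) (magnus-[] w) (magnus-commutator x y)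
        lead = commutator-lead (°-Ord1 (magnus x)) (°-Ord1 (magnus y)) (a ∷ b ∷ []) (a ∷ []) (b ∷ []) (a ∷ []) (b ∷ [])
          ≡.refl ≡.refl ≡.refl ≡.refl ≡.refl ≡.refl
        nz : ¬ (magnus x (a ∷ []) * magnus y (b ∷ []) ≈ 0#)
        nz e with domain _ _ e
        ... | inj₁ e₁ = xa (trans (sym (magnus-letter x a)) e₁)
        ... | inj₂ e₂ = yb (trans (sym (magnus-letter y b)) e₂)

      -- The p-power block of the new letter is long enough for its beginning, on which the inner
      -- commutator is read in the second term of the bracket, to be a power of one letter.
      witness-step : ∀ t {tests} → Witness tests → Witness (t ∷ tests)
      witness-step t W = record
        { word = word₁
        ; loop = w
        ; net≡0 = net-commutator Y (loop₂)
        ; ord = ≡.subst (λ k → Ord k (magnus w °)) (≡.sym len₁) (Ord-commutator ordY ord₂ (q ℕ.+ s) ℕ.≤-refl)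
        ; powers = λ f k → commutator-powers (magnus-[] Y) (magnus-[] loop₂) (magnus-[] w) (magnus-commutator Y loop₂) f k k ℕ.≤-refl
        ; nonzero = λ e → nz (trans (sym (value (λ l → l))) (trans (reflexive (≡.cong (magnus w °) (map-id word₁))) e))
        ; selective = λ π ne →
            (λ e → ne (trans (value π) (trans (*-congʳ (^-≈0 (trans (magnus-letter y (π a)) e) q q>0)) (zeroˡ _)))) ∷
            selective₂ π (λ e → ne (trans (value π) (trans (*-congˡ e) (zeroʳ _))))
        }
        where
        open Witness W renaming (word to ℓ; loop to loop₂; ord to ord₂; powers to powers₂; nonzero to nonzero₂; selective to selective₂)
        open Test t renaming (letter to a; loop to y)
        s = length ℓ
        q = p ^ s
        2≤p : 2 ≤ p
        2≤p = ℕ.nonTrivial⇒n>1 p {{prime⇒nonTrivial p-prime}}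
        s≤q : s ≤ q
        s≤q = ℕ.<⇒≤ (n<m^n 2≤p s)
        q>0 : 0 < q
        q>0 = ℕ.≤-trans (s≤s z≤n) (n<m^n 2≤p s)
        Y = pow y q
        word₁ = replicate q a ++ ℓ
        w = commutator Y loop₂
        len₁ : length word₁ ≡ q ℕ.+ s
        len₁ = ≡.trans (length-++ (replicate q a)) (≡.cong (ℕ._+ s) (length-replicate q))
        powY = °-^pᵏ char (magnus-[] y) s
        ordY : Ord q (magnus Y °)
        ordY = Ord-cong (°-cong (λ m → sym (magnus-pow y q m))) (proj₁ powY)
        leadY : ∀ f → (magnus Y °) (replicate q f) ≈ magnus y (f ∷ []) ^ᴿ q
        leadY f = trans (°-cong (magnus-pow y q) (replicate q f)) (proj₂ powY f)
        open Commutator (magnus-[] Y) (magnus-[] loop₂) (magnus-[] w) (magnus-commutator Y loop₂)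
        -- Valid for every letter map: the first factor is a power of the net count of `y` at `π a`,
        -- the second is the coefficient of the inner commutator. So both `nonzero` and `selective`
        -- are read off this product.
        value : ∀ π → (magnus w °) (map π word₁) ≈ magnus y (π a ∷ []) ^ᴿ q * (magnus loop₂ °) (map π ℓ)
        value π = begin
          (magnus w °) (map π word₁)                     ≈⟨ +-identityʳ _ ⟨
          (magnus w °) (map π word₁) + 0#
            ≈⟨ +-congˡ (trans (*-congʳ (powers₂ (π a) s)) (zeroˡ _)) ⟨
          (magnus w °) (map π word₁) + (magnus loop₂ °) (replicate s (π a)) * (magnus Y °) (replicate (q ∸ s) (π a) ++ map π ℓ)
            ≈⟨ commutator-lead ordY ord₂ (map π word₁) (replicate q (π a)) (map π ℓ) (replicate s (π a)) (replicate (q ∸ s) (π a) ++ map π ℓ)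
                 split₁ split₂ (length-replicate q) (length-map π ℓ) (length-replicate s)
                 (≡.trans (length-++ (replicate (q ∸ s) (π a))) (≡.trans (≡.cong₂ ℕ._+_ (length-replicate (q ∸ s)) (length-map π ℓ)) (ℕ.m∸n+n≡m s≤q))) ⟩
          (magnus Y °) (replicate q (π a)) * (magnus loop₂ °) (map π ℓ)  ≈⟨ *-congʳ (leadY (π a)) ⟩
          magnus y (π a ∷ []) ^ᴿ q * (magnus loop₂ °) (map π ℓ)          ∎
          where
          split₁ : map π word₁ ≡ replicate q (π a) ++ map π ℓ
          split₁ = ≡.trans (map-++ π (replicate q a) ℓ) (≡.cong (_++ map π ℓ) (map-replicate π q a))
          split₂ : map π word₁ ≡ replicate s (π a) ++ (replicate (q ∸ s) (π a) ++ map π ℓ)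
          split₂ = ≡.trans split₁ (≡.trans
            (≡.cong (_++ map π ℓ) (≡.trans (≡.cong (λ k → replicate k (π a)) (≡.sym (ℕ.m+[n∸m]≡n s≤q))) (replicate-+ s (q ∸ s) (π a))))
            (++-assoc (replicate s (π a)) (replicate (q ∸ s) (π a)) (map π ℓ)))
        nz : ¬ (magnus y (a ∷ []) ^ᴿ q * (magnus loop₂ °) (map (λ l → l) ℓ) ≈ 0#)
        nz e with domain _ _ e
        ... | inj₁ e₁ = ≉-^ (λ z → Test.detected t (trans (sym (magnus-letter y a)) z)) q e₁
        ... | inj₂ e₂ = nonzero₂ (trans (reflexive (≡.cong (magnus loop₂ °) (≡.sym (map-id ℓ)))) e₂)

      witness : ∀ {ts} → Witness [] → Witness ts
      witness {[]}     W = W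
      witness {t ∷ ts} W = witness-step t (witness W)

open SelectiveLoops

-- Edge cuts of an edge-transitive tetravalent graph

module EdgeCuts where
  open import Data.Bool using (Bool; true; false; _∧_; _∨_; not; _xor_)
  import Data.Bool.Properties as Bool
  open import Data.Fin.Permutation using (_⟨$⟩ˡ_; inverseˡ)
  open import Data.List using (filter; tabulate)
  open import Data.Nat using (_+_; _*_; _≤?_)
  open import Data.Nat.Induction using (<-wellFounded)
  open import Induction.WellFounded using (Acc; acc)
  open import Relation.Binary.Construct.Closure.ReflexiveTransitive using (Star; ε; _◅_)
  open ≡ using (refl; sym; trans; cong; cong₂; subst₂)
  open import Relation.Unary using (Pred; Decidable)

  open Sums ℕ.+-0-commutativeMonoid


  sum-mono : ∀ {n} {f g : Fin n → ℕ} → (∀ i → f i ≤ g i) → sum f ≤ sum g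
  sum-mono {zero}  h = z≤n
  sum-mono {suc n} h = ℕ.+-mono-≤ (h zero) (sum-mono (h ∘ suc))

  sum-strict : ∀ {n} {f g : Fin n → ℕ} → (∀ i → f i ≤ g i) → ∀ i → f i < g i → sum f < sum g
  sum-strict h zero    lt = ℕ.+-mono-<-≤ lt (sum-mono (h ∘ suc))
  sum-strict h (suc i) lt = ℕ.+-mono-≤-< (h zero) (sum-strict (h ∘ suc) i lt)

  term≤sum : ∀ {n} (f : Fin n → ℕ) i → f i ≤ sum f
  term≤sum f zero    = ℕ.m≤m+n _ _
  term≤sum f (suc i) = ℕ.≤-trans (term≤sum (f ∘ suc) i) (ℕ.m≤n+m _ _)

  two-terms≤sum : ∀ {n} (f : Fin n → ℕ) i j → i ≢ j → f i + f j ≤ sum f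
  two-terms≤sum f zero    zero    ne = ⊥-elim (ne refl)
  two-terms≤sum f zero    (suc j) ne = ℕ.+-monoʳ-≤ (f zero) (term≤sum (f ∘ suc) j)
  two-terms≤sum f (suc i) zero    ne = ℕ.≤-trans (ℕ.≤-reflexive (ℕ.+-comm (f (suc i)) (f zero))) (ℕ.+-monoʳ-≤ (f zero) (term≤sum (f ∘ suc) i))
  two-terms≤sum f (suc i) (suc j) ne = ℕ.≤-trans (two-terms≤sum (f ∘ suc) i j (ne ∘ cong suc)) (ℕ.m≤n+m _ _)

  sum≤n : ∀ {n} (f : Fin n → ℕ) → (∀ i → f i ≤ 1) → sum f ≤ n
  sum≤n {zero}  f h = z≤n
  sum≤n {suc n} f h = ℕ.+-mono-≤ (h zero) (sum≤n (f ∘ suc) (h ∘ suc))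

  infix 9 #_
  #_ : Bool → ℕ
  # true  = 1
  # false = 0

  #≤1 : ∀ b → # b ≤ 1
  #≤1 true  = s≤s z≤n
  #≤1 false = z≤n

  length-filter-tabulate : ∀ {A : Set} {P : Pred A 0ℓ} (P? : Decidable P) {n} (f : Fin n → A) →
    length (filter P? (tabulate f)) ≡ sum (λ i → # does (P? (f i)))
  length-filter-tabulate P? {zero}  f = refl
  length-filter-tabulate P? {suc n} f with does (P? (f zero))
  ... | true  = cong suc (length-filter-tabulate P? (f ∘ suc))
  ... | false = length-filter-tabulate P? (f ∘ suc)

  module EdgeConnectivity (Γ : Graph) (connected : Connected Γ) (tetravalent : Tetravalent Γ)
                          (G : Subgroup (Aut Γ)) (edge-transitive : EdgeTransitive G) where
    open Graph Γ renaming (order to n)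

    VertexSet : Set
    VertexSet = Vertex → Bool

    adj : Vertex → Vertex → Bool
    adj u v = does (Adj? u v)

    adj-true : ∀ {u v} → Adj u v → adj u v ≡ true
    adj-true {u} {v} a with Adj? u v
    ... | yes _ = refl
    ... | no ¬a = contradiction a ¬a

    crossing : VertexSet → Vertex → Vertex → Bool
    crossing X u v = adj u v ∧ (X u xor X v)

    -- Every edge is counted twice, once in each direction.
    cut : VertexSet → ℕ
    cut X = sum λ u → sum λ v → # crossing X u v

    size : VertexSet → ℕ
    size X = sum λ u → # X u

    -- The lexicographic order on cut and size in one number, as the size never exceeds `n`.
    measure : VertexSet → ℕ
    measure X = cut X * suc n + size X

    sum₂-mono : ∀ {f g h k : Vertex → Vertex → ℕ} → (∀ u v → f u v + g u v ≤ h u v + k u v) →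
      sum (λ u → sum (f u)) + sum (λ u → sum (g u)) ≤ sum (λ u → sum (h u)) + sum (λ u → sum (k u))
    sum₂-mono {f} {g} {h} {k} le = subst₂ _≤_ (merge f g) (merge h k) (sum-mono (λ u → sum-mono (le u)))
      where
      merge : ∀ (f g : Vertex → Vertex → ℕ) → sum (λ u → sum (λ v → f u v + g u v)) ≡ sum (λ u → sum (f u)) + sum (λ u → sum (g u))
      merge f g = trans (sum-cong-≋ (λ u → ∑-distrib-+ (f u) (g u))) (∑-distrib-+ (λ u → sum (f u)) (λ u → sum (g u)))

    -- The inequality holds for every ordered pair of vertices separately, by the truth table of the
    -- memberships of its two ends; `posimodular` is its variant for the two differences.
    submodular : ∀ X Y → cut (λ u → X u ∧ Y u) + cut (λ u → X u ∨ Y u) ≤ cut X + cut Y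
    submodular X Y = sum₂-mono (λ u v → go (adj u v) (X u) (X v) (Y u) (Y v))
      where
      go : ∀ a x x′ y y′ → # (a ∧ ((x ∧ y) xor (x′ ∧ y′))) + # (a ∧ ((x ∨ y) xor (x′ ∨ y′))) ≤ # (a ∧ (x xor x′)) + # (a ∧ (y xor y′))
      go false x     x′    y     y′    = z≤n
      go true  true  true  true  true  = z≤n
      go true  true  true  true  false = s≤s z≤n
      go true  true  true  false true  = s≤s z≤n
      go true  true  true  false false = z≤n
      go true  true  false true  true  = s≤s z≤n
      go true  true  false true  false = s≤s (s≤s z≤n)
      go true  true  false false true  = z≤n
      go true  true  false false false = s≤s z≤n
      go true  false true  true  true  = s≤s z≤n
      go true  false true  true  false = z≤n
      go true  false true  false true  = s≤s (s≤s z≤n)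
      go true  false true  false false = s≤s z≤n
      go true  false false true  true  = z≤n
      go true  false false true  false = s≤s z≤n
      go true  false false false true  = s≤s z≤n
      go true  false false false false = z≤n

    posimodular : ∀ X Y → cut (λ u → X u ∧ not (Y u)) + cut (λ u → Y u ∧ not (X u)) ≤ cut X + cut Y
    posimodular X Y = sum₂-mono (λ u v → go (adj u v) (X u) (X v) (Y u) (Y v))
      where
      go : ∀ a x x′ y y′ → # (a ∧ ((x ∧ not y) xor (x′ ∧ not y′))) + # (a ∧ ((y ∧ not x) xor (y′ ∧ not x′))) ≤ # (a ∧ (x xor x′)) + # (a ∧ (y xor y′))
      go false x     x′    y     y′    = z≤n
      go true  true  true  true  true  = z≤n
      go true  true  true  true  false = s≤s z≤n
      go true  true  true  false true  = s≤s z≤n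
      go true  true  true  false false = z≤n
      go true  true  false true  true  = s≤s z≤n
      go true  true  false true  false = z≤n
      go true  true  false false true  = s≤s (s≤s z≤n)
      go true  true  false false false = s≤s z≤n
      go true  false true  true  true  = s≤s z≤n
      go true  false true  true  false = s≤s (s≤s z≤n)
      go true  false true  false true  = z≤n
      go true  false true  false false = s≤s z≤n
      go true  false false true  true  = z≤n
      go true  false false true  false = s≤s z≤n
      go true  false false false true  = s≤s z≤n
      go true  false false false false = z≤n

    translate : Automorphism Γ → VertexSet → VertexSet
    translate g X u = X (Automorphism.perm g ⟨$⟩ˡ u)

    adj-invariant : ∀ (g : Automorphism Γ) u v → adj (g · u) (g · v) ≡ adj u v
    adj-invariant g u v with Adj? u v | Adj? (g · u) (g · v)
    ... | yes _ | yes _ = refl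
    ... | yes a | no ¬b = contradiction (Equivalence.to (Automorphism.preserves g u v) a) ¬b
    ... | no ¬a | yes b = contradiction (Equivalence.from (Automorphism.preserves g u v) b) ¬a
    ... | no _  | no _  = refl

    cut-translate : ∀ (g : Automorphism Γ) X → cut (translate g X) ≡ cut X
    cut-translate g X = trans (sum-permute _ π) (sum-cong-≋ λ u → trans (sum-permute _ π) (sum-cong-≋ λ v →
        cong #_ (cong₂ _∧_ (adj-invariant g u v) (cong₂ _xor_ (cong X (inverseˡ π)) (cong X (inverseˡ π))))))
      where π = Automorphism.perm g

    crossing-edge : ∀ (X : VertexSet) {u v} → Star Adj u v → X u ≡ true → X v ≡ false →
      ∃[ c ] ∃[ d ] Adj c d × X c ≡ true × X d ≡ false
    crossing-edge X ε p q = ⊥-elim (case (trans (sym p) q))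
      where
      case : true ≡ false → ⊥
      case ()
    crossing-edge X (_◅_ {u} {w} a W) p q with X w in eq
    ... | true  = crossing-edge X W eq q
    ... | false = u , w , a , p , eq

    -- All four edges at `a` leave `X`, which gives 4 in the row of `a`; as edges are counted in
    -- both directions, the row of a neighbour of `a` supplies one more.
    no-internal-edge⇒5≤cut : ∀ X a → X a ≡ true → (∀ u v → Adj u v → X u ≡ true → X v ≡ true → ⊥) → 5 ≤ cut X
    no-internal-edge⇒5≤cut X a Xa none = go (nbr (rowa))
      where
      row : Vertex → ℕ
      row u = sum (λ v → # crossing X u v)
      cross : ∀ v → crossing X a v ≡ adj a v
      cross v with Adj? a v
      ... | no _  = refl
      ... | yes b with X v in eq
      ...   | true  = ⊥-elim (none a v b Xa eq)
      ...   | false rewrite Xa = refl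
      rowa : row a ≡ 4
      rowa = trans (sum-cong-≋ (λ v → cong #_ (cross v))) (trans (sym (length-filter-tabulate (Adj? a) (λ v → v))) (tetravalent a))
      nbr : row a ≡ 4 → ∃[ b ] Adj a b
      nbr eq with Fin.any? (λ v → Adj? a v)
      ... | yes r = r
      ... | no ¬r = ⊥-elim (case (trans (sym eq) (zero-row)))
        where
        case : 4 ≡ 0 → ⊥
        case ()
        zero-row : row a ≡ 0
        zero-row = sum-zero z
          where
          z : ∀ v → # crossing X a v ≡ 0
          z v with Adj? a v
          ... | yes b = ⊥-elim (¬r (v , b))
          ... | no _  = refl
      go : ∃[ b ] Adj a b → 5 ≤ cut X
      go (b , ab) = ℕ.≤-trans (ℕ.+-mono-≤ (ℕ.≤-reflexive (sym rowa)) 1≤rowb) (two-terms≤sum row a b a≢b)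
        where
        a≢b : a ≢ b
        a≢b eq = Adj-irrefl eq ab
        entry : # crossing X b a ≡ 1
        entry rewrite adj-true (Adj-sym ab) | Xa with X b in eq
        ... | true  = ⊥-elim (none a b ab Xa eq)
        ... | false = refl
        1≤rowb : 1 ≤ row b
        1≤rowb = ℕ.≤-trans (ℕ.≤-reflexive (sym entry)) (term≤sum (λ v → # crossing X b v) a)

    -- Uncrossing: if gX splits an edge inside X, then one of X ∩ gX, X ∖ gX, X ∪ gX, gX ∖ X is a
    -- proper set with smaller measure.
    5≤cut-acc : ∀ X → Acc _<_ (measure X) → ∀ {a b} → X a ≡ true → X b ≡ false → 5 ≤ cut X
    5≤cut-acc X (acc rec) {a₀} {b₀} Xa₀ Xb₀ with 5 ≤? cut X
    ... | yes h = h
    ... | no  ¬h with Fin.any? (λ u → Fin.any? (λ v → Adj? u v ×-dec (X u Bool.≟ true ×-dec X v Bool.≟ true)))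
    ...   | no none = no-internal-edge⇒5≤cut X a₀ Xa₀ (λ u v uv Xu Xv → none (u , v , uv , Xu , Xv))
    ...   | yes (a , b , ab , Xa , Xb) with crossing-edge X (connected a₀ b₀) Xa₀ Xb₀
    -- An automorphism carrying the crossing edge `cd` onto the internal edge `ab` makes the
    -- translate of `X` separate the ends of `ab`.
    ...     | c , d , cd , Xc , Xd with edge-transitive cd ab
    ...       | g , _ , image = ⊥-elim (finish (split image))
      where
      Y = translate g X
      π = Automorphism.perm g
      Yg : ∀ u → Y (g · u) ≡ X u
      Yg u = cong X (inverseˡ π)
      cutY : cut Y ≡ cut X
      cutY = cut-translate g X
      split : (g · c ≡ a × g · d ≡ b) ⊎ (g · c ≡ b × g · d ≡ a) →
        Σ[ x ∈ Vertex ] Σ[ y ∈ Vertex ] X x ≡ true × X y ≡ true × Y x ≡ true × Y y ≡ false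
      split (inj₁ (refl , refl)) = a , b , Xa , Xb , trans (Yg c) Xc , trans (Yg d) Xd
      split (inj₂ (refl , refl)) = b , a , Xb , Xa , trans (Yg c) Xc , trans (Yg d) Xd
      small : cut X ≤ 4
      small = ℕ.≤-pred (ℕ.≰⇒> ¬h)
      IH : ∀ Z {u v} → Z u ≡ true → Z v ≡ false → measure Z < measure X → cut X < cut Z
      IH Z p q lt = ℕ.≤-<-trans small (5≤cut-acc Z (rec lt) p q)
      smaller-size : ∀ Z → (∀ u → Z u ≡ true → X u ≡ true) → ∀ {y} → X y ≡ true → Z y ≡ false → size Z < size X
      smaller-size Z sub {y} Xy Zy = sum-strict pointwise y (subst₂ (λ r t → # r < # t) (sym Zy) (sym Xy) (s≤s z≤n))
        where
        pointwise : ∀ u → # Z u ≤ # X u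
        pointwise u with Z u in eq
        ... | false = z≤n
        ... | true rewrite sub u eq = s≤s z≤n
      -- If the cut of `Z` does not exceed that of `X`, the smaller size makes the measure drop and
      -- the induction hypothesis applies; otherwise there is nothing to show.
      larger : ∀ Z → (∀ u → Z u ≡ true → X u ≡ true) → ∀ {x y} → Z x ≡ true → X y ≡ true → Z y ≡ false → cut X < cut Z
      larger Z sub Zx Xy Zy with cut Z ≤? cut X
      ... | yes le = IH Z Zx Zy (ℕ.+-mono-≤-< (ℕ.*-monoˡ-≤ (suc n) le) (smaller-size Z sub Xy Zy))
      ... | no ¬le = ℕ.≰⇒> ¬le
      -- A drop of the cut outweighs any growth of the size, so `Z` may be large here; the induction
      -- hypothesis then contradicts the drop.
      less : ∀ Z → cut Z < cut X → ∀ {u v} → Z u ≡ true → Z v ≡ false → ⊥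
      less Z lt p q = ℕ.<-asym lt (IH Z p q
        (ℕ.≤-trans (s≤s (ℕ.+-monoʳ-≤ (cut Z * suc n) (sum≤n (λ u → # Z u) (λ u → #≤1 (Z u)))))
          (ℕ.≤-trans (ℕ.≤-reflexive (trans (sym (ℕ.+-suc (cut Z * suc n) n)) (ℕ.+-comm (cut Z * suc n) (suc n))))
            (ℕ.≤-trans (ℕ.*-monoˡ-≤ (suc n) lt) (ℕ.m≤m+n _ (size X))))))
      other : ∀ {i j} → i + j ≤ cut X + cut Y → cut X < i → j < cut X
      other {i} {j} le lt = ℕ.+-cancelˡ-< (cut X) j (cut X)
        (ℕ.<-≤-trans (ℕ.+-monoˡ-< j lt) (ℕ.≤-trans le (ℕ.≤-reflexive (cong (cut X +_) cutY))))
      ∧ˡ : ∀ {r t} → r ∧ t ≡ true → r ≡ true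
      ∧ˡ {true} _ = refl
      finish : Σ[ x ∈ Vertex ] Σ[ y ∈ Vertex ] X x ≡ true × X y ≡ true × Y x ≡ true × Y y ≡ false → ⊥
      -- `I` and `A` are non-empty proper parts of `X`, so their cuts are larger than that of `X`,
      -- and those of `U` and `B` are smaller. The point `b₀` outside `X` decides which of the
      -- latter is used: `U` misses it unless it lies in `Y`, and then it lies in `B`.
      finish (x , y , Xx , Xy , Yx , Yy) = less B B-small B-true (cong₂ (λ r t → r ∧ not t) Yy Xy)
        where
        I A U B : VertexSet
        I u = X u ∧ Y u
        U u = X u ∨ Y u
        A u = X u ∧ not (Y u)
        B u = Y u ∧ not (X u)
        U-small : cut U < cut X
        U-small = other (submodular X Y) (larger I (λ u → ∧ˡ) (cong₂ _∧_ Xx Yx) Xy (cong₂ _∧_ Xy Yy))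
        B-small : cut B < cut X
        B-small = other (posimodular X Y) (larger A (λ u → ∧ˡ) (cong₂ (λ r t → r ∧ not t) Xy Yy) Xx (cong₂ (λ r t → r ∧ not t) Xx Yx))
        Yb₀ : Y b₀ ≡ true
        Yb₀ with Y b₀ in eq
        ... | true  = refl
        ... | false = ⊥-elim (less U U-small (cong₂ _∨_ Xx Yx) (cong₂ _∨_ Xb₀ eq))
        B-true : B b₀ ≡ true
        B-true = cong₂ (λ r t → r ∧ not t) Yb₀ Xb₀

    -- Every edge counts twice, so this excludes cuts of one or two edges, which would give 2 or 4.
    5≤cut : ∀ X {a b} → X a ≡ true → X b ≡ false → 5 ≤ cut X
    5≤cut X = 5≤cut-acc X (<-wellFounded (measure X))

open EdgeCuts

-- Normal subgroups of prime power index cut out by characters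

module PrimePowerIndices where
  open import Data.Fin using (combine; remQuot)
  open import Data.List.Relation.Unary.All using (All; []; _∷_)
  open import Data.List.Relation.Unary.Any using (any?; satisfied)
  import Data.List.Membership.Propositional as List

  module PrimePowerIndex (A : Grp) {p : ℕ} (coeff : Coefficients p) where
    open Group A renaming (trans to ≈-trans; sym to ≈-sym; refl to ≈-refl; setoid to A-setoid)
    open GroupProperties A using (⁻¹-anti-homo-∙; ⁻¹-involutive)
    private
      module R = CommutativeRing (Coefficients.ring coeff)
    open R using (0#; _+_) renaming (Carrier to K; _≈_ to _≈ᴿ_)
    open Coefficients coeff using (≈0?; multiple; multiple-unique)
    open import Algebra.Properties.Semiring.Mult R.semiring using () renaming (_×_ to _⋆_)
    open import Algebra.Properties.Group R.+-group using () renaming (∙-cancelˡ to +-cancelˡ)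

    -- The subgroup is known only through an equivalent predicate `Q`, so that its description can
    -- be reshaped by `transport` while the count of its cosets is kept.
    record NormalPrimePowerIndex (Q : Carrier → Set) : Set₁ where
      field
        subgroup : Subgroup A
        normal   : IsNormal subgroup
        index    : IsPGroup p (A / subgroup by normal)
        to       : ∀ {x} → x ∈ subgroup → Q x
        from     : ∀ {x} → Q x → x ∈ subgroup

    transport : ∀ {Q Q′} → (∀ {x} → Q x → Q′ x) → (∀ {x} → Q′ x → Q x) → NormalPrimePowerIndex Q → NormalPrimePowerIndex Q′
    transport f g I = record { NormalPrimePowerIndex I using (subgroup; normal; index) ; to = λ m → f (NormalPrimePowerIndex.to I m) ; from = λ q → NormalPrimePowerIndex.from I (g q) }

    everything : NormalPrimePowerIndex (λ _ → ⊤)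
    everything = record
      { subgroup = whole A
      ; normal = λ _ _ → tt
      ; index = 0 , record
        { to = λ _ → ε ; from = λ _ → zero
        ; to-cong = λ _ → tt ; from-cong = λ _ → ≡.refl
        ; inverse = (λ _ → tt) , (λ {x} _ → unique x) }
      ; to = λ _ → tt
      ; from = λ _ → tt
      }
      where
      unique : (x : Fin 1) → zero ≡ x
      unique zero = ≡.refl

    -- A homomorphism to the additive group modulo `p` which is invariant under conjugation by all
    -- of `A`, so that its kernel is again normal in `A`. The value may use the proof of membership,
    -- as it does when a net count is divided by a power of `p`.
    record Character (Q : Carrier → Set) : Set where
      field
        κ      : ∀ x → Q x → K
        κ-cong : ∀ {x y} → x ≈ y → ∀ a b → κ x a ≈ᴿ κ y b
        κ-∙    : ∀ {x y} a b c → κ (x ∙ y) c ≈ᴿ κ x a + κ y b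
        κ-conj : ∀ g {x} a c → κ (g ∙ x ∙ g ⁻¹) c ≈ᴿ κ x a

    restrict : ∀ {Q Q′} → (∀ {x} → Q′ x → Q x) → Character Q → Character Q′
    restrict f χ = record
      { κ = λ x q → κ x (f q)
      ; κ-cong = λ e a b → κ-cong e (f a) (f b)
      ; κ-∙ = λ a b c → κ-∙ (f a) (f b) (f c)
      ; κ-conj = λ g a c → κ-conj g (f a) (f c) }
      where open Character χ

    module _ (gens : List Carrier)
             (generated : ∀ (Q : Carrier → Set) → (∀ {x y} → x ≈ y → Q x → Q y) → Q ε →
                          (∀ {x s} → s List.∈ gens → Q x → Q (x ∙ s)) → ∀ x → Q x) where

      module Step (N : Subgroup A) (normal : IsNormal N) {n : ℕ} (order : HasOrder (A / N by normal) n)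
                  (χ : Character (_∈ N)) where
        open Subgroup N
        open Character χ
        open Quotient A N normal using (_~_)
        open import Relation.Binary.Reasoning.Setoid A-setoid
        private
          module Q = Group (A / N by normal)
          module I = Inverse order
        rep : Fin n → Carrier
        rep = I.to
        cls : Carrier → Fin n
        cls = I.from

        ≈⇒~ : ∀ {x y} → x ≈ y → x ~ y
        ≈⇒~ {x} e = ∈-resp-≈ (≈-trans (≈-sym (inverseˡ x)) (∙-congˡ e)) ε-closed

        -- The component of `x` in `N` relative to the chosen coset representatives.
        ν : Carrier → Carrier
        ν x = rep (cls x) ⁻¹ ∙ x

        ν∈ : ∀ x → ν x ∈ N
        ν∈ x = I.strictlyInverseˡ x

        κν : Carrier → K
        κν x = κ (ν x) (ν∈ x)

        ν-multiple : ∀ {x y} → (m : x ~ y) → κν y ≈ᴿ κν x + κ (x ⁻¹ ∙ y) m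
        ν-multiple {x} {y} m = R.trans (κ-cong eq (ν∈ y) prod) (κ-∙ (ν∈ x) m prod)
          where
          same : cls x ≡ cls y
          same = I.from-cong m
          eq : ν y ≈ ν x ∙ (x ⁻¹ ∙ y)
          eq = ≈-sym (begin
            (rep (cls x) ⁻¹ ∙ x) ∙ (x ⁻¹ ∙ y)  ≈⟨ assoc _ x _ ⟩
            rep (cls x) ⁻¹ ∙ (x ∙ (x ⁻¹ ∙ y))  ≈⟨ ∙-congˡ (assoc x _ y) ⟨
            rep (cls x) ⁻¹ ∙ (x ∙ x ⁻¹ ∙ y)    ≈⟨ ∙-congˡ (≈-trans (∙-congʳ (inverseʳ x)) (identityˡ y)) ⟩
            rep (cls x) ⁻¹ ∙ y                 ≡⟨ ≡.cong (λ i → rep i ⁻¹ ∙ y) same ⟩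
            rep (cls y) ⁻¹ ∙ y                 ∎)
          prod : (ν x ∙ (x ⁻¹ ∙ y)) ∈ N
          prod = ∙-closed (ν∈ x) m

        κε : ∀ m → κ ε m ≈ᴿ 0#
        κε m = +-cancelˡ (κ ε m) _ _ (R.trans (R.sym (κ-∙ m m (∙-closed m m))) (R.trans (κ-cong (identityˡ ε) _ m) (R.sym (R.+-identityʳ _))))

        κ⁻¹ : ∀ {x} a b → κ x a + κ (x ⁻¹) b ≈ᴿ 0#
        κ⁻¹ {x} a b = R.trans (R.sym (κ-∙ a b (∙-closed a b))) (R.trans (κ-cong (inverseʳ x) _ ε-closed) (κε ε-closed))

        N′ : Subgroup A
        N′ = record
          { Mem = λ x → Σ[ m ∈ Mem x ] κ x m ≈ᴿ 0#
          ; ∈-resp-≈ = λ e (m , z) → ∈-resp-≈ e m , R.trans (κ-cong (≈-sym e) _ m) z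
          ; ε-closed = ε-closed , κε _
          ; ∙-closed = λ (m , z) (m′ , z′) → ∙-closed m m′ , R.trans (κ-∙ m m′ _) (R.trans (R.+-cong z z′) (R.+-identityˡ 0#))
          ; ⁻¹-closed = λ (m , z) → ⁻¹-closed m , R.trans (R.sym (R.trans (R.+-congʳ z) (R.+-identityˡ _))) (κ⁻¹ m _)
          }

        normal′ : IsNormal N′
        normal′ g (m , z) = normal g m , R.trans (κ-conj g m _) z

        -- Schreier's argument: the elements `ν (rep i ∙ s)` are Schreier generators of `N`, and
        -- multiplying by a generator changes `κν` only by their values. Constancy is claimed rather
        -- than vanishing because the representative of the class of `ε` need not be `ε`.
        constant-κν : (∀ i {s} → s List.∈ gens → κν (rep i ∙ s) ≈ᴿ 0#) → ∀ x → κν x ≈ᴿ κν ε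
        constant-κν h = generated (λ x → κν x ≈ᴿ κν ε) resp R.refl step
          where
          resp : ∀ {x y} → x ≈ y → κν x ≈ᴿ κν ε → κν y ≈ᴿ κν ε
          resp {x} {y} e z = R.trans (κ-cong (∙-cong (⁻¹-cong (reflexive (≡.cong rep (I.from-cong (≈⇒~ (≈-sym e)))))) (≈-sym e)) _ _) z
          step : ∀ {x s} → s List.∈ gens → κν x ≈ᴿ κν ε → κν (x ∙ s) ≈ᴿ κν ε
          step {x} {s} s∈ z = R.trans (ν-multiple m) (R.trans (R.+-cong (h (cls x) s∈) (R.trans (R.trans (κ-cong eq m conj) (κ-conj (s ⁻¹) (ν∈ x) conj)) z)) (R.+-identityˡ _))
            where
            r = rep (cls x)
            conj = normal (s ⁻¹) (ν∈ x)
            eq : (r ∙ s) ⁻¹ ∙ (x ∙ s) ≈ s ⁻¹ ∙ ν x ∙ s ⁻¹ ⁻¹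
            eq = begin
              (r ∙ s) ⁻¹ ∙ (x ∙ s)       ≈⟨ ∙-congʳ (⁻¹-anti-homo-∙ r s) ⟩
              s ⁻¹ ∙ r ⁻¹ ∙ (x ∙ s)      ≈⟨ assoc _ x s ⟨
              s ⁻¹ ∙ r ⁻¹ ∙ x ∙ s        ≈⟨ ∙-cong (assoc _ _ x) (≈-sym (⁻¹-involutive s)) ⟩
              s ⁻¹ ∙ (r ⁻¹ ∙ x) ∙ s ⁻¹ ⁻¹ ∎
            m : (r ∙ s) ~ (x ∙ s)
            m = ∈-resp-≈ (≈-sym eq) conj

        trivial : (∀ i {s} → s List.∈ gens → κν (rep i ∙ s) ≈ᴿ 0#) → ∀ {x} m → κ x m ≈ᴿ 0#
        trivial h {x} m = +-cancelˡ (κν ε) _ _ (R.trans (R.sym (R.trans (ν-multiple m′) (R.+-congˡ (κ-cong e m′ m))))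
                           (R.trans (constant-κν h x) (R.sym (R.+-identityʳ _))))
          where
          e : ε ⁻¹ ∙ x ≈ x
          e = ≈-trans (∙-congʳ (≈-trans (≈-sym (identityˡ _)) (inverseʳ ε))) (identityˡ x)
          m′ : ε ~ x
          m′ = ∈-resp-≈ (≈-sym e) m

        same-order : (∀ i {s} → s List.∈ gens → κν (rep i ∙ s) ≈ᴿ 0#) → HasOrder (A / N′ by normal′) n
        same-order h = record
          { to = rep ; from = cls
          ; to-cong = λ { ≡.refl → Group.refl (A / N′ by normal′) }
          ; from-cong = λ (m , _) → I.from-cong m
          ; inverse = (λ e → let m = I.inverseˡ e in m , trivial h m) , (λ (m , _) → I.inverseʳ m) }

        power : Carrier → ℕ → Carrier
        power t zero    = ε
        power t (suc k) = t ∙ power t k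

        power∈ : ∀ {t} → t ∈ N → ∀ k → power t k ∈ N
        power∈ m zero    = ε-closed
        power∈ m (suc k) = ∙-closed m (power∈ m k)

        κ-power : ∀ {t} (m : t ∈ N) k a → κ (power t k) a ≈ᴿ k ⋆ κ t m
        κ-power m zero    a = κε a
        κ-power m (suc k) a = R.trans (κ-∙ m (power∈ m k) a) (R.+-congˡ (κ-power m k _))

        module _ {t} (t∈ : t ∈ N) (t≉0 : ¬ (κ t t∈ ≈ᴿ 0#)) where
          digit : Carrier → Fin p
          digit x = proj₁ (multiple t≉0 (κν x))

          digit-spec : ∀ x → toℕ (digit x) ⋆ κ t t∈ ≈ᴿ κν x
          digit-spec x = proj₂ (multiple t≉0 (κν x))

          to′ : Fin n × Fin p → Carrier
          to′ (i , k) = rep i ∙ power t (toℕ k)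

          from′ : Carrier → Fin n × Fin p
          from′ x = cls x , digit x

          from-cong′ : ∀ {x y} → Σ[ m ∈ x ~ y ] κ (x ⁻¹ ∙ y) m ≈ᴿ 0# → from′ x ≡ from′ y
          from-cong′ {x} {y} (m , z) = ≡.cong₂ _,_ (I.from-cong m)
            (multiple-unique t≉0 (digit x) (digit y) (R.trans (digit-spec x) (R.trans
               (R.sym (R.trans (ν-multiple m) (R.trans (R.+-congˡ z) (R.+-identityʳ _)))) (R.sym (digit-spec y)))))

          cancel : ∀ x y → x ⁻¹ ∙ (x ∙ y) ≈ y
          cancel x y = ≈-trans (≈-sym (assoc _ x y)) (≈-trans (∙-congʳ (inverseˡ x)) (identityˡ y))

          to∘from : ∀ x → Σ[ m ∈ to′ (from′ x) ~ x ] κ (to′ (from′ x) ⁻¹ ∙ x) m ≈ᴿ 0#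
          to∘from x = m , z
            where
            P = power t (toℕ (digit x))
            P∈ = power∈ t∈ (toℕ (digit x))
            eq : to′ (from′ x) ⁻¹ ∙ x ≈ P ⁻¹ ∙ ν x
            eq = ≈-trans (∙-congʳ (⁻¹-anti-homo-∙ _ _)) (assoc _ _ x)
            mem : (P ⁻¹ ∙ ν x) ∈ N
            mem = ∙-closed (⁻¹-closed P∈) (ν∈ x)
            m : to′ (from′ x) ~ x
            m = ∈-resp-≈ (≈-sym eq) mem
            z : κ (to′ (from′ x) ⁻¹ ∙ x) m ≈ᴿ 0#
            z = R.trans (κ-cong eq m mem) (R.trans (κ-∙ (⁻¹-closed P∈) (ν∈ x) mem) (R.trans
                  (R.+-congˡ (R.trans (R.sym (digit-spec x)) (R.sym (κ-power t∈ (toℕ (digit x)) P∈))))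
                  (R.trans (R.+-comm _ _) (κ⁻¹ P∈ (⁻¹-closed P∈)))))

          from∘to : ∀ ik → from′ (to′ ik) ≡ ik
          from∘to (i , k) = ≡.cong₂ _,_ same (multiple-unique t≉0 _ k (R.trans (digit-spec (rep i ∙ P)) (R.trans
              (κ-cong (≈-trans (∙-congʳ (⁻¹-cong (reflexive (≡.cong rep same)))) (cancel (rep i) P)) _ P∈) (κ-power t∈ (toℕ k) P∈))))
            where
            P = power t (toℕ k)
            P∈ = power∈ t∈ (toℕ k)
            same : cls (rep i ∙ P) ≡ i
            same = ≡.trans (≡.sym (I.from-cong (∈-resp-≈ (≈-sym (cancel (rep i) P)) P∈))) (I.strictlyInverseʳ i)

          larger-order : HasOrder (A / N′ by normal′) (n ℕ.* p)
          larger-order = record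
            { to = λ i → to′ (remQuot p i) ; from = λ x → combine (cls x) (digit x)
            ; to-cong = λ { ≡.refl → Group.refl (A / N′ by normal′) }
            ; from-cong = λ r → ≡.cong (λ ik → combine (proj₁ ik) (proj₂ ik)) (from-cong′ r)
            ; inverse = (λ { {x} ≡.refl → inv x }) , (λ {i} r → invʳ i r) }
            where
            inv : ∀ x → Subgroup.Mem N′ (to′ (remQuot p (combine (cls x) (digit x))) ⁻¹ ∙ x)
            inv x = ≡.subst (λ ik → Subgroup.Mem N′ (to′ ik ⁻¹ ∙ x)) (≡.sym (Fin.remQuot-combine (cls x) (digit x))) (to∘from x)
            invʳ : ∀ i {y} → Subgroup.Mem N′ (y ⁻¹ ∙ to′ (remQuot p i)) → combine (cls y) (digit y) ≡ i
            invʳ i r = ≡.trans (≡.cong (λ ik → combine (proj₁ ik) (proj₂ ik)) (≡.trans (from-cong′ r) (from∘to (remQuot p i)))) (Fin.combine-remQuot {n} p i)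

        -- Finitely many Schreier generators decide the case. If `κ` vanishes on all of them it is
        -- trivial on `N` and the order stays; otherwise one with non-zero value serves as `t`, the
        -- elements `rep i` times powers of `t` represent the new cosets, and the order grows by the
        -- factor `p`.
        order′ : Σ[ n′ ∈ ℕ ] HasOrder (A / N′ by normal′) n′ × (∀ j → n ≡ p ℕ.^ j → Σ[ j′ ∈ ℕ ] n′ ≡ p ℕ.^ j′)
        order′ with Fin.any? (λ i → any? (λ s → ¬? (≈0? (κν (rep i ∙ s)))) gens)
        ... | no none = n , same-order (λ i {s} s∈ → decidable-stable (≈0? _) (λ z → none (i , List.lose s∈ z))) , λ j e → j , e
        ... | yes (i , some) with satisfied some
        ...   | s , z = n ℕ.* p , larger-order (ν∈ (rep i ∙ s)) z , λ j e → suc j , ≡.trans (≡.cong (ℕ._* p) e) (ℕ.*-comm (p ℕ.^ j) p)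

      extend : ∀ {Q} → NormalPrimePowerIndex Q → (χ : Character Q) →
        NormalPrimePowerIndex (λ x → Σ[ q ∈ Q x ] Character.κ χ x q ≈ᴿ 0#)
      extend {Q} I χ = record
        { subgroup = S.N′
        ; normal = S.normal′
        ; index = proj₁ pj , ≡.subst (HasOrder (A / S.N′ by S.normal′)) (proj₂ pj) (proj₁ (proj₂ S.order′))
        ; to = λ (m , z) → to m , z
        ; from = λ (q , z) → from q , R.trans (Character.κ-cong χ ≈-refl _ q) z
        }
        where
        open NormalPrimePowerIndex I
        module S = Step subgroup normal (proj₂ index) (restrict to χ)
        pj = proj₂ (proj₂ S.order′) (proj₁ index) ≡.refl

      extend-list : ∀ {Q} {J : Set} → NormalPrimePowerIndex Q → (χ : J → Character Q) (js : List J) →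
        NormalPrimePowerIndex (λ x → Σ[ q ∈ Q x ] All (λ j → Character.κ (χ j) x q ≈ᴿ 0#) js)
      extend-list I χ []       = transport (λ q → q , []) proj₁ I
      extend-list I χ (j ∷ js) = transport
        (λ ((q , zs) , z) → q , z ∷ zs) (λ { (q , z ∷ zs) → (q , zs) , z })
        (extend (extend-list I χ js) (restrict proj₁ (χ j)))

open PrimePowerIndices

-- The group of closed walks and its kernels

module LoopKernels where
  open import Data.Integer using (ℤ; +_)
  open import Data.Integer.Divisibility.Signed using (_∣_; divides; quotient)
  open import Data.List using (cartesianProductWith; cartesianProduct; allFin; concatMap)
  open import Data.List.Properties using (++-identityʳ)
  open import Data.List.Relation.Unary.All as All using (All; []; _∷_)
  open import Data.List.Relation.Unary.All.Properties using (tabulate⁺)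
  open import Data.List.Relation.Unary.Any using (here; there)
  import Data.List.Membership.Propositional as List
  open import Data.List.Membership.Propositional.Properties using (∈-cartesianProductWith⁺; ∈-cartesianProduct⁺; ∈-allFin)
  open import Relation.Binary.Construct.Closure.ReflexiveTransitive using (ε; _◅_; _◅◅_)
  open import Relation.Binary.Construct.Closure.ReflexiveTransitive.Properties using (◅◅-assoc)

  module LoopGroup (Γ : Graph) (connected : Connected Γ) {p : ℕ} (p-prime : Prime p) (coeff : Coefficients p)
                   (v₀ : Graph.Vertex Γ) where
    open Walking Γ coeff
    open Graph Γ using (order)
    private
      module R = CommutativeRing (Coefficients.ring coeff)
    open R using (0#; 1#; _+_; _*_; _≈_)

    Loop : Set
    Loop = Walk v₀ v₀

    loops : Grp
    loops = record
      { Carrier = Loop ; _≈_ = _≐_ ; _∙_ = _◅◅_ ; ε = ε ; _⁻¹ = rev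
      ; isGroup = record
        { isMonoid = record
          { isSemigroup = record
            { isMagma = record
              { isEquivalence = record { refl = ≐-refl ; sym = ≐-sym ; trans = ≐-trans }
              ; ∙-cong = ◅◅-cong }
            ; assoc = ≐-assoc }
          ; identity = (λ x → ≐-refl) , ≐-identityʳ }
        ; inverse = rev-inverseˡ , rev-inverseʳ
        ; ⁻¹-cong = rev-cong }
      }

    τ : ∀ u → Walk v₀ u
    τ = connected v₀

    generator : ∀ {s t} → Adj s t → Loop
    generator {s} {t} b = τ s ◅◅ (b ◅ rev (τ t))

    cancel-mid : ∀ {u v w x} (W : Walk u v) (Y : Walk w v) (Z : Walk v x) → (W ◅◅ rev Y) ◅◅ (Y ◅◅ Z) ≐ W ◅◅ Z
    cancel-mid W Y Z = ≐-trans (≐-assoc W (rev Y) (Y ◅◅ Z)) (◅◅-congˡ W (≐-trans (≐-assoc⁻¹ (rev Y) Y Z) (◅◅-congʳ Z (rev-inverseˡ Y))))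

    -- Returning to `v₀` along `τ` after every step writes a loop as a product of generators. The
    -- loop `τ v₀` and its reverse occur because `τ v₀` need not be empty.
    loop-induction : ∀ (Q : Loop → Set) → (∀ {x y} → x ≐ y → Q x → Q y) → Q ε →
      (∀ {x} → Q x → Q (x ◅◅ τ v₀)) → (∀ {x} → Q x → Q (x ◅◅ rev (τ v₀))) →
      (∀ {x s t} (b : Adj s t) → Q x → Q (x ◅◅ generator b)) → ∀ x → Q x
    loop-induction Q resp Qε Qτ Qτ⁻¹ Qb x = resp
      (≐-trans (≐-assoc x (rev (τ v₀)) (τ v₀)) (≐-trans (◅◅-congˡ x (rev-inverseˡ (τ v₀))) (≐-identityʳ x)))
      (Qτ (along ε x (Qτ⁻¹ Qε)))
      where
      along : ∀ {u w} (Y : Walk v₀ u) (W : Walk u w) → Q (Y ◅◅ rev (τ u)) → Q ((Y ◅◅ W) ◅◅ rev (τ w))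
      along {u} Y ε q = ≡.subst (λ Z → Q (Z ◅◅ rev (τ u))) (≡.sym (◅◅-identityʳ Y)) q
      along {u} {w} Y (_◅_ {j = v} a W) q = ≡.subst (λ Z → Q (Z ◅◅ rev (τ w))) (◅◅-assoc Y (a ◅ ε) W)
        (along (Y ◅◅ (a ◅ ε)) W (resp (≐-trans (cancel-mid Y (τ u) (a ◅ rev (τ v)))
          (≐-assoc⁻¹ Y (a ◅ ε) (rev (τ v)))) (Qb a q)))

    private
      arcLoops : ∀ {s t} → Dec (Adj s t) → List Loop
      arcLoops (yes b) = generator b ∷ []
      arcLoops (no _)  = []

    gens : List Loop
    gens = τ v₀ ∷ rev (τ v₀) ∷ concatMap (λ s → concatMap (λ t → arcLoops (Adj? s t)) (allFin order)) (allFin order)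

    generated : ∀ (Q : Loop → Set) → (∀ {x y} → x ≐ y → Q x → Q y) → Q ε →
      (∀ {x s} → s List.∈ gens → Q x → Q (x ◅◅ s)) → ∀ x → Q x
    generated Q resp Qε step = loop-induction Q resp Qε (step (here ≡.refl)) (step (there (here ≡.refl)))
      (λ {x} {s} {t} b q → arc s t b q (Adj? s t) ≡.refl)
      where
      open import Data.List.Membership.Propositional.Properties using (∈-concatMap⁺)
      arc : ∀ {x} s t (b : Adj s t) → Q x → (d : Dec (Adj s t)) → d ≡ Adj? s t → Q (x ◅◅ generator b)
      arc s t b q (no ¬b) eq = ⊥-elim (¬b b)
      arc {x} s t b q (yes b′) eq = resp (◅◅-congˡ x (◅◅-congˡ (τ s) (mk≐ (λ _ → R.refl) (λ _ → ≡.refl))))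
        (step (there (there (∈-concatMap⁺ (λ s → concatMap (λ t → arcLoops (Adj? s t)) (allFin order))
          (List.lose (∈-allFin s) (∈-concatMap⁺ (λ t → arcLoops (Adj? s t)) (List.lose (∈-allFin t)
            (≡.subst (λ d → generator b′ List.∈ arcLoops d) eq (here ≡.refl)))))))) q)

    open PrimePowerIndex loops coeff

    n° : ∀ {u v} → Walk u v → Series
    n° W = magnus W °

    n°-∙ : ∀ {u v w} (x : Walk u v) (y : Walk v w) → n° (x ◅◅ y) ≗ n° x ⊕ n° y ⊕ n° x ⊛ n° y
    n°-∙ x y ℓ = R.trans (°-cong (magnus-◅◅ x y) ℓ) (°-⊛ (magnus-[] x) (magnus-[] y) ℓ)

    -- The mixed product has order `k + k`, which exceeds `k` as `k` is positive.
    n°-∙-lead : ∀ {u v w} k (x : Walk u v) (y : Walk v w) → 0 < k → Ord k (n° x) → Ord k (n° y) → ∀ ℓ → length ℓ ≡ k →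
      n° (x ◅◅ y) ℓ ≈ n° x ℓ + n° y ℓ
    n°-∙-lead k x y 0<k ox oy ℓ len = R.trans (n°-∙ x y ℓ) (R.trans (R.+-congˡ (⊛-Ord k ox oy ℓ
      (ℕ.≤-trans (s≤s (ℕ.≤-reflexive len)) (ℕ.≤-trans (ℕ.≤-reflexive (ℕ.+-comm 1 k)) (ℕ.+-monoʳ-≤ k 0<k))))) (R.+-identityʳ _))

    conjugate : ∀ {u v} → Walk u v → Walk v v → Walk u u
    conjugate g x = (g ◅◅ x) ◅◅ rev g

    -- Conjugation multiplies `n° x` on both sides by series with constant term 1, which does not
    -- affect its leading coefficients.
    n°-conjugate : ∀ {u v} k (g : Walk u v) (x : Walk v v) → Ord k (n° x) → ∀ ℓ → length ℓ ≤ k → n° (conjugate g x) ℓ ≈ n° x ℓ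
    n°-conjugate k g x ox []      len = R.refl
    n°-conjugate k g x ox (l ∷ ℓ) len = R.trans (magnus-◅◅ (g ◅◅ x) (rev g) (l ∷ ℓ)) (R.trans
      (⊛-congʳ (magnus (rev g)) (λ m → R.trans (magnus-◅◅ g x m) (R.trans (⊛-congˡ (magnus g) (1+° (magnus-[] x)) m)
        (R.trans (⊛-distribˡ (magnus g) 𝟙 (n° x) m) (R.+-congʳ (⊛-identityʳ (magnus g) m))))) (l ∷ ℓ))
      (R.trans (⊛-distribʳ (magnus (rev g)) (magnus g) (magnus g ⊛ n° x) (l ∷ ℓ))
        (R.trans (R.+-cong (magnus-rev′ g (l ∷ ℓ)) lead) (R.+-identityˡ _))))
      where
      -- The word may be shorter than `k`; lowering the order to its length puts it into the leading
      -- degree in every case.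
      j = length (l ∷ ℓ)
      oj : Ord j (n° x)
      oj = Ord-mono len ox
      lead : ((magnus g ⊛ n° x) ⊛ magnus (rev g)) (l ∷ ℓ) ≈ n° x (l ∷ ℓ)
      lead = R.trans (R.reflexive (≡.cong ((magnus g ⊛ n° x) ⊛ magnus (rev g)) (≡.sym (++-identityʳ (l ∷ ℓ)))))
        (R.trans (⊛-lead {a = j} {b = 0} (⊛-Ordʳ (magnus g) oj) (λ _ ()) (l ∷ ℓ) [] ≡.refl ≡.refl)
          (R.trans (R.*-cong (⊛-head (magnus g) oj (l ∷ ℓ) ≡.refl) (magnus-[] (rev g)))
            (R.trans (R.*-identityʳ _) (R.trans (R.*-congʳ (magnus-[] g)) (R.*-identityˡ _)))))

    net-conjugate : ∀ {u v} (g : Walk u v) (x : Walk v v) l → net (conjugate g x) l ≡ net x l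
    net-conjugate g x l = ≡.trans (net-◅◅ (g ◅◅ x) (rev g) l) (≡.trans (≡.cong₂ ℤ._+_ (net-◅◅ g x l) (net-rev g l)) (eq (net g l) (net x l)))
      where
      eq : ∀ a b → (a ℤ.+ b) ℤ.+ ℤ.- a ≡ b
      eq = solve-∀

    wordCharacter : ∀ {Q : Loop → Set} k → 0 < k → (∀ {x} → Q x → Ord k (n° x)) → ∀ ℓ → length ℓ ≡ k → Character Q
    wordCharacter k 0<k ord ℓ len = record
      { κ = λ x _ → n° x ℓ
      ; κ-cong = λ e _ _ → °-cong (magnus≗ e) ℓ
      ; κ-∙ = λ {x} {y} a b _ → n°-∙-lead k x y 0<k (ord a) (ord b) ℓ len
      ; κ-conj = λ g {x} a _ → n°-conjugate k g x (ord a) ℓ (ℕ.≤-reflexive len)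
      }

    letters : List Letter
    letters = cartesianProduct (allFin order) (allFin order)

    wordsOfLength : ∀ k → List (Σ[ ℓ ∈ Word ] length ℓ ≡ k)
    wordsOfLength zero    = ([] , ≡.refl) ∷ []
    wordsOfLength (suc k) = cartesianProductWith (λ l (ℓ , e) → l ∷ ℓ , ≡.cong suc e) letters (wordsOfLength k)

    wordsOfLength-complete : ∀ ℓ → (ℓ , ≡.refl) List.∈ wordsOfLength (length ℓ)
    wordsOfLength-complete []      = here ≡.refl
    wordsOfLength-complete (l ∷ ℓ) = ∈-cartesianProductWith⁺ (λ l (ℓ , e) → l ∷ ℓ , ≡.cong suc e)
      (∈-cartesianProduct⁺ (∈-allFin (proj₁ l)) (∈-allFin (proj₂ l))) (wordsOfLength-complete ℓ)

    -- On loops of order `suc k` the coefficients at the finitely many words of length `suc k` are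
    -- characters, and their common kernel is the next term of the filtration. The start is trivial,
    -- since `°` removes the constant term.
    Ord-index : ∀ k → NormalPrimePowerIndex (λ x → Ord (suc k) (n° x))
    Ord-index zero    = transport (λ {x} _ → °-Ord1 (magnus x)) (λ _ → tt) everything
    Ord-index (suc k) = transport (λ {x} → forward {x}) (λ {x} → backward {x})
      (extend-list gens generated (Ord-index k)
        (λ (ℓ , e) → wordCharacter (suc k) (s≤s z≤n) (λ q → q) ℓ e) (wordsOfLength (suc k)))
      where
      forward : ∀ {x : Loop} → Σ[ q ∈ Ord (suc k) (n° x) ] All (λ ℓe → n° x (proj₁ ℓe) ≈ 0#) (wordsOfLength (suc k)) → Ord (suc (suc k)) (n° x)
      forward {x} (o , zs) ℓ (s≤s h) with ℕ.m≤n⇒m<n∨m≡n h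
      ... | inj₁ lt     = o ℓ lt
      ... | inj₂ eq = All.lookup zs (≡.subst (λ j → Σ[ e ∈ length ℓ ≡ j ] (ℓ , e) List.∈ wordsOfLength j) eq (≡.refl , wordsOfLength-complete ℓ) .proj₂)
      backward : ∀ {x : Loop} → Ord (suc (suc k)) (n° x) → Σ[ q ∈ Ord (suc k) (n° x) ] All (λ ℓe → n° x (proj₁ ℓe) ≈ 0#) (wordsOfLength (suc k))
      backward o = Ord-mono (ℕ.n≤1+n _) o , All.tabulate (λ {ℓe} _ → o (proj₁ ℓe) (s≤s (ℕ.≤-reflexive (proj₂ ℓe))))

    module _ (s : ℕ) (m : ℕ) (ω : Fin m → Word) (ω-length : ∀ i → length (ω i) ≡ suc s) where

      -- A subgroup between two terms of the filtration: in the top degree only the words `ω i` are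
      -- tested, which leaves room for loops with non-zero coefficients on other words of that
      -- length.
      WordTrivial : ∀ {u} → Walk u u → Set
      WordTrivial x = Ord (suc s) (n° x) × (∀ i → n° x (ω i) ≈ 0#)

      WordTrivial-index : NormalPrimePowerIndex WordTrivial
      WordTrivial-index = transport (λ (o , zs) → o , λ i → All.lookup zs (∈-allFin i)) (λ (o , z) → o , tabulate⁺ z)
        (extend-list gens generated (Ord-index s) (λ i → wordCharacter (suc s) (s≤s z≤n) (λ q → q) (ω i) (ω-length i)) (allFin m))

      -- Stated for closed walks at any vertex, because automorphisms move the base point;
      -- `Trivial-conjugate` carries the condition back to `v₀`.
      Trivial : ℕ → ∀ {u} → Walk u u → Set
      Trivial k x = WordTrivial x × (∀ l → + (p ℕ.^ k) ∣ net x l)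

      Trivial-conjugate : ∀ k {u v} (g : Walk u v) (x : Walk v v) → Trivial k x → Trivial k (conjugate g x)
      Trivial-conjugate k g x ((o , z) , d) =
        ((λ ℓ h → R.trans (n°-conjugate (suc s) g x o ℓ (ℕ.<⇒≤ h)) (o ℓ h)) ,
         (λ i → R.trans (n°-conjugate (suc s) g x o (ω i) (ℕ.≤-reflexive (ω-length i))) (z i))) ,
        (λ l → ≡.subst (+ (p ℕ.^ k) ∣_) (≡.sym (net-conjugate g x l)) (d l))

      module _ (k : ℕ) where
        private
          q = + (p ℕ.^ k)
          instance
            q≢0 : ℤ.NonZero q
            q≢0 = ℕ.m^n≢0 p k {{prime⇒nonZero p-prime}}

        quotient-unique : ∀ {x y} → x ≡ y → (a : q ∣ x) (b : q ∣ y) → quotient a ≡ quotient b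
        quotient-unique e (divides a x≡) (divides b y≡) = ℤₚ.*-cancelʳ-≡ a b q (≡.trans (≡.sym x≡) (≡.trans e y≡))

        -- Once all net counts are divisible by `q`, the quotient modulo `p` is additive, and its
        -- vanishing is divisibility by the next power of `p`.
        netCharacter : Letter → Character (λ x → Trivial k x)
        netCharacter l = record
          { κ = λ x (_ , d) → ι (quotient (d l))
          ; κ-cong = λ e (_ , a) (_ , b) → R.reflexive (≡.cong ι (quotient-unique (net≡ e l) (a l) (b l)))
          ; κ-∙ = λ {x} {y} (_ , a) (_ , b) (_ , c) → R.trans
              (R.reflexive (≡.cong ι (quotient-unique ≡.refl (c l) (divides (quotient (a l) ℤ.+ quotient (b l))
                (≡.trans (net-◅◅ x y l) (≡.trans (≡.cong₂ ℤ._+_ (_∣_.equality (a l)) (_∣_.equality (b l))) (≡.sym (ℤₚ.*-distribʳ-+ q (quotient (a l)) (quotient (b l))))))))))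
              (ι-+ _ _)
          ; κ-conj = λ g {x} (_ , a) (_ , c) → R.reflexive (≡.cong ι (quotient-unique (net-conjugate g x l) (c l) (a l)))
          }

      Trivial-index : ∀ k → NormalPrimePowerIndex (λ x → Trivial k x)
      Trivial-index zero    = transport (λ {x} w → w , λ l → divides (net x l) (≡.sym (ℤₚ.*-identityʳ _))) proj₁ WordTrivial-index
      Trivial-index (suc k) = transport (λ {x} → forward {x}) (λ {x} → backward {x}) (extend-list gens generated (Trivial-index k) (netCharacter k) letters)
        where
        open Coefficients coeff using (ι-ker; ker-ι)
        P∣ : Loop → Set
        P∣ x = Σ[ t ∈ Trivial k x ] All (λ l → ι (quotient (proj₂ t l)) ≈ 0#) letters
        forward : ∀ {x : Loop} → P∣ x → Trivial (suc k) x
        forward ((w , d) , zs) = w , λ l → combine (d l) (ι-ker (All.lookup zs (∈-cartesianProduct⁺ (∈-allFin (proj₁ l)) (∈-allFin (proj₂ l)))))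
          where
          combine : ∀ {x} (a : + (p ℕ.^ k) ∣ x) → + p ∣ quotient a → + (p ℕ.^ suc k) ∣ x
          combine (divides a e) (divides b e′) = divides b (≡.trans e (≡.trans (≡.cong (ℤ._* + (p ℕ.^ k)) e′)
            (≡.trans (ℤₚ.*-assoc b (+ p) (+ (p ℕ.^ k))) (≡.cong (b ℤ.*_) (≡.sym (ℤₚ.pos-* p (p ℕ.^ k)))))))
        backward : ∀ {x : Loop} → Trivial (suc k) x → P∣ x
        backward {x} (w , d) = (w , weaker) , All.tabulate (λ {l} _ → ker-ι (divides (quotient (d l)) ≡.refl))
          where
          weaker : ∀ l → + (p ℕ.^ k) ∣ net x l
          weaker l = divides (quotient (d l) ℤ.* + p) (≡.trans (_∣_.equality (d l)) (≡.trans (≡.cong (quotient (d l) ℤ.*_) (ℤₚ.pos-* p (p ℕ.^ k)))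
            (≡.sym (ℤₚ.*-assoc (quotient (d l)) (+ p) (+ (p ℕ.^ k))))))

open LoopKernels

-- Loops that separate two edges modulo p

module SeparatingLoops where
  open import Data.Bool using (true; false; _xor_)
  open import Data.Integer using (ℤ; +_; -[1+_]; 0ℤ; 1ℤ)
  open import Relation.Binary.Construct.Closure.ReflexiveTransitive using (_◅_; _◅◅_)
  open import Data.Bool.Properties using (xor-same)

  open Sums ℕ.+-0-commutativeMonoid

  sum-δ≤ : ∀ {n} (f : Fin n → ℕ) a → f a ≤ 1 → (∀ i → i ≢ a → f i ≡ 0) → sum f ≤ 1
  sum-δ≤ f a le off = ℕ.≤-trans (ℕ.≤-reflexive (sum-single a off)) le

  module Separating (Γ : Graph) (connected : Connected Γ) (tetravalent : Tetravalent Γ)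
                    (G : Subgroup (Aut Γ)) (edge-transitive : EdgeTransitive G)
                    {p : ℕ} (p-prime : Prime p) (coeff : Coefficients p) (v₀ : Graph.Vertex Γ) where
    open Walking Γ coeff
    open LoopGroup Γ connected p-prime coeff v₀ using (τ; generator)
    open Separator Γ p-prime coeff using (pow)
    open EdgeConnectivity Γ connected tetravalent G edge-transitive using (VertexSet; crossing; cut; 5≤cut; adj; adj-true)
    open Coefficients coeff using (≈0?; 1≉0)
    open CommutativeRing (Coefficients.ring coeff) hiding (_≉_; _-_; zero; _*_) renaming (_+_ to _+ᴿ_; -_ to -ᴿ_)
    open import Algebra.Properties.Group +-group using (ε⁻¹≈ε)

    ι-sub : ∀ {x y} → ι x ≈ 0# → ι y ≈ 0# → ι (x ℤ.- y) ≈ 0#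
    ι-sub {x} {y} p q = trans (ι-+ x (ℤ.- y)) (trans (+-cong p (trans (ι-neg y) (trans (-‿cong q) ε⁻¹≈ε))) (+-identityˡ 0#))

    ι-opp : ∀ {x y} → ι (x ℤ.- y) ≈ 0# → ι (y ℤ.- x) ≈ 0#
    ι-opp {x} {y} p = trans (reflexive (≡.cong ι (eq x y))) (ι-sub ι-0 p)
      where
      eq : ∀ x y → y ℤ.- x ≡ 0ℤ ℤ.- (x ℤ.- y)
      eq = solve-∀

    -- The net counts of `generator` as a function of the end points only, so that a search over
    -- vertices can refer to them without a proof of adjacency.
    gen : Vertex → Vertex → Letter → ℤ
    gen s t l = net (τ s) l ℤ.+ (stepNet s t l ℤ.- net (τ t) l)

    net-generator : ∀ {s t} (b : Adj s t) l → net (generator b) l ≡ gen s t l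
    net-generator {s} {t} b l = ≡.trans (net-◅◅ (τ s) (b ◅ rev (τ t)) l)
      (≡.cong (λ z → net (τ s) l ℤ.+ (stepNet s t l ℤ.+ z)) (net-rev (τ t) l))

    net-pow : ∀ {v} (W : Walk v v) k l → net (pow W k) l ≡ + k ℤ.* net W l
    net-pow W zero    l = ≡.sym (ℤₚ.*-zeroˡ (net W l))
    net-pow W (suc k) l = ≡.trans (net-◅◅ W (pow W k) l) (≡.trans (≡.cong (λ z → net W l ℤ.+ z) (net-pow W k l)) (eq (+ k) (net W l)))
      where
      eq : ∀ k n → n ℤ.+ k ℤ.* n ≡ (1ℤ ℤ.+ k) ℤ.* n
      eq = solve-∀

    zpow : ∀ {v} → Walk v v → ℤ → Walk v v
    zpow W (+ k)     = pow W k
    zpow W (-[1+ k ]) = rev (pow W (suc k))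

    net-zpow : ∀ {v} (W : Walk v v) z l → net (zpow W z) l ≡ z ℤ.* net W l
    net-zpow W (+ k)     l = net-pow W k l
    net-zpow W (-[1+ k ]) l = ≡.trans (net-rev (pow W (suc k)) l)
      (≡.trans (≡.cong ℤ.-_ (net-pow W (suc k) l)) (ℤₚ.neg-distribˡ-* (+ suc k) (net W l)))

    stepNet-off : ∀ {s t l} → l ≢ (s , t) → l ≢ (t , s) → stepNet s t l ≡ 0ℤ
    stepNet-off {s} {t} {l} ne ne′ with l ≟ᴸ (s , t) | l ≟ᴸ (t , s)
    ... | yes e | _     = contradiction e ne
    ... | no _  | yes e = contradiction e ne′
    ... | no _  | no _  = ≡.refl

    module _ {u v x y} (uv : Adj u v) (xy : Adj x y) (ne : (x , y) ≢ (u , v)) (ne′ : (x , y) ≢ (v , u)) where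
      e f : Letter
      e = u , v
      f = x , y

      u≢v : u ≢ v
      u≢v eq = Adj-irrefl eq uv

      stepNet-e : stepNet u v e ≡ 1ℤ
      stepNet-e with (u , v) ≟ᴸ (u , v) | (u , v) ≟ᴸ (v , u)
      ... | no ¬r | _     = contradiction ≡.refl ¬r
      ... | yes _ | yes r = contradiction (≡.cong proj₁ r) u≢v
      ... | yes _ | no _  = ≡.refl

      -- Proportional coefficients of e and f on all loops give a function on the vertices which
      -- is constant along every edge other than e and f.
      no-proportion : ∀ F₀ E₀ → ¬ (ι F₀ ≈ 0#) →
        (∀ {s t} → Adj s t → ι (F₀ ℤ.* gen s t e ℤ.- E₀ ℤ.* gen s t f) ≈ 0#) → ⊥
      no-proportion F₀ E₀ F₀≉0 prop = ℕ.<⇒≱ (s≤s cut≤4) (5≤cut X Xu Xv)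
        where
        φ : Vertex → ℤ
        φ s = F₀ ℤ.* net (τ s) e ℤ.- E₀ ℤ.* net (τ s) f
        -- From `u` to `v` the value of `φ` changes by `F₀`, which is non-zero modulo `p`; so `v`
        -- lies outside, while only the edges `e` and `f` can cross.
        X : VertexSet
        X s = does (≈0? (ι (φ s ℤ.- φ u)))
        key : ∀ {s t} → Adj s t → ι (φ s ℤ.- φ t ℤ.+ (F₀ ℤ.* stepNet s t e ℤ.- E₀ ℤ.* stepNet s t f)) ≈ 0#
        key {s} {t} st = trans (reflexive (≡.cong ι (eq F₀ E₀ (net (τ s) e) (net (τ s) f) (net (τ t) e) (net (τ t) f) (stepNet s t e) (stepNet s t f)))) (prop st)
          where
          eq : ∀ F E a b c d k l → (F ℤ.* a ℤ.- E ℤ.* b) ℤ.- (F ℤ.* c ℤ.- E ℤ.* d) ℤ.+ (F ℤ.* k ℤ.- E ℤ.* l)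
             ≡ F ℤ.* (a ℤ.+ (k ℤ.- c)) ℤ.- E ℤ.* (b ℤ.+ (l ℤ.- d))
          eq = solve-∀
        Xu : X u ≡ true
        Xu = dec-true (≈0? _) (trans (reflexive (≡.cong ι (ℤₚ.+-inverseʳ (φ u)))) ι-0)
        Xv : X v ≡ false
        Xv = dec-false (≈0? _) λ h → F₀≉0 (trans (reflexive (≡.cong ι (eq F₀ (φ u) (φ v) E₀))) (trans (ι-+ _ _)
               (trans (+-cong (trans (reflexive (≡.cong ι step-values)) (key uv)) h) (+-identityˡ 0#))))
          where
          eq : ∀ F a b E → F ≡ (a ℤ.- b ℤ.+ (F ℤ.* 1ℤ ℤ.- E ℤ.* 0ℤ)) ℤ.+ (b ℤ.- a)
          eq = solve-∀
          step-values : φ u ℤ.- φ v ℤ.+ (F₀ ℤ.* 1ℤ ℤ.- E₀ ℤ.* 0ℤ) ≡ φ u ℤ.- φ v ℤ.+ (F₀ ℤ.* stepNet u v e ℤ.- E₀ ℤ.* stepNet u v f)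
          step-values = ≡.cong₂ (λ k l → φ u ℤ.- φ v ℤ.+ (F₀ ℤ.* k ℤ.- E₀ ℤ.* l)) (≡.sym stepNet-e) (≡.sym (stepNet-off ne ne′))
        X-equal : ∀ {s t} → Adj s t → e ≢ (s , t) → e ≢ (t , s) → f ≢ (s , t) → f ≢ (t , s) → X s ≡ X t
        X-equal {s} {t} st n₁ n₂ n₃ n₄ = does-⇔ (mk⇔ (sum-ι (φ t) (φ s) (φ u) (ι-opp {φ s} {φ t} same)) (sum-ι (φ s) (φ t) (φ u) same)) (≈0? _) (≈0? _)
          where
          same : ι (φ s ℤ.- φ t) ≈ 0#
          same = trans (reflexive (≡.cong ι (≡.trans (eq (φ s ℤ.- φ t) F₀ E₀)
            (≡.cong₂ (λ k l → φ s ℤ.- φ t ℤ.+ (F₀ ℤ.* k ℤ.- E₀ ℤ.* l)) (≡.sym (stepNet-off n₁ n₂)) (≡.sym (stepNet-off n₃ n₄)))))) (key st)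
            where
            eq : ∀ a F E → a ≡ a ℤ.+ (F ℤ.* 0ℤ ℤ.- E ℤ.* 0ℤ)
            eq = solve-∀
          sum-ι : ∀ a b c → ι (a ℤ.- b) ≈ 0# → ι (b ℤ.- c) ≈ 0# → ι (a ℤ.- c) ≈ 0#
          sum-ι a b c h k = trans (reflexive (≡.cong ι (eq a b c))) (trans (ι-+ _ _) (trans (+-cong h k) (+-identityˡ 0#)))
            where
            eq : ∀ a b c → a ℤ.- c ≡ (a ℤ.- b) ℤ.+ (b ℤ.- c)
            eq = solve-∀
        δ : Letter → Vertex → Vertex → ℕ
        δ l s t = # does (l ≟ᴸ (s , t))
        total : (Vertex → Vertex → ℕ) → ℕ
        total h = sum λ s → sum λ t → h s t
        total-+ : ∀ h k → total (λ s t → h s t ℕ.+ k s t) ≡ total h ℕ.+ total k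
        total-+ h k = ≡.trans (sum-cong-≋ (λ s → ∑-distrib-+ (h s) (k s))) (∑-distrib-+ (λ s → sum (h s)) (λ s → sum (k s)))
        total-δ : ∀ l → total (δ l) ≤ 1
        total-δ (a , b) = sum-δ≤ (λ s → sum (δ (a , b) s)) a
          (sum-δ≤ (δ (a , b) a) b (#≤1 _) (λ t t≢b → ≡.cong #_ (dec-false ((a , b) ≟ᴸ (a , t)) (λ r → t≢b (≡.sym (≡.cong proj₂ r))))))
          (λ s s≢a → sum-zero (λ t → ≡.cong #_ (dec-false ((a , b) ≟ᴸ (s , t)) (λ r → s≢a (≡.sym (≡.cong proj₁ r))))))
        -- Two edges in both directions give at most four crossing pairs, one short of the five
        -- demanded by `5≤cut`.
        bound : Vertex → Vertex → ℕ
        bound s t = δ e s t ℕ.+ δ (v , u) s t ℕ.+ (δ f s t ℕ.+ δ (y , x) s t)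
        flip-letter : ∀ {a b s t : Vertex} → (a , b) ≡ (t , s) → (b , a) ≡ (s , t)
        flip-letter ≡.refl = ≡.refl
        pointwise : ∀ s t → # crossing X s t ≤ bound s t
        pointwise s t with e ≟ᴸ (s , t) | (v , u) ≟ᴸ (s , t) | f ≟ᴸ (s , t) | (y , x) ≟ᴸ (s , t)
        ... | yes _ | _     | _     | _     = ℕ.≤-trans (#≤1 _) (s≤s z≤n)
        ... | no _  | yes _ | _     | _     = ℕ.≤-trans (#≤1 _) (s≤s z≤n)
        ... | no _  | no _  | yes _ | _     = ℕ.≤-trans (#≤1 _) (s≤s z≤n)
        ... | no _  | no _  | no _  | yes _ = ℕ.≤-trans (#≤1 _) (s≤s z≤n)
        ... | no n₁ | no n₂ | no n₃ | no n₄ with Adj? s t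
        ...   | no _   = z≤n
        ...   | yes st = ℕ.≤-reflexive (≡.cong #_ (≡.trans (≡.cong (_xor X t) (X-equal st n₁ (λ r → n₂ (flip-letter r)) n₃ (λ r → n₄ (flip-letter r)))) (xor-same (X t))))
        cut≤4 : cut X ≤ 4
        cut≤4 = ℕ.≤-trans (sum-mono (λ s → sum-mono (pointwise s))) (ℕ.≤-trans
          (ℕ.≤-reflexive (≡.trans (total-+ (λ s t → δ e s t ℕ.+ δ (v , u) s t) (λ s t → δ f s t ℕ.+ δ (y , x) s t))
            (≡.cong₂ ℕ._+_ (total-+ (δ e) (δ (v , u))) (total-+ (δ f) (δ (y , x))))))
          (ℕ.+-mono-≤ (ℕ.+-mono-≤ (total-δ e) (total-δ (v , u))) (ℕ.+-mono-≤ (total-δ f) (total-δ (y , x)))))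

      -- Either two generators have counts at `e` and `f` with non-zero determinant modulo `p`, and
      -- a combination of them works; or a single generator works; or the counts of all generators
      -- are proportional, which `no-proportion` excludes.
      separate : Σ[ Y ∈ Walk v₀ v₀ ] ¬ (ι (net Y e) ≈ 0#) × ι (net Y f) ≈ 0#
      separate with Fin.any? (λ s → Fin.any? (λ t → Fin.any? (λ s′ → Fin.any? (λ t′ →
                      Adj? s t ×-dec (Adj? s′ t′ ×-dec ¬? (≈0? (ι (gen s t f ℤ.* gen s′ t′ e ℤ.- gen s t e ℤ.* gen s′ t′ f)))))))) 
      ... | yes (s , t , s′ , t′ , a , b , ne₀) = Y , (λ h → ne₀ (trans (reflexive (≡.cong ι (≡.sym (Y-e)))) h)) ,
              trans (reflexive (≡.cong ι Y-f)) ι-0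
        where
        -- The exponents make the counts at `f` cancel, and the count at `e` becomes the determinant
        -- found to be non-zero.
        Y = zpow (generator b) (gen s t f) ◅◅ zpow (generator a) (ℤ.- gen s′ t′ f)
        Y-net : ∀ l → net Y l ≡ gen s t f ℤ.* gen s′ t′ l ℤ.+ ℤ.- gen s′ t′ f ℤ.* gen s t l
        Y-net l = ≡.trans (net-◅◅ (zpow (generator b) (gen s t f)) (zpow (generator a) (ℤ.- gen s′ t′ f)) l)
          (≡.cong₂ ℤ._+_ (≡.trans (net-zpow (generator b) (gen s t f) l) (≡.cong (λ z → gen s t f ℤ.* z) (net-generator b l)))
                         (≡.trans (net-zpow (generator a) (ℤ.- gen s′ t′ f) l) (≡.cong (λ z → ℤ.- gen s′ t′ f ℤ.* z) (net-generator a l))))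
        Y-e : net Y e ≡ gen s t f ℤ.* gen s′ t′ e ℤ.- gen s t e ℤ.* gen s′ t′ f
        Y-e = ≡.trans (Y-net e) (eq (gen s t f) (gen s′ t′ e) (gen s′ t′ f) (gen s t e))
          where
          eq : ∀ a b c d → a ℤ.* b ℤ.+ ℤ.- c ℤ.* d ≡ a ℤ.* b ℤ.- d ℤ.* c
          eq = solve-∀
        Y-f : net Y f ≡ 0ℤ
        Y-f = ≡.trans (Y-net f) (eq (gen s t f) (gen s′ t′ f))
          where
          eq : ∀ a b → a ℤ.* b ℤ.+ ℤ.- b ℤ.* a ≡ 0ℤ
          eq = solve-∀
      ... | no dets with Fin.any? (λ s → Fin.any? (λ t → Adj? s t ×-dec (¬? (≈0? (ι (gen s t e))) ×-dec ≈0? (ι (gen s t f)))))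
      ...   | yes (s , t , a , h , k) = generator a , (λ z → h (trans (reflexive (≡.cong ι (≡.sym (net-generator a e)))) z)) ,
                trans (reflexive (≡.cong ι (net-generator a f))) k
      ...   | no none with Fin.any? (λ s → Fin.any? (λ t → Adj? s t ×-dec ¬? (≈0? (ι (gen s t f)))))
      ...     | yes (s , t , a , h) = ⊥-elim (no-proportion (gen s t f) (gen s t e) h
                  (λ {s′} {t′} b → decidable-stable (≈0? _) (λ z → dets (s , t , s′ , t′ , a , b , z))))
      ...     | no allzero = ⊥-elim (no-proportion 1ℤ 0ℤ (λ h → 1≉0 (trans (sym ι-1) h))
                  (λ {s} {t} b → trans (reflexive (≡.cong ι (eq (gen s t e) (gen s t f))))
                    (decidable-stable (≈0? _) (λ z → none (s , t , b , z , decidable-stable (≈0? _) (λ k → allzero (s , t , b , k)))))))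
        where
        eq : ∀ a b → 1ℤ ℤ.* a ℤ.- 0ℤ ℤ.* b ≡ a
        eq = solve-∀

open SeparatingLoops

-- The regular cover defined by a normal subgroup of the loops

module RegularCovers where
  open import Data.Bool using (true; false; if_then_else_)
  open import Data.Fin using (combine; remQuot)
  open import Data.Fin.Permutation using (permutation)
  open import Relation.Binary.Construct.Closure.ReflexiveTransitive using (Star; ε; _◅_; _◅◅_; reverse)
  open import Relation.Binary.Construct.Closure.ReflexiveTransitive.Properties using (◅◅-assoc)
  open ≡ using (refl; sym; trans; cong; subst)

  module Covering (Γ : Graph) (connected : Connected Γ) {p : ℕ} (p-prime : Prime p) (coeff : Coefficients p)
                  (v₀ : Graph.Vertex Γ) where
    open Graph Γ using (order)
    open Walking Γ coeff
    open LoopGroup Γ connected p-prime coeff v₀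
    private
      module A = Group loops

    module Kernel (N : Subgroup loops) (normal : IsNormal N) {h : ℕ} (loop-order : HasOrder (loops / N by normal) h) where
      open Subgroup N
      open Quotient loops N normal using (_~_)
      private
        module Q = Group (loops / N by normal)
        module I = Inverse loop-order

      infix 4 _≃_
      record _≃_ (x y : Loop) : Set where
        constructor mk≃
        field un≃ : x ~ y
      open _≃_ public

      ≐⇒≃ : ∀ {x y} → x ≐ y → x ≃ y
      ≐⇒≃ {x} {y} e = mk≃ (∈-resp-≈ (≐-trans (≐-sym (rev-inverseˡ x)) (◅◅-congˡ (rev x) e)) ε-closed)

      ≃-refl : ∀ {x} → x ≃ x
      ≃-refl = ≐⇒≃ ≐-refl

      ≃-sym : ∀ {x y} → x ≃ y → y ≃ x
      ≃-sym {x} {y} (mk≃ e) = mk≃ (Q.sym {x} {y} e)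

      ≃-trans : ∀ {x y z} → x ≃ y → y ≃ z → x ≃ z
      ≃-trans {x} {y} {z} (mk≃ e) (mk≃ f) = mk≃ (Q.trans {x} {y} {z} e f)

      ≃-∙ : ∀ {x y u v} → x ≃ y → u ≃ v → x ◅◅ u ≃ y ◅◅ v
      ≃-∙ {x} {y} {u} {v} (mk≃ e) (mk≃ f) = mk≃ (Q.∙-cong {x} {y} {u} {v} e f)

      cls-cong : ∀ {x y} → x ≃ y → I.from x ≡ I.from y
      cls-cong (mk≃ e) = I.from-cong e

      rep-cls : ∀ x → I.to (I.from x) ≃ x
      rep-cls x = mk≃ (I.strictlyInverseˡ x)

      val : ∀ {u} → Walk v₀ u → Loop
      val {u} W = W ◅◅ rev (τ u)

      val-loop : ∀ (Y : Loop) {u} (W : Walk v₀ u) → val (Y ◅◅ W) ≐ Y ◅◅ val W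
      val-loop Y {u} W = ≐-assoc Y W (rev (τ u))

      val-extend : ∀ {u v} (W : Walk v₀ u) (Z : Walk u v) → val (W ◅◅ Z) ≐ val W ◅◅ (τ u ◅◅ (Z ◅◅ rev (τ v)))
      val-extend {u} {v} W Z = ≐-sym (≐-trans (cancel-mid W (τ u) (Z ◅◅ rev (τ v))) (≐-assoc⁻¹ W Z (rev (τ v))))

      -- A vertex is a coset of `N` together with an end point; the coset of a walk is that of the
      -- loop closing it up along `τ`.
      VertexΔ : Set
      VertexΔ = Fin (h ℕ.* order)

      -- The end point of the lift of a walk from v₀.
      pt : ∀ {u} → Walk v₀ u → VertexΔ
      pt {u} W = combine (I.from (val W)) u

      base : VertexΔ → Vertex
      base x = proj₂ (remQuot {h} order x)

      wk : ∀ x → Walk v₀ (base x)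
      wk x = I.to (proj₁ (remQuot {h} order x)) ◅◅ τ (base x)

      base-pt : ∀ {u} (W : Walk v₀ u) → base (pt W) ≡ u
      base-pt {u} W = cong proj₂ (Fin.remQuot-combine {h} (I.from (val W)) u)

      pt-wk : ∀ x → pt (wk x) ≡ x
      pt-wk x = trans (cong (λ i → combine i (base x)) idx) (Fin.combine-remQuot {h} order x)
        where
        r = I.to (proj₁ (remQuot {h} order x))
        idx : I.from (val (wk x)) ≡ proj₁ (remQuot {h} order x)
        idx = trans (cls-cong (≐⇒≃ (≐-trans (≐-assoc r (τ (base x)) (rev (τ (base x))))
                (≐-trans (◅◅-congˡ r (rev-inverseʳ (τ (base x)))) (≐-identityʳ r))))) (I.strictlyInverseʳ _)

      pt-cong : ∀ {u} {W W′ : Walk v₀ u} → val W ≃ val W′ → pt W ≡ pt W′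
      pt-cong {u} m = cong (λ i → combine i u) (cls-cong m)

      pt-≐ : ∀ {u} {W W′ : Walk v₀ u} → W ≐ W′ → pt W ≡ pt W′
      pt-≐ {u} e = pt-cong (≐⇒≃ (◅◅-congʳ (rev (τ u)) e))

      pt-end : ∀ {u u′} {W : Walk v₀ u} {W′ : Walk v₀ u′} → pt W ≡ pt W′ → u ≡ u′
      pt-end {W = W} {W′} e = trans (sym (base-pt W)) (trans (cong base e) (base-pt W′))

      pt-injective : ∀ {u} {W W′ : Walk v₀ u} → pt W ≡ pt W′ → val W ≃ val W′
      pt-injective {u} {W} {W′} e = ≃-trans (≃-sym (rep-cls (val W)))
        (subst (λ i → I.to i ≃ val W′) (sym (Fin.combine-injectiveˡ _ u _ u e)) (rep-cls (val W′)))

      pt-extend : ∀ {u v} {W W′ : Walk v₀ u} (Z : Walk u v) → pt W ≡ pt W′ → pt (W ◅◅ Z) ≡ pt (W′ ◅◅ Z)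
      pt-extend {W = W} {W′} Z e = pt-cong (≃-trans (≐⇒≃ (val-extend W Z))
        (≃-trans (≃-∙ (pt-injective e) ≃-refl) (≐⇒≃ (≐-sym (val-extend W′ Z)))))

      pt-∙ : ∀ {Y Y′ : Loop} {u} {W W′ : Walk v₀ u} → Y ≃ Y′ → val W ≃ val W′ → pt (Y ◅◅ W) ≡ pt (Y′ ◅◅ W′)
      pt-∙ {Y} {Y′} {W = W} {W′} e f = pt-cong (≃-trans (≐⇒≃ (val-loop Y W)) (≃-trans (≃-∙ e f) (≐⇒≃ (≐-sym (val-loop Y′ W′)))))

      pt-loop : ∀ (Y : Loop) {u u′} {W : Walk v₀ u} {W′ : Walk v₀ u′} → pt W ≡ pt W′ → pt (Y ◅◅ W) ≡ pt (Y ◅◅ W′)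
      pt-loop Y {W = W} {W′} e with pt-end e
      ... | refl = pt-∙ {Y} {Y} {W = W} {W′} ≃-refl (pt-injective e)

      -- By normality of `N`, whether the lift of a closed walk at `u` closes up does not depend on
      -- the point of the fibre; conjugating with `τ u` brings the condition to `v₀`. The converse
      -- is `closed-pt`.
      pt-closed : ∀ {u} (W : Walk v₀ u) (Z : Walk u u) → conjugate (τ u) Z ∈ N → pt (W ◅◅ Z) ≡ pt W
      pt-closed {u} W Z m = pt-cong (≃-trans (≐⇒≃ (val-extend W Z))
          (≃-trans (≃-∙ (≃-refl {val W}) (mk≃ c~ε)) (≐⇒≃ (≐-identityʳ (val W)))))
        where
        c = τ u ◅◅ (Z ◅◅ rev (τ u))
        c~ε : c ~ ε
        c~ε = ∈-resp-≈ (≐-sym (≐-identityʳ (rev c))) (⁻¹-closed (∈-resp-≈ (≐-assoc (τ u) Z (rev (τ u))) m))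

      closed-pt : ∀ {u} (W : Walk v₀ u) (Z : Walk u u) → pt (W ◅◅ Z) ≡ pt W → conjugate (τ u) Z ∈ N
      closed-pt {u} W Z e = ∈-resp-≈ eq (un≃ (pt-injective (sym e)))
        where
        c = τ u ◅◅ (Z ◅◅ rev (τ u))
        eq : rev (val W) ◅◅ val (W ◅◅ Z) ≐ conjugate (τ u) Z
        eq = ≐-trans (◅◅-congˡ (rev (val W)) (val-extend W Z)) (≐-trans (≐-assoc⁻¹ (rev (val W)) (val W) c)
          (≐-trans (◅◅-congʳ c (rev-inverseˡ (val W))) (≐-assoc⁻¹ (τ u) Z (rev (τ u)))))

      -- Ranging over all walks to the first vertex, and not only the representative `wk`, makes
      -- adjacency visibly symmetric and stable under lifted maps; `AdjΔ-from` returns to any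
      -- preferred walk.
      AdjΔ : VertexΔ → VertexΔ → Set
      AdjΔ x y = Σ[ u ∈ Vertex ] Σ[ v ∈ Vertex ] Σ[ W ∈ Walk v₀ u ] Σ[ a ∈ Adj u v ] x ≡ pt W × y ≡ pt (W ◅◅ (a ◅ ε))

      AdjΔ-step : ∀ {u v} (W : Walk v₀ u) (a : Adj u v) → AdjΔ (pt W) (pt (W ◅◅ (a ◅ ε)))
      AdjΔ-step W a = _ , _ , W , a , refl , refl

      AdjΔ-from : ∀ {u} (W : Walk v₀ u) {y} → AdjΔ (pt W) y → Σ[ v ∈ Vertex ] Σ[ a ∈ Adj u v ] y ≡ pt (W ◅◅ (a ◅ ε))
      AdjΔ-from W (u′ , v , W′ , a , e , e′) with pt-end {W = W} {W′} e
      ... | refl = v , a , trans e′ (pt-extend (a ◅ ε) (sym e))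

      AdjΔ-base : ∀ {x y} → AdjΔ x y → Adj (base x) (base y)
      AdjΔ-base (u , v , W , a , refl , refl) = ≡.subst₂ Adj (sym (base-pt W)) (sym (base-pt (W ◅◅ (a ◅ ε)))) a

      step-back : ∀ {u v} (W : Walk v₀ u) (a : Adj u v) (b : Adj v u) → pt ((W ◅◅ (a ◅ ε)) ◅◅ (b ◅ ε)) ≡ pt W
      step-back W a b = pt-≐ (≐-trans (≐-assoc W (a ◅ ε) (b ◅ ε)) (≐-trans (◅◅-congˡ W back) (≐-identityʳ W)))
        where
        back : a ◅ (b ◅ ε) ≐ ε
        back = ≐-trans (◅◅-congˡ (a ◅ ε) (step-irrelevant b (Adj-sym a))) (rev-inverseʳ (a ◅ ε))

      AdjΔ-sym : ∀ {x y} → AdjΔ x y → AdjΔ y x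
      AdjΔ-sym (u , v , W , a , refl , refl) = v , u , W ◅◅ (a ◅ ε) , Adj-sym a , refl , sym (step-back W a (Adj-sym a))

      AdjΔ? : ∀ x y → Dec (AdjΔ x y)
      AdjΔ? x y with Adj? (base x) (base y)
      ... | no ¬a = no (λ e → ¬a (AdjΔ-base e))
      ... | yes a with pt (wk x ◅◅ (a ◅ ε)) Fin.≟ y
      ...   | yes e = yes (_ , _ , wk x , a , sym (pt-wk x) , sym e)
      ...   | no ¬e = no λ e → go (AdjΔ-from (wk x) (subst (λ z → AdjΔ z y) (sym (pt-wk x)) e))
        where
        go : Σ[ v ∈ Vertex ] Σ[ b ∈ Adj (base x) v ] y ≡ pt (wk x ◅◅ (b ◅ ε)) → _
        go (v , b , e) with trans (cong base e) (base-pt (wk x ◅◅ (b ◅ ε)))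
        ... | refl = ¬e (trans (pt-≐ (◅◅-congˡ (wk x) (step-irrelevant a b))) (sym e))

      Δ : Graph
      Δ = record
        { order = h ℕ.* order
        ; Adj = AdjΔ
        ; Adj? = AdjΔ?
        ; Adj-sym = AdjΔ-sym
        ; Adj-irrefl = λ { refl a → Adj-irrefl refl (AdjΔ-base a) }
        }

      lift : ∀ {u v} (W : Walk v₀ u) (Z : Walk u v) → Star AdjΔ (pt W) (pt (W ◅◅ Z))
      lift W ε       = subst (λ Y → Star AdjΔ (pt W) (pt Y)) (sym (◅◅-identityʳ W)) ε
      lift W (a ◅ Z) = AdjΔ-step W a ◅ subst (λ Y → Star AdjΔ (pt (W ◅◅ (a ◅ ε))) (pt Y)) (◅◅-assoc W (a ◅ ε) Z) (lift (W ◅◅ (a ◅ ε)) Z)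

      Δ-connected : Connected Δ
      Δ-connected x y = ≡.subst₂ (Star AdjΔ) (pt-wk x) (pt-wk y) (reverse AdjΔ-sym (lift ε (wk x)) ◅◅ lift ε (wk y))

      module NeighbourSum (M : CommutativeMonoid 0ℓ 0ℓ) where
        open CommutativeMonoid M renaming (refl to ≈-refl; trans to ≈-trans; sym to ≈-sym; ε to 0#)
        open Sums M

        -- Projection is a bijection from the neighbours of `x` to those of `base x`. For natural
        -- numbers this yields valency, for integers it lifts divergences.
        if-sum : ∀ x (f : Vertex → Carrier) → sum (λ y → if does (AdjΔ? x y) then f (base y) else 0#) ≈ sum (λ v → if does (Adj? (base x) v) then f v else 0#)
        if-sum x f = ≈-trans (sum-combine h _) (≈-trans (∑-comm (λ i v → entry v i)) (sum-cong-≋ column))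
          where
          entry : Vertex → Fin h → Carrier
          entry v i = if does (AdjΔ? x (combine i v)) then f (base (combine i v)) else 0#
          base-combine : ∀ (i : Fin h) v → base (combine i v) ≡ v
          base-combine i v = cong proj₂ (Fin.remQuot-combine {h} i v)
          column : ∀ v → sum (entry v) ≈ (if does (Adj? (base x) v) then f v else 0#)
          column v with Adj? (base x) v
          ... | no ¬a = sum-zero (λ i → reflexive (cong (λ b → if b then f (base (combine i v)) else 0#)
                  (dec-false (AdjΔ? x (combine i v)) (λ e → ¬a (subst (Adj (base x)) (base-combine i v) (AdjΔ-base e))))))
          ... | yes a = ≈-trans (sum-single i₀ off) (reflexive (≡.trans (cong (λ b → if b then f (base (combine i₀ v)) else 0#) (dec-true (AdjΔ? x (combine i₀ v)) on)) (cong f (base-combine i₀ v))))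
            where
            i₀ = I.from (val (wk x ◅◅ (a ◅ ε)))
            on : AdjΔ x (combine i₀ v)
            on = subst (λ z → AdjΔ z (combine i₀ v)) (pt-wk x) (AdjΔ-step (wk x) a)
            off : ∀ i → ¬ (i ≡ i₀) → entry v i ≈ 0#
            off i ne = reflexive (cong (λ b → if b then f (base (combine i v)) else 0#) (dec-false (AdjΔ? x (combine i v)) not-adjacent))
              where
              not-adjacent : ¬ AdjΔ x (combine i v)
              not-adjacent e with AdjΔ-from (wk x) (subst (λ z → AdjΔ z (combine i v)) (sym (pt-wk x)) e)
              ... | v′ , b , e′ with Fin.combine-injectiveʳ i v _ v′ e′
              ...   | refl = ne (trans (Fin.combine-injectiveˡ i v _ v e′) (Fin.combine-injectiveˡ _ v _ v (pt-≐ (◅◅-congˡ (wk x) (step-irrelevant b a)))))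

      Δ-tetravalent : Tetravalent Γ → Tetravalent Δ
      Δ-tetravalent tet x = trans (length-filter-tabulate (AdjΔ? x) (λ y → y)) (trans
        (sum-cong-≋ (λ y → #-if (does (AdjΔ? x y)))) (trans (if-sum x (λ _ → 1)) (trans
        (sum-cong-≋ (λ v → sym (#-if (does (Adj? (base x) v))))) (trans (sym (length-filter-tabulate (Adj? (base x)) (λ v → v))) (tet (base x))))))
        where
        open NeighbourSum ℕ.+-0-commutativeMonoid
        open Sums ℕ.+-0-commutativeMonoid
        #-if : ∀ b → # b ≡ (if b then 1 else 0)
        #-if true  = refl
        #-if false = refl

      -- A family of vertices indexed compatibly by the walks from v₀ defines a map of Δ.
      record WalkMap : Set where
        field
          F      : ∀ {u} → Walk v₀ u → VertexΔ
          F-cong : ∀ {u u′} {W : Walk v₀ u} {W′ : Walk v₀ u′} → pt W ≡ pt W′ → F W ≡ F W′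
          F-step : ∀ {u v} (W : Walk v₀ u) (a : Adj u v) → AdjΔ (F W) (F (W ◅◅ (a ◅ ε)))

        ⟦_⟧ : VertexΔ → VertexΔ
        ⟦_⟧ x = F (wk x)

        ⟦pt⟧ : ∀ {u} (W : Walk v₀ u) → ⟦_⟧ (pt W) ≡ F W
        ⟦pt⟧ W = F-cong (pt-wk (pt W))

        ⟦⟧-adj : ∀ {x y} → AdjΔ x y → AdjΔ (⟦_⟧ x) (⟦_⟧ y)
        ⟦⟧-adj (u , v , W , a , refl , refl) = ≡.subst₂ AdjΔ (sym (⟦pt⟧ W)) (sym (⟦pt⟧ (W ◅◅ (a ◅ ε)))) (F-step W a)

      open WalkMap

      automorphism : (φ ψ : WalkMap) → (∀ {u} (W : Walk v₀ u) → ⟦ φ ⟧ (F ψ W) ≡ pt W) → (∀ {u} (W : Walk v₀ u) → ⟦ ψ ⟧ (F φ W) ≡ pt W) → Automorphism Δ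
      automorphism φ ψ φψ ψφ = record
        { perm = permutation ⟦ φ ⟧ ⟦ ψ ⟧ (λ x → inv φ ψ φψ x) (λ x → inv ψ φ ψφ x)
        ; preserves = λ x y → mk⇔ (⟦⟧-adj φ) (λ a → ≡.subst₂ AdjΔ (inv ψ φ ψφ x) (inv ψ φ ψφ y) (⟦⟧-adj ψ a))
        }
        where
        inv : (φ ψ : WalkMap) → (∀ {u} (W : Walk v₀ u) → ⟦ φ ⟧ (F ψ W) ≡ pt W) → ∀ x → ⟦ φ ⟧ (⟦ ψ ⟧ x) ≡ x
        inv φ ψ e x = trans (e (wk x)) (pt-wk x)

      deckMap : Loop → WalkMap
      deckMap Y = record
        { F = λ W → pt (Y ◅◅ W)
        ; F-cong = pt-loop Y
        ; F-step = λ W a → subst (λ Z → AdjΔ (pt (Y ◅◅ W)) (pt Z)) (◅◅-assoc Y W (a ◅ ε)) (AdjΔ-step (Y ◅◅ W) a)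
        }

      deck-inverse : ∀ Y Y′ → Y ◅◅ Y′ ≐ ε → ∀ {u} (W : Walk v₀ u) → ⟦ deckMap Y ⟧ (F (deckMap Y′) W) ≡ pt W
      deck-inverse Y Y′ e W = trans (⟦pt⟧ (deckMap Y) (Y′ ◅◅ W)) (pt-≐ (≐-trans (≐-assoc⁻¹ Y Y′ W) (◅◅-congʳ W e)))

      deck : Loop → Automorphism Δ
      deck Y = automorphism (deckMap Y) (deckMap (rev Y)) (deck-inverse Y (rev Y) (rev-inverseʳ Y)) (deck-inverse (rev Y) Y (rev-inverseˡ Y))

      deck-pt : ∀ Y {u} (W : Walk v₀ u) → deck Y · pt W ≡ pt (Y ◅◅ W)
      deck-pt Y W = ⟦pt⟧ (deckMap Y) W

      -- Defined by its effect on fibres, so that membership is tested vertex by vertex;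
      -- `deck-complete` shows that its elements come from loops.
      deckGroup : Subgroup (Aut Δ)
      deckGroup = record
        { Mem = λ a → ∀ x → base (a · x) ≡ base x
        ; ∈-resp-≈ = λ e m x → trans (cong base (sym (e x))) (m x)
        ; ε-closed = λ x → refl
        ; ∙-closed = λ {a} {b} m m′ x → trans (m (b · x)) (m′ x)
        ; ⁻¹-closed = λ {a} m x → trans (sym (m _)) (cong base (Data.Fin.Permutation.inverseʳ (Automorphism.perm a)))
        }

      deck∈ : ∀ Y → deck Y ∈ deckGroup
      deck∈ Y x = subst (λ z → base (deck Y · z) ≡ base z) (pt-wk x)
        (trans (cong base (deck-pt Y (wk x))) (trans (base-pt (Y ◅◅ wk x)) (sym (base-pt (wk x)))))

      AdjΔ-unique : ∀ {x y z} → AdjΔ x y → AdjΔ x z → base y ≡ base z → y ≡ z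
      AdjΔ-unique (u , v , W , a , refl , refl) xz e with AdjΔ-from W xz
      ... | v′ , b , refl with trans (sym (base-pt (W ◅◅ (a ◅ ε)))) (trans e (base-pt (W ◅◅ (b ◅ ε))))
      ...   | refl = pt-≐ (◅◅-congˡ W (step-irrelevant a b))

      -- Uniqueness of lifts: once `a` and `b` agree at a vertex, they send a neighbour of it to
      -- neighbours of one vertex in the same fibre, and there is only one such neighbour.
      agree : ∀ (a b : Automorphism Δ) → (∀ x → base (a · x) ≡ base (b · x)) → ∀ {x y} → Star AdjΔ x y → a · x ≡ b · x → a · y ≡ b · y
      agree a b over ε e = e
      agree a b over (_◅_ {j = z} s W) e = agree a b over W
        (AdjΔ-unique (Equivalence.to (Automorphism.preserves a _ _) s)
          (subst (λ t → AdjΔ t (b · z)) (sym e) (Equivalence.to (Automorphism.preserves b _ _) s)) (over z))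

      pt-subst : ∀ {u w} (e : u ≡ w) (W : Walk v₀ u) → pt (subst (Walk v₀) e W) ≡ pt W
      pt-subst refl W = refl

      deck-transitive : ∀ x y → base x ≡ base y → Σ[ Y ∈ Loop ] deck Y · x ≡ y
      deck-transitive x y e = Y , trans (pt-≐ (≐-trans (≐-assoc W (rev (wk x)) (wk x))
          (≐-trans (◅◅-congˡ W (rev-inverseˡ (wk x))) (≐-identityʳ W)))) (trans (pt-subst (sym e) (wk y)) (pt-wk y))
        where
        W = subst (Walk v₀) (sym e) (wk y)
        Y = W ◅◅ rev (wk x)

      deck-complete : ∀ a → a ∈ deckGroup → Σ[ Y ∈ Loop ] (∀ x → a · x ≡ deck Y · x)
      deck-complete a m = Y , λ x → agree a (deck Y) (λ y → trans (m y) (sym (deck∈ Y y))) (Δ-connected (pt ε) x) (sym (proj₂ d))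
        where
        d = deck-transitive (pt ε) (a · pt ε) (sym (m (pt ε)))
        Y = proj₁ d

      -- The image of `pt ε` determines a deck transformation, and it determines the loop modulo
      -- `N`, so the deck group has as many elements as there are cosets.
      deck-order : HasOrder ⟪ deckGroup ⟫ h
      deck-order = record
        { to = λ i → deck (I.to i) , deck∈ (I.to i)
        ; from = λ (a , m) → I.from (loopOf a m)
        ; to-cong = λ { refl x → refl }
        ; from-cong = λ {(a , m)} {(b , m′)} e → cls-cong (same (trans (sym (spec a m)) (trans (e (pt ε)) (spec b m′))))
        ; inverse = (λ { {a , m} refl x → trans (pt-∙ {I.to (I.from (loopOf a m))} {loopOf a m} {W = wk x} {wk x} (rep-cls (loopOf a m)) ≃-refl) (sym (proj₂ (deck-complete a m) x)) }) ,
                    (λ {i} {(a , m)} e → trans (cls-cong (same (trans (sym (spec a m)) (trans (e (pt ε)) (deck-ε (I.to i)))))) (I.strictlyInverseʳ i))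
        }
        where
        loopOf : ∀ a → a ∈ deckGroup → Loop
        loopOf a m = proj₁ (deck-complete a m)
        deck-ε : ∀ Y → deck Y · pt ε ≡ pt Y
        deck-ε Y = trans (deck-pt Y ε) (cong pt (◅◅-identityʳ Y))
        spec : ∀ a m → a · pt ε ≡ pt (loopOf a m)
        spec a m = trans (proj₂ (deck-complete a m) (pt ε)) (deck-ε (loopOf a m))
        cancel-τ : ∀ Y → val Y ◅◅ τ v₀ ≐ Y
        cancel-τ Y = ≐-trans (≐-assoc Y (rev (τ v₀)) (τ v₀)) (≐-trans (◅◅-congˡ Y (rev-inverseˡ (τ v₀))) (≐-identityʳ Y))
        same : ∀ {Y Y′ : Loop} → pt Y ≡ pt Y′ → Y ≃ Y′
        same {Y} {Y′} e = ≃-trans (≐⇒≃ (≐-sym (cancel-τ Y))) (≃-trans (≃-∙ (pt-injective e) (≃-refl {τ v₀})) (≐⇒≃ (cancel-τ Y′)))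

open RegularCovers

-- Automorphisms of small displacement are deck transformations

module Displacements where
  open import Data.Bool using (if_then_else_)
  open import Data.Integer using (ℤ; +_; 0ℤ; 1ℤ; ∣_∣)
  open import Data.Integer.Divisibility.Signed using (_∣_; ∣⇒∣ᵤ)
  open import Relation.Binary.Construct.Closure.ReflexiveTransitive using (Star; ε; _◅_; _◅◅_)
  open import Relation.Binary.Construct.Closure.ReflexiveTransitive.Properties using (◅◅-assoc)
  open ≡ using (refl; sym; trans; cong; cong₂; subst)

  argmax : ∀ {n} (f : Fin n → ℤ) → Fin n → Σ[ i ∈ Fin n ] ∀ j → f j ℤ.≤ f i
  argmax {suc zero}    f _ = zero , λ { zero → ℤₚ.≤-refl }
  argmax {suc (suc n)} f _ with argmax (λ i → f (suc i)) zero
  ... | i , max with ℤₚ.≤-total (f zero) (f (suc i))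
  ...   | inj₁ le = suc i , λ { zero → le ; (suc j) → max j }
  ...   | inj₂ ge = zero , λ { zero → ℤₚ.≤-refl ; (suc j) → ℤₚ.≤-trans (max j) ge }

  open Sums ℤₚ.+-0-commutativeMonoid

  sum-nonpositive : ∀ {n} (f : Fin n → ℤ) → (∀ i → f i ℤ.≤ 0ℤ) → sum f ℤ.≤ 0ℤ
  sum-nonpositive {zero}  f h = ℤₚ.≤-refl
  sum-nonpositive {suc n} f h = ℤₚ.+-mono-≤ (h zero) (sum-nonpositive (λ i → f (suc i)) (λ i → h (suc i)))

  nonpositive-terms : ∀ {n} (f : Fin n → ℤ) → (∀ i → f i ℤ.≤ 0ℤ) → sum f ≡ 0ℤ → ∀ i → f i ≡ 0ℤ
  nonpositive-terms {suc n} f h e = go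
    where
    tail≤0 : sum (λ i → f (suc i)) ℤ.≤ 0ℤ
    tail≤0 = sum-nonpositive (λ i → f (suc i)) (λ i → h (suc i))
    head≡0 : f zero ≡ 0ℤ
    head≡0 = ℤₚ.≤-antisym (h zero) (subst (ℤ._≤ f zero) e (ℤₚ.≤-trans (ℤₚ.+-monoʳ-≤ (f zero) tail≤0) (ℤₚ.≤-reflexive (ℤₚ.+-identityʳ (f zero)))))
    tail≡0 : sum (λ i → f (suc i)) ≡ 0ℤ
    tail≡0 = trans (sym (ℤₚ.+-identityˡ _)) (trans (cong (ℤ._+ sum (λ i → f (suc i))) (sym head≡0)) e)
    go : ∀ i → f i ≡ 0ℤ
    go zero    = head≡0
    go (suc i) = nonpositive-terms (λ i → f (suc i)) (λ i → h (suc i)) tail≡0 i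

  *-distribˡ-sum : ∀ {n} c (f : Fin n → ℤ) → c ℤ.* sum f ≡ sum (λ i → c ℤ.* f i)
  *-distribˡ-sum {zero}  c f = ℤₚ.*-zeroʳ c
  *-distribˡ-sum {suc n} c f = trans (ℤₚ.*-distribˡ-+ c (f zero) (sum (λ i → f (suc i)))) (cong (λ z → c ℤ.* f zero ℤ.+ z) (*-distribˡ-sum c (λ i → f (suc i))))

  small-multiple : ∀ {q : ℕ} {z} → + q ∣ z → ∣ z ∣ < q → z ≡ 0ℤ
  small-multiple {q} {z} d lt = ℤₚ.∣i∣≡0⇒i≡0 (zero-below (∣⇒∣ᵤ d) lt)
    where
    zero-below : ∀ {m} → q ℕ∣.∣ m → m < q → m ≡ 0
    zero-below {zero}  _ _  = refl
    zero-below {suc m} d lt = ⊥-elim (ℕ.<⇒≱ lt (ℕ∣.∣⇒≤ d))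

  module SmallDisplacement (Γ : Graph) (connected : Connected Γ) (tetravalent : Tetravalent Γ)
      (G : Subgroup (Aut Γ)) (edge-transitive : EdgeTransitive G)
      {p : ℕ} (p-prime : Prime p) (coeff : Coefficients p) (v₀ : Graph.Vertex Γ) where
    open Graph Γ using (order)
    open Walking Γ coeff
    open LoopGroup Γ connected p-prime coeff v₀
    open Covering Γ connected p-prime coeff v₀
    open Separating Γ connected tetravalent G edge-transitive p-prime coeff v₀ using (separate; stepNet-off)
    private
      module R = CommutativeRing (Coefficients.ring coeff)

    other-neighbour : ∀ u v → Σ[ w ∈ Vertex ] Adj u w × w ≢ v
    other-neighbour u v with Fin.any? (λ w → Adj? u w ×-dec ¬? (w Fin.≟ v))
    ... | yes r = r
    ... | no none = ⊥-elim (absurd (subst (_≤ 1) (trans (sym (length-filter-tabulate (Adj? u) (λ w → w))) (tetravalent u))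
            (sum-δ≤ (λ w → # does (Adj? u w)) v (#≤1 _) off)))
      where
      absurd : 4 ≤ 1 → ⊥
      absurd (s≤s ())
      off : ∀ w → w ≢ v → # does (Adj? u w) ≡ 0
      off w ne with Adj? u w
      ... | yes a = ⊥-elim (none (w , a , ne))
      ... | no _  = refl

    net-antisym : ∀ {u v} (W : Walk u v) a b → net W (b , a) ≡ ℤ.- net W (a , b)
    net-antisym ε a b = refl
    net-antisym (_◅_ {s} {t} _ W) a b = trans (cong₂ ℤ._+_ flip (net-antisym W a b)) (sym (ℤₚ.neg-distrib-+ (stepNet s t (a , b)) (net W (a , b))))
      where
      swap : ∀ {c d e f : Vertex} → (c , d) ≡ (e , f) → (d , c) ≡ (f , e)
      swap refl = refl
      iso : ∀ c d e f → [ (d , c) ≟ᴸ (f , e) ]ᶻ ≡ [ (c , d) ≟ᴸ (e , f) ]ᶻ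
      iso c d e f = []-cong [_]ᶻ (λ _ _ → refl) (λ _ _ → refl) ((d , c) ≟ᴸ (f , e)) ((c , d) ≟ᴸ (e , f)) swap swap
      eq : ∀ x y → x ℤ.- y ≡ ℤ.- (y ℤ.- x)
      eq = solve-∀
      flip : stepNet s t (b , a) ≡ ℤ.- stepNet s t (a , b)
      flip = trans (cong₂ ℤ._-_ (iso a b t s) (iso a b s t)) (eq [ (a , b) ≟ᴸ (t , s) ]ᶻ [ (a , b) ≟ᴸ (s , t) ]ᶻ)

    net-off : ∀ {u v} (W : Walk u v) {a b} → ¬ Adj a b → net W (a , b) ≡ 0ℤ
    net-off ε ¬ab = refl
    net-off (_◅_ {s} {t} st W) {a} {b} ¬ab = cong₂ ℤ._+_ (stepNet-off {s} {t} {a , b} (λ { refl → ¬ab st }) (λ { refl → ¬ab (Adj-sym st) })) (net-off W ¬ab)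

    -- The boundary of a walk telescopes to its two ends; for a loop it is zero, so the net counts
    -- of a loop form a circulation.
    divergence : ∀ {u v} (W : Walk u v) a → sum (λ b → net W (a , b)) ≡ [ a Fin.≟ u ]ᶻ ℤ.- [ a Fin.≟ v ]ᶻ
    divergence {u} ε a = trans (sum-replicate-zero order) (sym (ℤₚ.+-inverseʳ [ a Fin.≟ u ]ᶻ))
    divergence {u} {v} (_◅_ {j = t} st W) a = trans (∑-distrib-+ (λ b → stepNet u t (a , b)) (λ b → net W (a , b)))
      (trans (cong₂ ℤ._+_ step (divergence W a)) (eq [ a Fin.≟ u ]ᶻ [ a Fin.≟ t ]ᶻ [ a Fin.≟ v ]ᶻ))
      where
      eq : ∀ x y z → (x ℤ.- y) ℤ.+ (y ℤ.- z) ≡ x ℤ.- z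
      eq = solve-∀
      row : ∀ s t → sum (λ b → [ (a , b) ≟ᴸ (s , t) ]ᶻ) ≡ [ a Fin.≟ s ]ᶻ
      row s t = trans (sum-single t (λ b ne → []-no ((a , b) ≟ᴸ (s , t)) (λ e → ne (cong proj₂ e))))
        ([]-cong [_]ᶻ (λ _ _ → refl) (λ _ _ → refl) ((a , t) ≟ᴸ (s , t)) (a Fin.≟ s) (cong proj₁) (cong (_, t)))
        where
        []-no : ∀ {P : Set} (d : Dec P) → ¬ P → [ d ]ᶻ ≡ 0ℤ
        []-no (yes x) ¬x = contradiction x ¬x
        []-no (no _)  _  = refl
      neg-sum : ∀ {n} (f : Fin n → ℤ) → sum (λ i → ℤ.- f i) ≡ ℤ.- sum f
      neg-sum {zero}  f = refl
      neg-sum {suc n} f = trans (cong (λ z → ℤ.- f zero ℤ.+ z) (neg-sum (λ i → f (suc i)))) (sym (ℤₚ.neg-distrib-+ (f zero) _))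
      step : sum (λ b → stepNet u t (a , b)) ≡ [ a Fin.≟ u ]ᶻ ℤ.- [ a Fin.≟ t ]ᶻ
      step = trans (∑-distrib-+ (λ b → [ (a , b) ≟ᴸ (u , t) ]ᶻ) (λ b → ℤ.- [ (a , b) ≟ᴸ (t , u) ]ᶻ))
        (cong₂ ℤ._+_ (row u t) (trans (neg-sum (λ b → [ (a , b) ≟ᴸ (t , u) ]ᶻ)) (cong ℤ.-_ (row t u))))

    ∣stepNet∣≤1 : ∀ s t l → ∣ stepNet s t l ∣ ≤ 1
    ∣stepNet∣≤1 s t l with l ≟ᴸ (s , t) | l ≟ᴸ (t , s)
    ... | yes _ | yes _ = z≤n
    ... | yes _ | no _  = s≤s z≤n
    ... | no _  | yes _ = s≤s z≤n
    ... | no _  | no _  = z≤n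

    pair : (Letter → ℤ) → (Letter → ℤ) → ℤ
    pair θ φ = sum (λ a → sum (λ b → θ (a , b) ℤ.* φ (a , b)))

    pair-cong : ∀ θ {φ ψ} → (∀ l → φ l ≡ ψ l) → pair θ φ ≡ pair θ ψ
    pair-cong θ e = sum-cong-≋ (λ a → sum-cong-≋ (λ b → cong (λ z → θ (a , b) ℤ.* z) (e (a , b))))

    pair-+ : ∀ θ φ ψ → pair θ (λ l → φ l ℤ.+ ψ l) ≡ pair θ φ ℤ.+ pair θ ψ
    pair-+ θ φ ψ = trans (sum-cong-≋ (λ a → trans (sum-cong-≋ (λ b → ℤₚ.*-distribˡ-+ (θ (a , b)) (φ (a , b)) (ψ (a , b))))
      (∑-distrib-+ (λ b → θ (a , b) ℤ.* φ (a , b)) (λ b → θ (a , b) ℤ.* ψ (a , b))))) (∑-distrib-+ (λ a → sum (λ b → θ (a , b) ℤ.* φ (a , b))) (λ a → sum (λ b → θ (a , b) ℤ.* ψ (a , b))))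

    pair-stepNet : ∀ θ s t → pair θ (stepNet s t) ≡ θ (s , t) ℤ.- θ (t , s)
    pair-stepNet θ s t = trans (pair-+ θ (λ l → [ l ≟ᴸ (s , t) ]ᶻ) (λ l → ℤ.- [ l ≟ᴸ (t , s) ]ᶻ))
        (cong₂ ℤ._+_ (trans (single (λ z → z) refl s t) (ℤₚ.*-identityʳ (θ (s , t))))
                     (trans (single ℤ.-_ refl t s) (trans (ℤₚ.*-comm (θ (t , s)) (ℤ.- 1ℤ)) (ℤₚ.-1*i≡-i (θ (t , s))))))
      where
      single : ∀ (g : ℤ → ℤ) → g 0ℤ ≡ 0ℤ → ∀ s t → pair θ (λ l → g [ l ≟ᴸ (s , t) ]ᶻ) ≡ θ (s , t) ℤ.* g 1ℤ
      single g g0 s t = trans (sum-single s (λ a ne → sum-zero (λ b → off (a , b) (λ e → ne (cong proj₁ e)))))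
        (trans (sum-single t (λ b ne → off (s , b) (λ e → ne (cong proj₂ e)))) on)
        where
        off : ∀ l → l ≢ (s , t) → θ l ℤ.* g [ l ≟ᴸ (s , t) ]ᶻ ≡ 0ℤ
        off l ne with l ≟ᴸ (s , t)
        ... | yes e = contradiction e ne
        ... | no _  = trans (cong (θ l ℤ.*_) g0) (ℤₚ.*-zeroʳ (θ l))
        on : θ (s , t) ℤ.* g [ (s , t) ≟ᴸ (s , t) ]ᶻ ≡ θ (s , t) ℤ.* g 1ℤ
        on with (s , t) ≟ᴸ (s , t)
        ... | yes _ = refl
        ... | no ¬r = contradiction refl ¬r

    module _ (N : Subgroup loops) (normal : IsNormal N) {h : ℕ} (loop-order : HasOrder (loops / N by normal) h)
             (q : ℕ) (N-net : ∀ {x} → x ∈ N → ∀ l → + q ∣ net x l) where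
      open Kernel N normal loop-order

      _⇝_ : VertexΔ → VertexΔ → Set
      _⇝_ = Star (AdjΔ)

      netΔ : ∀ {x y} → x ⇝ y → Letter → ℤ
      netΔ ε l = 0ℤ
      netΔ (_◅_ {x} {y} _ S) l = stepNet (base x) (base y) l ℤ.+ netΔ S l

      len : ∀ {x y} → x ⇝ y → ℕ
      len ε       = 0
      len (_ ◅ S) = suc (len S)

      netΔ-◅◅ : ∀ {x y z} (S : x ⇝ y) (T : y ⇝ z) l → netΔ (S ◅◅ T) l ≡ netΔ S l ℤ.+ netΔ T l
      netΔ-◅◅ ε T l = sym (ℤₚ.+-identityˡ _)
      netΔ-◅◅ (_◅_ {x} {y} _ S) T l = trans (cong (λ z → stepNet (base x) (base y) l ℤ.+ z) (netΔ-◅◅ S T l)) (sym (ℤₚ.+-assoc (stepNet (base x) (base y) l) (netΔ S l) (netΔ T l)))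

      revΔ : ∀ {x y} → x ⇝ y → y ⇝ x
      revΔ ε       = ε
      revΔ (s ◅ S) = revΔ S ◅◅ (AdjΔ-sym s ◅ ε)

      netΔ-rev : ∀ {x y} (S : x ⇝ y) l → netΔ (revΔ S) l ≡ ℤ.- netΔ S l
      netΔ-rev ε l = refl
      netΔ-rev (_◅_ {x} {y} s S) l = trans (netΔ-◅◅ (revΔ S) (AdjΔ-sym s ◅ ε) l)
        (trans (cong₂ ℤ._+_ (netΔ-rev S l) (cong (ℤ._+ 0ℤ) (stepNet-rev (base x) (base y) l))) (eq (netΔ S l) (stepNet (base x) (base y) l)))
        where
        eq : ∀ a b → ℤ.- a ℤ.+ (ℤ.- b ℤ.+ 0ℤ) ≡ ℤ.- (b ℤ.+ a)
        eq = solve-∀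

      ∣netΔ∣≤len : ∀ {x y} (S : x ⇝ y) l → ∣ netΔ S l ∣ ≤ len S
      ∣netΔ∣≤len ε l = z≤n
      ∣netΔ∣≤len (_◅_ {x} {y} _ S) l = ℕ.≤-trans (ℤₚ.∣i+j∣≤∣i∣+∣j∣ (stepNet (base x) (base y) l) (netΔ S l))
        (ℕ.+-mono-≤ (∣stepNet∣≤1 (base x) (base y) l) (∣netΔ∣≤len S l))

      project : ∀ {u} (W : Walk v₀ u) {x y} → x ≡ pt W → (S : x ⇝ y) →
        Σ[ v ∈ Vertex ] Σ[ Z ∈ Walk u v ] y ≡ pt (W ◅◅ Z) × (∀ l → net Z l ≡ netΔ S l)
      project {u} W e ε = u , ε , trans e (cong (pt) (sym (◅◅-identityʳ W))) , λ _ → refl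
      project W refl (s ◅ S) with AdjΔ-from W s
      ... | v , a , refl with project (W ◅◅ (a ◅ ε)) refl S
      ...   | w , Z , e , n = w , a ◅ Z , trans e (cong (pt) (◅◅-assoc W (a ◅ ε) Z)) ,
              λ l → cong₂ ℤ._+_ (cong₂ (λ s t → stepNet s t l) (sym (base-pt W)) (sym (base-pt (W ◅◅ (a ◅ ε))))) (n l)

      -- A closed walk of the cover projects to a closed walk whose conjugate at `v₀` lies in `N`,
      -- and conjugation keeps net counts.
      closed-netΔ : ∀ {x} (S : x ⇝ x) l → + q ∣ netΔ S l
      closed-netΔ {x} S l with project (wk x) (sym (pt-wk x)) S
      ... | v , Z , e , n with trans (cong base e) (base-pt (wk x ◅◅ Z))
      ...   | refl = subst (+ q ∣_) (trans (net-conjugate (τ (base x)) Z l) (n l))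
              (N-net (closed-pt (wk x) Z (trans (sym e) (sym (pt-wk x)))) l)

      module _ (a : Automorphism Δ) (r : ℕ) (bound : r ℕ.+ r ℕ.+ 2 < q)
               (displacement : ∀ x → Σ[ S ∈ x ⇝ (a · x) ] len S ≤ r) where
        path : ∀ x → x ⇝ (a · x)
        path x = proj₁ (displacement x)

        image : ∀ {x y} → AdjΔ x y → AdjΔ (a · x) (a · y)
        image {x} {y} = Equivalence.to (Automorphism.preserves a x y)

        -- The displacement of `x`, the image of the edge, the displacement of `y` backwards and the
        -- edge backwards form a closed walk of length at most `r + r + 2`. Its net counts are
        -- divisible by `q` and smaller than `q`, hence zero.
        exact : ∀ {x y} (s : AdjΔ x y) l →
          netΔ (path x) l ℤ.+ stepNet (base (a · x)) (base (a · y)) l ≡ netΔ (path y) l ℤ.+ stepNet (base x) (base y) l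
        exact {x} {y} s l = ℤₚ.i-j≡0⇒i≡j _ _ (trans (sym value) (small-multiple (closed-netΔ circuit l) small))
          where
          circuit : x ⇝ x
          circuit = (path x ◅◅ (image s ◅ ε)) ◅◅ revΔ ((s ◅ ε) ◅◅ path y)
          fx = netΔ (path x) l
          fy = netΔ (path y) l
          sxy = stepNet (base x) (base y) l
          saxy = stepNet (base (a · x)) (base (a · y)) l
          value : netΔ circuit l ≡ (fx ℤ.+ saxy) ℤ.- (fy ℤ.+ sxy)
          value = trans (netΔ-◅◅ (path x ◅◅ (image s ◅ ε)) (revΔ ((s ◅ ε) ◅◅ path y)) l) (trans
            (cong₂ ℤ._+_ (netΔ-◅◅ (path x) (image s ◅ ε) l) (trans (netΔ-rev ((s ◅ ε) ◅◅ path y) l) (cong ℤ.-_ (netΔ-◅◅ (s ◅ ε) (path y) l))))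
            (eq fx saxy sxy fy))
            where
            eq : ∀ fx s′ s fy → (fx ℤ.+ (s′ ℤ.+ 0ℤ)) ℤ.+ ℤ.- ((s ℤ.+ 0ℤ) ℤ.+ fy) ≡ (fx ℤ.+ s′) ℤ.- (fy ℤ.+ s)
            eq = solve-∀
          small : ∣ netΔ circuit l ∣ < q
          small = ℕ.≤-<-trans (ℕ.≤-trans (ℕ.≤-reflexive (cong ∣_∣ value)) (ℕ.≤-trans (ℤₚ.∣i-j∣≤∣i∣+∣j∣ (fx ℤ.+ saxy) (fy ℤ.+ sxy)) (ℕ.≤-trans
            (ℕ.+-mono-≤ (side (path x) (base (a · x)) (base (a · y)) (proj₂ (displacement x))) (side (path y) (base x) (base y) (proj₂ (displacement y))))
            (ℕ.≤-reflexive (arith r))))) bound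
            where
            side : ∀ {x y} (S : x ⇝ y) c d → len S ≤ r → ∣ netΔ S l ℤ.+ stepNet c d l ∣ ≤ r ℕ.+ 1
            side S c d le = ℕ.≤-trans (ℤₚ.∣i+j∣≤∣i∣+∣j∣ (netΔ S l) (stepNet c d l)) (ℕ.+-mono-≤ (ℕ.≤-trans (∣netΔ∣≤len S l) le) (∣stepNet∣≤1 c d l))
            arith : ∀ r → r ℕ.+ 1 ℕ.+ (r ℕ.+ 1) ≡ r ℕ.+ r ℕ.+ 2
            arith = ℕsolve
              where open import Data.Nat.Tactic.RingSolver renaming (solve-∀ to ℕsolve)

        module _ (Y : Loop) where
          θ : Letter → ℤ
          θ = net Y

          potential : VertexΔ → ℤ
          potential x = pair θ (netΔ (path x))

          two-θ : ∀ s t → pair θ (stepNet s t) ≡ θ (s , t) ℤ.+ θ (s , t)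
          two-θ s t = trans (pair-stepNet θ s t) (trans (cong (λ z → θ (s , t) ℤ.- z) (net-antisym Y s t)) (cong (λ z → θ (s , t) ℤ.+ z) (ℤₚ.neg-involutive (θ (s , t)))))

          θ₂ : VertexΔ → VertexΔ → ℤ
          θ₂ x y = θ (base x , base y) ℤ.+ θ (base x , base y)

          -- Pairing `exact` with the circulation `θ` leaves only its values on the edge and on the
          -- image edge. They are doubled, since `θ` is antisymmetric and both directions of an edge
          -- contribute.
          potential-step : ∀ {x y} → AdjΔ x y → potential y ℤ.- potential x ≡ θ₂ (a · x) (a · y) ℤ.- θ₂ x y
          potential-step {x} {y} s = rearr (potential x) (θ₂ (a · x) (a · y)) (potential y) (θ₂ x y) (trans
            (trans (cong (λ z → potential x ℤ.+ z) (sym (two-θ (base (a · x)) (base (a · y))))) (sym (pair-+ θ (netΔ (path x)) (stepNet (base (a · x)) (base (a · y))))))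
            (trans (pair-cong θ (exact s)) (trans (pair-+ θ (netΔ (path y)) (stepNet (base x) (base y))) (cong (λ z → potential y ℤ.+ z) (two-θ (base x) (base y))))))
            where
            rearr : ∀ P A Q B → P ℤ.+ A ≡ Q ℤ.+ B → Q ℤ.- P ≡ A ℤ.- B
            rearr P A Q B e = trans (e₁ P Q B) (trans (cong (λ z → z ℤ.- P ℤ.- B) (sym e)) (e₂ P A B))
              where
              e₁ : ∀ P Q B → Q ℤ.- P ≡ (Q ℤ.+ B) ℤ.- P ℤ.- B
              e₁ = solve-∀
              e₂ : ∀ P A B → (P ℤ.+ A) ℤ.- P ℤ.- B ≡ A ℤ.- B
              e₂ = solve-∀

          on-edges : VertexΔ → VertexΔ → ℤ → ℤ
          on-edges x y z = if does (AdjΔ? x y) then z else 0ℤ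

          divergence-free : ∀ x → sum (λ y → on-edges x y (θ₂ x y)) ≡ 0ℤ
          divergence-free x = trans (if-sum x (λ v → θ (base x , v) ℤ.+ θ (base x , v))) (trans (sum-cong-≋ off) (trans
              (∑-distrib-+ (λ v → θ (base x , v)) (λ v → θ (base x , v))) (cong₂ ℤ._+_ zero-div zero-div)))
            where
            open NeighbourSum ℤₚ.+-0-commutativeMonoid
            zero-div : sum (λ v → θ (base x , v)) ≡ 0ℤ
            zero-div = trans (divergence Y (base x)) (ℤₚ.+-inverseʳ [ base x Fin.≟ v₀ ]ᶻ)
            off : ∀ v → (if does (Adj? (base x) v) then θ (base x , v) ℤ.+ θ (base x , v) else 0ℤ) ≡ θ (base x , v) ℤ.+ θ (base x , v)
            off v with Adj? (base x) v
            ... | yes _ = refl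
            ... | no ¬b = sym (cong₂ ℤ._+_ (net-off Y ¬b) (net-off Y ¬b))

          -- By `potential-step` the sum is the divergence of the lifted circulation at `a · x`,
          -- after reindexing by `a`, minus that at `x`; both are zero.
          harmonic : ∀ x → sum (λ y → on-edges x y (potential y ℤ.- potential x)) ≡ 0ℤ
          harmonic x = trans (sum-cong-≋ pointwise) (trans (∑-distrib-+ (λ y → on-edges (a · x) (a · y) (θ₂ (a · x) (a · y))) (λ y → (ℤ.- 1ℤ) ℤ.* on-edges x y (θ₂ x y)))
            (cong₂ ℤ._+_ (trans (sym (sum-permute (λ y → on-edges (a · x) y (θ₂ (a · x) y)) (Automorphism.perm a))) (divergence-free (a · x)))
              (trans (sym (*-distribˡ-sum (ℤ.- 1ℤ) (λ y → on-edges x y (θ₂ x y)))) (trans (cong (λ z → (ℤ.- 1ℤ) ℤ.* z) (divergence-free x)) (ℤₚ.*-zeroʳ (ℤ.- 1ℤ))))))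
            where
            pointwise : ∀ y → on-edges x y (potential y ℤ.- potential x) ≡ on-edges (a · x) (a · y) (θ₂ (a · x) (a · y)) ℤ.+ (ℤ.- 1ℤ) ℤ.* on-edges x y (θ₂ x y)
            pointwise y with AdjΔ? x y | AdjΔ? (a · x) (a · y)
            ... | yes s | yes _ = trans (potential-step s) (cong (λ z → θ₂ (a · x) (a · y) ℤ.+ z) (sym (ℤₚ.-1*i≡-i (θ₂ x y))))
            ... | yes s | no ¬s = contradiction (image s) ¬s
            ... | no ¬s | yes s = contradiction (Equivalence.from (Automorphism.preserves a x y) s) ¬s
            ... | no _  | no _  = refl

          -- The maximum principle: at a maximum the terms of the zero sum `harmonic` are all
          -- non-positive, so each of them is zero and the neighbours attain the maximum as well.
          spread : ∀ {x y} → (∀ z → potential z ℤ.≤ potential x) → x ⇝ y → potential y ≡ potential x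
          spread max ε = refl
          spread {x} max (_◅_ {j = z} s S) = trans (spread (λ w → subst (potential w ℤ.≤_) (sym eq) (max w)) S) eq
            where
            term : ∀ y → on-edges x y (potential y ℤ.- potential x) ℤ.≤ 0ℤ
            term y with AdjΔ? x y
            ... | yes _ = ℤₚ.i≤j⇒i-j≤0 (max y)
            ... | no _  = ℤₚ.≤-refl
            adjacent-term : on-edges x z (potential z ℤ.- potential x) ≡ potential z ℤ.- potential x
            adjacent-term with AdjΔ? x z
            ... | yes _ = refl
            ... | no ¬s = contradiction s ¬s
            eq : potential z ≡ potential x
            eq = ℤₚ.i-j≡0⇒i≡j _ _ (trans (sym adjacent-term) (nonpositive-terms _ term (harmonic x) z))

          constant : ∀ x y → potential x ≡ potential y
          constant x y with argmax potential x
          ... | m , max = trans (spread max (Δ-connected m x)) (sym (spread max (Δ-connected m y)))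

          same-θ : ∀ {x y} → AdjΔ x y → θ (base (a · x) , base (a · y)) ≡ θ (base x , base y)
          same-θ {x} {y} s = double (ℤₚ.i-j≡0⇒i≡j _ _ (trans (sym (potential-step s)) (ℤₚ.i≡j⇒i-j≡0 {potential y} {potential x} (constant y x))))
            where
            double : ∀ {i j} → i ℤ.+ i ≡ j ℤ.+ j → i ≡ j
            double {i} {j} e = ℤₚ.*-cancelˡ-≡ (+ 2) i j (trans (two i) (trans e (sym (two j))))
              where
              two : ∀ i → + 2 ℤ.* i ≡ i ℤ.+ i
              two = solve-∀

        -- Every circulation takes the same value on an edge and on its image, and loops separate
        -- distinct edges, so the image lies over the same edge. If the direction were reversed,
        -- every circulation would vanish there, but some loop has a non-zero count on the edge.
        same-label : ∀ {x y} → AdjΔ x y → (base (a · x) , base (a · y)) ≡ (base x , base y)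
        same-label {x} {y} s with (base (a · x) , base (a · y)) ≟ᴸ (base x , base y)
        ... | yes e = e
        ... | no ne with (base (a · x) , base (a · y)) ≟ᴸ (base y , base x)
        ...   | no ne′ = ⊥-elim (nz (R.trans (R.reflexive (cong ι (sym (same-θ Y s)))) z))
          where
          sep = separate (AdjΔ-base s) (AdjΔ-base (image s)) ne ne′
          Y = proj₁ sep
          nz = proj₁ (proj₂ sep)
          z = proj₂ (proj₂ sep)
        ...   | yes e = ⊥-elim (nz (R.trans (R.reflexive (cong ι θ≡0)) ι-0))
          where
          other = other-neighbour (base x) (base y)
          w = proj₁ other
          sep = separate (AdjΔ-base s) (proj₁ (proj₂ other)) (λ e → proj₂ (proj₂ other) (cong proj₂ e))
                  (λ e → Adj-irrefl (cong proj₁ e) (AdjΔ-base s))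
          Y = proj₁ sep
          nz = proj₁ (proj₂ sep)
          θ≡0 : net Y (base x , base y) ≡ 0ℤ
          θ≡0 = self-neg (trans (sym (same-θ Y s)) (trans (cong (net Y) e) (net-antisym Y (base x) (base y))))
            where
            self-neg : ∀ {i} → i ≡ ℤ.- i → i ≡ 0ℤ
            self-neg {i} e = ℤₚ.*-cancelˡ-≡ (+ 2) i 0ℤ (trans (two i) (trans (cong (λ z → i ℤ.+ z) e) (ℤₚ.+-inverseʳ i)))
              where
              two : ∀ i → + 2 ℤ.* i ≡ i ℤ.+ i
              two = solve-∀

        small-displacement⇒deck : a ∈ deckGroup
        small-displacement⇒deck x with other-neighbour (base x) (base x)
        ... | w , b , _ = cong proj₁ (same-label (subst (λ z → AdjΔ z y) (pt-wk x) (AdjΔ-step (wk x) b)))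
          where y = pt (wk x ◅◅ (b ◅ ε))

open Displacements

-- A loop and a word on which only the trivial vertex map survives

module RigidWord where
  open import Data.Fin.Permutation using (_⟨$⟩ˡ_; inverseˡ; inverseʳ)
  open import Data.Integer using (+_; 0ℤ)
  open import Data.Integer.Divisibility.Signed using (_∣_; divides)
  open import Data.List using (cartesianProduct)
  open import Data.List.Properties using (length-map; map-∘; map-cong; map-id)
  open import Data.List.Relation.Unary.All as All using (All)
  open import Data.List.Membership.Propositional using () renaming (_∈_ to _∈ᴸ_)
  open import Data.List.Membership.Propositional.Properties using (∈-map⁺; ∈-cartesianProduct⁺; ∈-allFin)
  open import Data.Nat using (pred)
  open import Relation.Binary.Construct.Closure.ReflexiveTransitive using (ε; _◅_; _◅◅_)
  open ≡ using (refl; sym; trans; cong; cong₂; subst)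

  module Rigidity (Γ : Graph) (connected : Connected Γ) (tetravalent : Tetravalent Γ)
      (G : Subgroup (Aut Γ)) (edge-transitive : EdgeTransitive G)
      {|G| : ℕ} (G-order : HasOrder ⟪ G ⟫ |G|)
      {p : ℕ} (p-prime : Prime p) (coeff : Coefficients p) (v₀ : Graph.Vertex Γ) where
    open Walking Γ coeff
    open Separator Γ p-prime coeff
    open Separating Γ connected tetravalent G edge-transitive p-prime coeff v₀ using (separate)
    open SmallDisplacement Γ connected tetravalent G edge-transitive p-prime coeff v₀ using (other-neighbour)
    open LoopGroup Γ connected p-prime coeff v₀ public
    private
      module R = CommutativeRing (Coefficients.ring coeff)
    open R using (_≈_; 0#)
    open Coefficients coeff using (≈0?)

    neighbour : ∀ u → Σ[ w ∈ Vertex ] Adj u w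
    neighbour u with other-neighbour u u
    ... | w , a , _ = w , a

    private
      a₀ = proj₁ (neighbour v₀)
      va = proj₂ (neighbour v₀)
      b₀ = proj₁ (other-neighbour v₀ a₀)
      vb = proj₁ (proj₂ (other-neighbour v₀ a₀))
      b≢a = proj₂ (proj₂ (other-neighbour v₀ a₀))

      -- Two edges at `v₀` start the nested commutator: `x₀` sees the first and not the second, `y₀`
      -- sees the second.
      x₀ = separate va vb (λ e → b≢a (cong proj₂ e)) (λ e → Adj-irrefl (cong proj₁ e) va)
      y₀ = separate vb va (λ e → b≢a (sym (cong proj₂ e))) (λ e → Adj-irrefl (cong proj₁ e) vb)

      -- For a pair of distinct edges the test excludes that the first letter is sent to the second.
      -- All other pairs receive some valid test, since additional tests do no harm.
      testFor : Letter → Letter → Test v₀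
      testFor (u , v) (x , y) with Adj? u v | Adj? x y | (x , y) ≟ᴸ (u , v) | (x , y) ≟ᴸ (v , u)
      ... | yes uv | yes xy | no ne | no ne′ = test (u , v) (proj₁ s) (proj₁ (proj₂ s))
        where s = separate uv xy ne ne′
      ... | _ | _ | _ | _ = test (v₀ , a₀) (proj₁ x₀) (proj₁ (proj₂ x₀))

      testFor-fails : ∀ {u v x y} → Adj u v → Adj x y → (x , y) ≢ (u , v) → (x , y) ≢ (v , u) →
        ∀ (π : Letter → Letter) → π (u , v) ≡ (x , y) →
        ι (net (Test.loop (testFor (u , v) (x , y))) (π (Test.letter (testFor (u , v) (x , y))))) ≈ 0#
      testFor-fails {u} {v} {x} {y} uv xy ne ne′ π e with Adj? u v | Adj? x y | (x , y) ≟ᴸ (u , v) | (x , y) ≟ᴸ (v , u)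
      ... | yes uv′ | yes xy′ | no n | no n′ = R.trans (R.reflexive (cong (λ l → ι (net (proj₁ s) l)) e)) (proj₂ (proj₂ s))
        where s = separate uv′ xy′ n n′
      ... | no ¬a | _     | _     | _     = contradiction uv ¬a
      ... | yes _ | no ¬a | _     | _     = contradiction xy ¬a
      ... | yes _ | yes _ | yes e′ | _     = contradiction e′ ne
      ... | yes _ | yes _ | no _  | yes e′ = contradiction e′ ne′

      tests : List (Test v₀)
      tests = map (λ (e , f) → testFor e f) (cartesianProduct letters letters)

      letter∈ : ∀ l → l ∈ᴸ letters
      letter∈ (u , v) = ∈-cartesianProduct⁺ (∈-allFin u) (∈-allFin v)

      -- Kept opaque: each test replaces a word of length `s` by one of length `p ^ s + s`, so the
      -- word must never be evaluated.
      abstract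
        W : Witness v₀ tests
        W = witness v₀ (witness-base v₀ (proj₁ x₀) (proj₁ y₀) (v₀ , a₀) (v₀ , b₀) (proj₁ (proj₂ x₀)) (proj₂ (proj₂ x₀)) (proj₁ (proj₂ y₀)))

    open Witness W public using (word) renaming (loop to w)

    w-net : ∀ l → net w l ≡ 0ℤ
    w-net = Witness.net≡0 W

    w-nonzero : ¬ (n° w word ≈ 0#)
    w-nonzero = Witness.nonzero W

    -- One less than the length of the word, to match the kernels, whose tested words have length
    -- `suc s`.
    s : ℕ
    s = pred (length word)

    word-length : length word ≡ suc s
    word-length = go word w-nonzero
      where
      go : ∀ ℓ → ¬ (n° w ℓ ≈ 0#) → length ℓ ≡ suc (pred (length ℓ))
      go []      ne = ⊥-elim (ne R.refl)
      go (_ ∷ _) ne = refl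

    w-ord : Ord (suc s) (n° w)
    w-ord = subst (λ k → Ord k (n° w)) word-length (Witness.ord W)

    module _ (π : Vertex → Vertex) (π-inj : ∀ {u v} → π u ≡ π v → u ≡ v) (π-adj : ∀ {u v} → Adj u v → Adj (π u) (π v))
             (survives : ¬ (n° w (map (mapᴸ π π-inj) word) ≈ 0#)) where
      edge-fixed : ∀ {u v} → Adj u v → (π u , π v) ≡ (u , v) ⊎ (π u , π v) ≡ (v , u)
      edge-fixed {u} {v} uv with (π u , π v) ≟ᴸ (u , v) | (π u , π v) ≟ᴸ (v , u)
      ... | yes e | _      = inj₁ e
      ... | no _  | yes e  = inj₂ e
      ... | no ne | no ne′ = contradiction (testFor-fails uv (π-adj uv) ne ne′ (mapᴸ π π-inj) refl)
        (All.lookup (Witness.selective W (mapᴸ π π-inj) survives)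
          (∈-map⁺ (λ (e , f) → testFor e f) (∈-cartesianProduct⁺ (letter∈ (u , v)) (letter∈ (π u , π v)))))

      -- Every edge is kept as a set. Two edges at `u` with different far ends cannot both be
      -- reversed, as `u` would then have two images; so `u` is fixed.
      survivor-trivial : ∀ u → π u ≡ u
      survivor-trivial u with neighbour u
      ... | a , ua with edge-fixed ua
      ...   | inj₁ e = cong proj₁ e
      ...   | inj₂ e with other-neighbour u a
      ...     | b , ub , b≢a with edge-fixed ub
      ...       | inj₁ e′ = cong proj₁ e′
      ...       | inj₂ e′ = contradiction (trans (sym (cong proj₁ e′)) (cong proj₁ e)) b≢a

    actInj : ∀ (g : Automorphism Γ) {u v} → g · u ≡ g · v → u ≡ v
    actInj g {u} {v} e = trans (sym (inverseˡ π)) (trans (cong (π ⟨$⟩ˡ_) e) (inverseˡ π))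
      where π = Automorphism.perm g

    actAdj : ∀ (g : Automorphism Γ) {u v} → Adj u v → Adj (g · u) (g · v)
    actAdj g = Equivalence.to (Automorphism.preserves g _ _)

    actᴸ : Automorphism Γ → Letter → Letter
    actᴸ g = mapᴸ (g ·_) (actInj g)

    actᵂ : ∀ (g : Automorphism Γ) {u v} → Walk u v → Walk (g · u) (g · v)
    actᵂ g = mapᵂ (g ·_) (actInj g) (actAdj g)

    _⁻¹ᴬ : Automorphism Γ → Automorphism Γ
    _⁻¹ᴬ = Group._⁻¹ (Aut Γ)

    act-inverse : ∀ g ℓ → map (actᴸ g) (map (actᴸ (g ⁻¹ᴬ)) ℓ) ≡ ℓ
    act-inverse g ℓ = trans (sym (map-∘ ℓ)) (trans (map-cong (λ (u , v) → cong₂ _,_ (inverseʳ (Automorphism.perm g)) (inverseʳ (Automorphism.perm g))) ℓ) (map-id ℓ))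

    n°-act : ∀ g {u v} (X : Walk u v) ℓ → n° (actᵂ g X) ℓ ≈ n° X (map (actᴸ (g ⁻¹ᴬ)) ℓ)
    n°-act g X []      = R.refl
    n°-act g X (l ∷ ℓ) = R.trans (R.reflexive (cong (magnus (actᵂ g X)) (sym (act-inverse g (l ∷ ℓ)))))
      (magnus-map (g ·_) (actInj g) (actAdj g) X (map (actᴸ (g ⁻¹ᴬ)) (l ∷ ℓ)))

    net-act : ∀ g {u v} (X : Walk u v) l → net (actᵂ g X) l ≡ net X (actᴸ (g ⁻¹ᴬ) l)
    net-act g X l = trans (cong (net (actᵂ g X)) (sym (cong₂ _,_ (inverseʳ (Automorphism.perm g)) (inverseʳ (Automorphism.perm g)))))
      (net-map (g ·_) (actInj g) (actAdj g) X (actᴸ (g ⁻¹ᴬ) l))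

    same-act : ∀ g {u v u′ v′} {W : Walk u v} {W′ : Walk u′ v′} → Same W W′ → Same (actᵂ g W) (actᵂ g W′)
    same-act g (same-ε e)     = same-ε (cong (g ·_) e)
    same-act g (same-◅ e f S) = same-◅ (cong (g ·_) e) (cong (g ·_) f) (same-act g S)

    same-act² : ∀ g h → (∀ u → g · (h · u) ≡ u) → ∀ {u v} (W : Walk u v) → Same (actᵂ g (actᵂ h W)) W
    same-act² g h e ε       = same-ε (e _)
    same-act² g h e (a ◅ W) = same-◅ (e _) (e _) (same-act² g h e W)

    act-◅◅ : ∀ g {u v w} (W : Walk u v) (Z : Walk v w) → actᵂ g (W ◅◅ Z) ≡ actᵂ g W ◅◅ actᵂ g Z
    act-◅◅ g ε       Z = refl
    act-◅◅ g (a ◅ W) Z = cong (actAdj g a ◅_) (act-◅◅ g W Z)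

    act-rev : ∀ h {u v} (W : Walk u v) → Same (actᵂ h (rev W)) (rev (actᵂ h W))
    act-rev h ε       = same-ε refl
    act-rev h (a ◅ W) = subst (λ Z → Same Z (rev (actᵂ h (a ◅ W)))) (sym (act-◅◅ h (rev W) (Adj-sym a ◅ ε)))
      (same-◅◅ (act-rev h W) (same-◅ refl refl (same-ε refl)))

    g# : Fin |G| → Automorphism Γ
    g# i = proj₁ (Inverse.to G-order i)

    ω : Fin |G| → Word
    ω i = map (actᴸ (g# i)) word

    ω-length : ∀ i → length (ω i) ≡ suc s
    ω-length i = trans (length-map _ word) word-length

    TrivialAt : ℕ → ∀ {u} → Walk u u → Set
    TrivialAt = Trivial s |G| ω ω-length

    index-of : ∀ {g : Automorphism Γ} → g ∈ G → Σ[ i ∈ Fin |G| ] (∀ u → g# i · u ≡ g · u)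
    index-of {g} g∈ = Inverse.from G-order (g , g∈) , Inverse.strictlyInverseˡ G-order (g , g∈)

    Ord-act : ∀ g {u v} (X : Walk u v) {k} → Ord k (n° X) → Ord k (n° (actᵂ g X))
    Ord-act g X o ℓ h = R.trans (n°-act g X ℓ) (o (map (actᴸ (g ⁻¹ᴬ)) ℓ) (subst (_< _) (sym (length-map (actᴸ (g ⁻¹ᴬ)) ℓ)) h))

    -- Left multiplication by an element of `G` permutes `G`, so the translates of the word are
    -- permuted among themselves.
    Trivial-act : ∀ {g : Automorphism Γ} → g ∈ G → ∀ k {u} (X : Walk u u) → TrivialAt k X → TrivialAt k (actᵂ g X)
    Trivial-act {g} g∈ k X ((o , z) , d) =
      (Ord-act g X o , λ i → R.trans (n°-act g X (ω i)) (R.trans (R.reflexive (cong (n° X) (translated i))) (z (proj₁ (j i))))) ,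
      λ l → subst (+ (p ℕ.^ k) ∣_) (sym (net-act g X l)) (d _)
      where
      j : ∀ i → Σ[ j ∈ Fin |G| ] (∀ u → g# j · u ≡ (g ⁻¹ᴬ) · (g# i · u))
      j i = index-of {g = Group._∙_ (Aut Γ) (g ⁻¹ᴬ) (g# i)}
        (Subgroup.∙-closed G (Subgroup.⁻¹-closed G g∈) (proj₂ (Inverse.to G-order i)))
      translated : ∀ i → map (actᴸ (g ⁻¹ᴬ)) (ω i) ≡ ω (proj₁ (j i))
      translated i = trans (sym (map-∘ word)) (map-cong (λ (u , v) → sym (cong₂ _,_ (proj₂ (j i) u) (proj₂ (j i) v))) word)

    -- The coefficient of the translated loop on `ω i` is that of `w` on the translate of `word` by
    -- the inverse of `β` times `g# i`. If it survived, that product would fix every vertex and `β`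
    -- would act as `g# i`.
    Trivial-outside : ∀ β → (∀ i → ¬ (∀ u → g# i · u ≡ β · u)) → ∀ k → TrivialAt k (actᵂ β w)
    Trivial-outside β outside k =
      (Ord-act β w w-ord , λ i → R.trans (n°-act β w (ω i)) (R.trans (R.reflexive (cong (n° w) (sym (map-∘ word)))) (vanish i))) ,
      λ l → divides 0ℤ (trans (net-act β w l) (w-net _))
      where
      vanish : ∀ i → n° w (map (λ l → actᴸ (β ⁻¹ᴬ) (actᴸ (g# i) l)) word) ≈ 0#
      vanish i = decidable-stable (≈0? _) λ ne → outside i λ u →
        trans (sym (inverseʳ (Automorphism.perm β))) (cong (β ·_)
          (survivor-trivial (λ u → (β ⁻¹ᴬ) · (g# i · u)) (λ e → actInj (g# i) (actInj (β ⁻¹ᴬ) e)) (λ a → actAdj (β ⁻¹ᴬ) (actAdj (g# i) a)) ne u))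

    identity-index : Σ[ i ∈ Fin |G| ] ω i ≡ word
    identity-index with index-of (Subgroup.ε-closed G)
    ... | i , e = i , trans (map-cong (λ (u , v) → cong₂ _,_ (e u) (e v)) word) (map-id word)

open RigidWord

-- Normality of the deck group

module DeckNormality where
  open import Data.Fin.Permutation using (inverseˡ; inverseʳ)
  open import Data.Integer using (ℤ; +_; 0ℤ)
  open import Data.Integer.Divisibility.Signed using (_∣_; divides)
  open import Relation.Binary.Construct.Closure.ReflexiveTransitive using (Star; ε; _◅_; _◅◅_; gmap)
  open import Relation.Binary.Construct.Closure.ReflexiveTransitive.Properties using (◅◅-assoc)
  open ≡ using (refl; sym; trans; cong; cong₂; subst)
  open import Algebra.Properties.CommutativeMonoid.Sum ℕ.+-0-commutativeMonoid using (sum)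

  module Normality (Γ : Graph) (connected : Connected Γ) (tetravalent : Tetravalent Γ)
      (G : Subgroup (Aut Γ)) (edge-transitive : EdgeTransitive G)
      {|G| : ℕ} (G-order : HasOrder ⟪ G ⟫ |G|)
      {p : ℕ} (p-prime : Prime p) (coeff : Coefficients p) (v₀ : Graph.Vertex Γ) where
    open Walking Γ coeff
    open Rigidity Γ connected tetravalent G edge-transitive G-order p-prime coeff v₀
    open Covering Γ connected p-prime coeff v₀
    open SmallDisplacement Γ connected tetravalent G edge-transitive p-prime coeff v₀
    open PrimePowerIndex loops coeff
    private
      module R = CommutativeRing (Coefficients.ring coeff)
      module L = Group loops
    open R using (_≈_; 0#)

    ∥_∥ : ∀ {u v} → Walk u v → ℕ
    ∥ ε ∥     = 0
    ∥ _ ◅ W ∥ = suc ∥ W ∥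

    ∥◅◅∥ : ∀ {u v w} (W : Walk u v) (Z : Walk v w) → ∥ W ◅◅ Z ∥ ≡ ∥ W ∥ ℕ.+ ∥ Z ∥
    ∥◅◅∥ ε       Z = refl
    ∥◅◅∥ (_ ◅ W) Z = cong suc (∥◅◅∥ W Z)

    ∥rev∥ : ∀ {u v} (W : Walk u v) → ∥ rev W ∥ ≡ ∥ W ∥
    ∥rev∥ ε       = refl
    ∥rev∥ (a ◅ W) = trans (∥◅◅∥ (rev W) (Adj-sym a ◅ ε)) (trans (ℕ.+-comm ∥ rev W ∥ 1) (cong suc (∥rev∥ W)))

    -- The coarse kernel does not depend on the modulus of the net counts, hence neither does the
    -- radius, and the modulus can be chosen larger.
    module _ (coarse : NormalPrimePowerIndex (WordTrivial s |G| ω ω-length)) where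
      module C = NormalPrimePowerIndex coarse
      module CO = Inverse (proj₂ C.index)

      -- Sums serve as crude maxima. `shortLoop` bounds a generator, which consists of two walks `τ`
      -- and an edge; `radius` bounds its conjugate by a coarse representative followed by some
      -- `τ u`.
      maxτ maxRep shortLoop radius : ℕ
      maxτ      = sum (λ u → ∥ τ u ∥)
      maxRep    = sum (λ i → ∥ CO.to i ∥)
      shortLoop = maxτ ℕ.+ suc maxτ
      radius    = (maxRep ℕ.+ maxτ) ℕ.+ (shortLoop ℕ.+ (maxRep ℕ.+ maxτ))

      module _ (modulus : ℕ) (fine : NormalPrimePowerIndex (TrivialAt modulus)) (modulus< : radius ℕ.+ radius ℕ.+ 2 < p ℕ.^ modulus) where
        module K = NormalPrimePowerIndex fine
        open Kernel K.subgroup K.normal (proj₂ K.index)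

        N-net : ∀ {x} → x ∈ K.subgroup → ∀ l → + (p ℕ.^ modulus) ∣ net x l
        N-net m = proj₂ (K.to m)

        _⇝Δ_ : VertexΔ → VertexΔ → Set
        _⇝Δ_ = Star AdjΔ

        lenΔ : ∀ {x y} → x ⇝Δ y → ℕ
        lenΔ = len K.subgroup K.normal (proj₂ K.index) (p ℕ.^ modulus) N-net

        deck-of-small : ∀ (a : Automorphism Δ) → (∀ x → Σ[ S ∈ x ⇝Δ (a · x) ] lenΔ S ≤ radius) → a ∈ deckGroup
        deck-of-small a d = small-displacement⇒deck K.subgroup K.normal (proj₂ K.index) (p ℕ.^ modulus) N-net a radius modulus< d

        liftΔ : ∀ {u v} (W : Walk v₀ u) (Z : Walk u v) → Σ[ S ∈ pt W ⇝Δ pt (W ◅◅ Z) ] lenΔ S ≡ ∥ Z ∥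
        liftΔ W ε       = subst (λ Y → Σ[ S ∈ pt W ⇝Δ pt Y ] lenΔ S ≡ 0) (sym (◅◅-identityʳ W)) (ε , refl)
        liftΔ W (a ◅ Z) with liftΔ (W ◅◅ (a ◅ ε)) Z
        ... | S , e = subst (λ Y → Σ[ S ∈ pt W ⇝Δ pt Y ] lenΔ S ≡ suc ∥ Z ∥) (◅◅-assoc W (a ◅ ε) Z) (AdjΔ-step W a ◅ S , cong suc e)

        -- Up to the coarse kernel every walk W from v₀ is a short walk W₀, and conjugation by W W₀⁻¹
        -- moves no loop modulo the fine kernel.
        short-displacement : ∀ (Y : Loop) → ∥ Y ∥ ≤ shortLoop → ∀ x → Σ[ S ∈ x ⇝Δ (deck Y · x) ] lenΔ S ≤ radius
        short-displacement Y le x = subst (λ z → Σ[ S ∈ z ⇝Δ (deck Y · x) ] lenΔ S ≤ radius) (pt-wk x)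
            (subst (λ z → Σ[ S ∈ pt W ⇝Δ z ] lenΔ S ≤ radius) same (proj₁ (liftΔ W Z) , ℕ.≤-trans (ℕ.≤-reflexive (proj₂ (liftΔ W Z))) Z-short))
          where
          u = base x
          W = wk x
          r = CO.to (CO.from (val W))
          W₀ = r ◅◅ τ u
          Z = rev W₀ ◅◅ (Y ◅◅ W₀)
          t = W ◅◅ rev W₀
          W₀-short : ∥ W₀ ∥ ≤ maxRep ℕ.+ maxτ
          W₀-short = ℕ.≤-trans (ℕ.≤-reflexive (∥◅◅∥ r (τ u))) (ℕ.+-mono-≤ (term≤sum (λ i → ∥ CO.to i ∥) (CO.from (val W))) (term≤sum (λ u → ∥ τ u ∥) u))
          Z-short : ∥ Z ∥ ≤ radius
          Z-short = ℕ.≤-trans (ℕ.≤-reflexive (trans (∥◅◅∥ (rev W₀) (Y ◅◅ W₀)) (cong₂ ℕ._+_ (∥rev∥ W₀) (∥◅◅∥ Y W₀))))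
            (ℕ.+-mono-≤ W₀-short (ℕ.+-mono-≤ le W₀-short))
          open GroupProperties loops using (⁻¹-anti-homo-∙; ⁻¹-involutive)
          open Subgroup C.subgroup renaming (∈-resp-≈ to C-resp; ∙-closed to C-∙; ⁻¹-closed to C-⁻¹)
          open import Relation.Binary.Reasoning.Setoid (Group.setoid loops)
          rev-◅◅ : ∀ {a b c} (X : Walk a b) (X′ : Walk b c) → rev (X ◅◅ X′) ≡ rev X′ ◅◅ rev X
          rev-◅◅ ε       X′ = sym (◅◅-identityʳ (rev X′))
          rev-◅◅ (b ◅ X) X′ = trans (cong (_◅◅ (Adj-sym b ◅ ε)) (rev-◅◅ X X′)) (◅◅-assoc (rev X′) (rev X) (Adj-sym b ◅ ε))
          t∈ : t ∈ C.subgroup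
          t∈ = C-resp eq (C.normal r (CO.strictlyInverseˡ (val W)))
            where
            eq : (r ◅◅ (rev r ◅◅ val W)) ◅◅ rev r ≐ t
            eq = begin
              (r ◅◅ (rev r ◅◅ val W)) ◅◅ rev r   ≈⟨ ◅◅-cong (≐-assoc⁻¹ r (rev r) (val W)) ≐-refl ⟩
              ((r ◅◅ rev r) ◅◅ val W) ◅◅ rev r   ≈⟨ ◅◅-cong (◅◅-congʳ (val W) (rev-inverseʳ r)) ≐-refl ⟩
              val W ◅◅ rev r                     ≈⟨ ≐-assoc W (rev (τ u)) (rev r) ⟩
              W ◅◅ (rev (τ u) ◅◅ rev r)          ≈⟨ ≡⇒≐ (cong (W ◅◅_) (sym (rev-◅◅ r (τ u)))) ⟩
              t                                  ∎
          conj-Y = (t ◅◅ Y) ◅◅ rev t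
          shift : W ◅◅ Z ≐ conj-Y ◅◅ W
          shift = ≐-sym (≐-trans (≐-assoc (t ◅◅ Y) (rev t) W) (≐-trans
            (◅◅-congˡ (t ◅◅ Y) back) (≐-trans (≐-assoc t Y W₀) (≐-assoc W (rev W₀) (Y ◅◅ W₀)))))
            where
            back : rev t ◅◅ W ≐ W₀
            back = ≐-trans (◅◅-congʳ W (≐-trans (≡⇒≐ (rev-◅◅ W (rev W₀))) (◅◅-congʳ (rev W) (same⇒≐ (same-rev-rev W₀)))))
              (≐-trans (≐-assoc W₀ (rev W) W) (≐-trans (◅◅-congˡ W₀ (rev-inverseˡ W)) (≐-identityʳ W₀)))
          -- A commutator of `t` and `Y` up to inversion: it lies in the coarse kernel because `t`
          -- does, and its net counts are zero because conjugation keeps them. So it lies in the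
          -- fine kernel for every modulus.
          comm : Loop
          comm = rev conj-Y ◅◅ Y
          comm∈ : comm ∈ C.subgroup
          comm∈ = C-resp eq (C-∙ t∈ (C.normal (rev Y) (C-⁻¹ t∈)))
            where
            eq : t ◅◅ ((rev Y ◅◅ rev t) ◅◅ rev (rev Y)) ≐ comm
            eq = begin
              t ◅◅ ((rev Y ◅◅ rev t) ◅◅ rev (rev Y))       ≈⟨ ◅◅-cong (≐-sym (⁻¹-involutive t)) (◅◅-cong (≐-sym (⁻¹-anti-homo-∙ t Y)) (⁻¹-involutive Y)) ⟩
              rev (rev t) ◅◅ (rev (t ◅◅ Y) ◅◅ Y)           ≈⟨ ≐-assoc⁻¹ (rev (rev t)) (rev (t ◅◅ Y)) Y ⟩
              (rev (rev t) ◅◅ rev (t ◅◅ Y)) ◅◅ Y           ≈⟨ ◅◅-congʳ Y (≐-sym (⁻¹-anti-homo-∙ (t ◅◅ Y) (rev t))) ⟩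
              comm                                          ∎
          comm-net : ∀ l → net comm l ≡ 0ℤ
          comm-net l = trans (net-◅◅ (rev conj-Y) Y l) (trans (cong (ℤ._+ net Y l) (trans (net-rev conj-Y l) (cong ℤ.-_ (net-conjugate t Y l)))) (ℤₚ.+-inverseˡ (net Y l)))
          comm-N : comm ∈ K.subgroup
          comm-N = K.from (C.to comm∈ , λ l → divides 0ℤ (comm-net l))
          same : pt (W ◅◅ Z) ≡ deck Y · x
          same = trans (pt-≐ shift) (pt-∙ {conj-Y} {Y} {W = W} {W} (mk≃ comm-N) ≃-refl)

        module AutΔ = Group (Aut Δ)

        -- Conjugation preserves displacements.
        conjugate-small : ∀ (c : Automorphism Δ) Y → ∥ Y ∥ ≤ shortLoop → (c AutΔ.∙ deck Y AutΔ.∙ c AutΔ.⁻¹) ∈ deckGroup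
        conjugate-small c Y le = deck-of-small (c AutΔ.∙ deck Y AutΔ.∙ c AutΔ.⁻¹) λ x →
          let y = (c AutΔ.⁻¹) · x
              S , len≤ = short-displacement Y le y
          in subst (λ z → Σ[ S ∈ z ⇝Δ (c · (deck Y · y)) ] lenΔ S ≤ radius) (inverseʳ (Automorphism.perm c))
               (gmap (c ·_) (λ {u} {v} → Equivalence.to (Automorphism.preserves c u v)) S , ℕ.≤-trans (ℕ.≤-reflexive (len-gmap S)) len≤)
          where
          len-gmap : ∀ {x y} (S : x ⇝Δ y) → lenΔ (gmap (c ·_) (λ {u} {v} → Equivalence.to (Automorphism.preserves c u v)) S) ≡ lenΔ S
          len-gmap ε       = refl
          len-gmap (_ ◅ S) = cong suc (len-gmap S)

        deck-∙ : ∀ Y Y′ x → deck (Y ◅◅ Y′) · x ≡ deck Y · (deck Y′ · x)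
        deck-∙ Y Y′ x = sym (trans (deck-pt Y (Y′ ◅◅ wk x)) (cong pt (sym (◅◅-assoc Y Y′ (wk x)))))

        deck-normal : IsNormal deckGroup
        deck-normal c {a} m x = trans (cong (λ z → base (c · z)) (proj₂ (deck-complete a m) ((c AutΔ.⁻¹) · x))) (conjugates (proj₁ (deck-complete a m)) x)
          where
          Q : Loop → Set
          Q Y = (c AutΔ.∙ deck Y AutΔ.∙ c AutΔ.⁻¹) ∈ deckGroup
          resp : ∀ {Y Y′} → Y ≐ Y′ → Q Y → Q Y′
          resp {Y} {Y′} e q x = trans (cong (λ z → base (c · z)) (sym (pt-≐ (◅◅-congʳ (wk ((c AutΔ.⁻¹) · x)) e)))) (q x)
          Qε : Q ε
          Qε x = cong base (trans (cong (c ·_) (pt-wk _)) (inverseʳ (Automorphism.perm c)))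
          Q∙ : ∀ {Y} s → ∥ s ∥ ≤ shortLoop → Q Y → Q (Y ◅◅ s)
          Q∙ {Y} s le q x = trans (cong (λ z → base (c · z)) (trans (deck-∙ Y s y) (cong (deck Y ·_) (sym (inverseˡ (Automorphism.perm c))))))
            (trans (q (c · (deck s · y))) (conjugate-small c s le x))
            where y = (c AutΔ.⁻¹) · x
          τ≤ : ∀ u → ∥ τ u ∥ ≤ maxτ
          τ≤ = term≤sum (λ u → ∥ τ u ∥)
          τ-short : ∥ τ v₀ ∥ ≤ shortLoop
          τ-short = ℕ.≤-trans (τ≤ v₀) (ℕ.m≤m+n maxτ (suc maxτ))
          conjugates : ∀ Y → Q Y
          conjugates = loop-induction Q (λ {Y} {Y′} → resp {Y} {Y′}) Qε (λ {Y} → Q∙ {Y} (τ v₀) τ-short)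
            (λ {Y} → Q∙ {Y} (rev (τ v₀)) (ℕ.≤-trans (ℕ.≤-reflexive (∥rev∥ (τ v₀))) τ-short))
            (λ {Y} {s} {t} b → Q∙ {Y} (generator b) (ℕ.≤-trans (ℕ.≤-reflexive (trans (∥◅◅∥ (τ s) (b ◅ rev (τ t))) (cong (λ k → ∥ τ s ∥ ℕ.+ suc k) (∥rev∥ (τ t)))))
              (ℕ.+-mono-≤ (τ≤ s) (s≤s (τ≤ t)))))

open DeckNormality

-- Projection and lifting of automorphisms

module LiftedAutomorphisms where
  open import Data.Fin.Permutation using (permutation; inverseˡ; inverseʳ)
  open import Data.Integer using (+_)
  open import Data.Integer.Divisibility.Signed using (_∣_)
  open import Relation.Binary.Construct.Closure.ReflexiveTransitive using (ε; _◅_; _◅◅_)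
  open import Relation.Binary.Construct.Closure.ReflexiveTransitive.Properties using (◅◅-assoc)
  open ≡ using (refl; sym; trans; cong; subst)

  module Lifting (Γ : Graph) (connected : Connected Γ) (tetravalent : Tetravalent Γ)
      (G : Subgroup (Aut Γ)) (vertex-transitive : VertexTransitive G) (edge-transitive : EdgeTransitive G)
      {|G| : ℕ} (G-order : HasOrder ⟪ G ⟫ |G|)
      {p : ℕ} (p-prime : Prime p) (coeff : Coefficients p) (v₀ : Graph.Vertex Γ) where
    open Walking Γ coeff
    open Rigidity Γ connected tetravalent G edge-transitive G-order p-prime coeff v₀
    open Covering Γ connected p-prime coeff v₀
    open SmallDisplacement Γ connected tetravalent G edge-transitive p-prime coeff v₀
    open PrimePowerIndex loops coeff
    private
      module R = CommutativeRing (Coefficients.ring coeff)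
      module L = Group loops
    open R using (_≈_; 0#)

    module _ (modulus : ℕ) (fine : NormalPrimePowerIndex (TrivialAt modulus)) where
      module K = NormalPrimePowerIndex fine
      open Kernel K.subgroup K.normal (proj₂ K.index)
      module AutΔ = Group (Aut Δ)

      module _ (deck-normal : IsNormal deckGroup) where
        -- The fibres are orbits of the deck group, and an automorphism permutes the orbits of a
        -- normal subgroup.
        fibre-preserving : ∀ (c : Automorphism Δ) {x y} → base x ≡ base y → base (c · x) ≡ base (c · y)
        fibre-preserving c {x} {y} e = sym (trans (cong (λ z → base (c · z)) (sym (trans (cong (deck Y ·_) (inverseˡ (Automorphism.perm c))) (proj₂ d))))
            (deck-normal c {deck Y} (deck∈ Y) (c · x)))
          where
          d = deck-transitive x y e
          Y = proj₁ d

        onBase : Automorphism Δ → Vertex → Vertex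
        onBase c u = base (c · pt (τ u))

        onBase-base : ∀ c x → onBase c (base x) ≡ base (c · x)
        onBase-base c x = fibre-preserving c (base-pt (τ (base x)))

        onBase-∙ : ∀ c d u → onBase (c AutΔ.∙ d) u ≡ onBase c (onBase d u)
        onBase-∙ c d u = sym (onBase-base c (d · pt (τ u)))

        onBase-inverse : ∀ c d → (∀ x → c · (d · x) ≡ x) → ∀ u → onBase c (onBase d u) ≡ u
        onBase-inverse c d e u = trans (onBase-base c (d · pt (τ u))) (trans (cong base (e (pt (τ u)))) (base-pt (τ u)))

        onBase-adj : ∀ c {u v} → Adj u v → Adj (onBase c u) (onBase c v)
        onBase-adj c {u} {v} a = subst (Adj (onBase c u)) (trans (sym (onBase-base c y)) (cong (onBase c) (base-pt (τ u ◅◅ (a ◅ ε)))))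
            (AdjΔ-base (Equivalence.to (Automorphism.preserves c (pt (τ u)) y) (AdjΔ-step (τ u) a)))
          where y = pt (τ u ◅◅ (a ◅ ε))

        induced : Automorphism Δ → Automorphism Γ
        induced c = record
          { perm = permutation (onBase c) (onBase c′) cc′ c′c
          ; preserves = λ u v → mk⇔ (onBase-adj c) (λ a → ≡.subst₂ Adj (c′c u) (c′c v) (onBase-adj c′ a))
          }
          where
          c′ = c AutΔ.⁻¹
          cc′ = onBase-inverse c c′ (λ x → inverseʳ (Automorphism.perm c))
          c′c = onBase-inverse c′ c (λ x → inverseˡ (Automorphism.perm c))

        -- The image of each lifted step is determined by its start and the fibre of its end.
        -- Consequently closed lifts go to closed lifts, and the induced automorphism preserves the
        -- kernel.
        induced-walk : ∀ c {u v} (W : Walk v₀ u) (X : Walk v₀ (onBase c u)) → c · pt W ≡ pt X → (Z : Walk u v) →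
          c · pt (W ◅◅ Z) ≡ pt (X ◅◅ actᵂ (induced c) Z)
        induced-walk c W X e ε = trans (cong (λ Y → c · pt Y) (◅◅-identityʳ W)) (trans e (cong pt (sym (◅◅-identityʳ X))))
        induced-walk c {u} W X e (_◅_ {j = v} a Z) = trans (cong (λ Y → c · pt Y) (sym (◅◅-assoc W (a ◅ ε) Z)))
            (trans (induced-walk c (W ◅◅ (a ◅ ε)) (X ◅◅ (a′ ◅ ε)) step Z) (cong pt (◅◅-assoc X (a′ ◅ ε) (actᵂ (induced c) Z))))
          where
          a′ = actAdj (induced c) a
          step : c · pt (W ◅◅ (a ◅ ε)) ≡ pt (X ◅◅ (a′ ◅ ε))
          step = AdjΔ-unique (subst (λ z → AdjΔ z (c · pt (W ◅◅ (a ◅ ε)))) e (Equivalence.to (Automorphism.preserves c _ _) (AdjΔ-step W a)))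
            (AdjΔ-step X a′)
            (trans (sym (onBase-base c (pt (W ◅◅ (a ◅ ε))))) (trans (cong (onBase c) (base-pt (W ◅◅ (a ◅ ε)))) (sym (base-pt (X ◅◅ (a′ ◅ ε))))))

        induced-closed : ∀ c {u} (Z : Walk u u) → conjugate (τ u) Z ∈ K.subgroup → conjugate (τ (onBase c u)) (actᵂ (induced c) Z) ∈ K.subgroup
        induced-closed c {u} Z m = closed-pt X (actᵂ (induced c) Z)
            (trans (sym (induced-walk c (τ u) X (sym (pt-wk _)) Z)) (trans (cong (c ·_) (pt-closed (τ u) Z m)) (sym (pt-wk _))))
          where
          X : Walk v₀ (onBase c u)
          X = wk (c · pt (τ u))

        same-pt : ∀ {u u′} {W : Walk v₀ u} {W′ : Walk v₀ u′} → Same W W′ → pt W ≡ pt W′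
        same-pt {W = W} {W′} S with same-end S
        ... | refl = pt-≐ (mk≐ (same-magnus S) (same-net S))

        -- Let `β` be the inverse of the induced automorphism. If `β` is outside `G`, the loop `βw`
        -- satisfies the kernel conditions by `Trivial-outside`; the induced automorphism preserves
        -- the kernel and brings `βw` back to `w`, whose coefficient on `word`, one of the `ω i`, is
        -- not zero.
        induced∈G : ∀ c → induced c ∈ G
        induced∈G c with Fin.any? (λ i → Fin.all? (λ u → (g# i · u) Fin.≟ (β · u)))
          where β = induced c ⁻¹ᴬ
        ... | yes (i , e) = Subgroup.∈-resp-≈ G {(g# i) ⁻¹ᴬ} {induced c} (λ u → trans (Group.⁻¹-cong (Aut Γ) {g# i} {induced c ⁻¹ᴬ} e u) refl)
                (Subgroup.⁻¹-closed G (proj₂ (Inverse.to G-order i)))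
        ... | no outside = ⊥-elim (w-nonzero (R.trans (R.sym survives) vanishes))
          where
          α β : Automorphism Γ
          α = induced c
          β = induced c ⁻¹ᴬ
          βw = actᵂ β w
          αβw = actᵂ α βw
          βw∈ : conjugate (τ (β · v₀)) βw ∈ K.subgroup
          βw∈ = K.from (Trivial-conjugate s |G| ω ω-length modulus (τ (β · v₀)) βw (Trivial-outside β (λ i e → outside (i , e)) modulus))
          αβw∈ : conjugate (τ (α · (β · v₀))) αβw ∈ K.subgroup
          αβw∈ = induced-closed c βw βw∈
          i₀ = proj₁ identity-index
          ord : Ord (suc s) (n° αβw)
          ord = Ord-act α βw (Ord-act β w w-ord)
          vanishes : n° αβw (ω i₀) ≈ 0#
          vanishes = R.trans (R.sym (n°-conjugate (suc s) (τ (α · (β · v₀))) αβw ord (ω i₀) (ℕ.≤-reflexive (ω-length i₀)))) (proj₂ (proj₁ (K.to αβw∈)) i₀)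
          survives : n° αβw (ω i₀) ≈ n° w word
          survives = R.trans (R.reflexive (cong (n° αβw) (proj₂ identity-index)))
            (°-cong (same-magnus (same-act² α β (λ u → inverseʳ (Automorphism.perm α)) w)) word)

        Trivial-unconjugate : ∀ {u} (Z : Walk u u) → conjugate (τ u) Z ∈ K.subgroup → TrivialAt modulus Z
        Trivial-unconjugate {u} Z m = transfer (Trivial-conjugate s |G| ω ω-length modulus (rev (τ u)) (conjugate (τ u) Z) (K.to m))
          where
          rev-rev-magnus : magnus (conjugate (rev (τ u)) (conjugate (τ u) Z)) ≗ magnus Z
          rev-rev-magnus = magnus≗ back
            where
            back : conjugate (rev (τ u)) (conjugate (τ u) Z) ≐ Z
            back = ≐-trans (◅◅-congʳ (rev (rev (τ u))) inner) (≐-trans (≐-assoc Z (rev (τ u)) (rev (rev (τ u))))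
              (≐-trans (◅◅-congˡ Z (rev-inverseʳ (rev (τ u)))) (≐-identityʳ Z)))
              where
              inner : rev (τ u) ◅◅ conjugate (τ u) Z ≐ Z ◅◅ rev (τ u)
              inner = ≐-trans (◅◅-congˡ (rev (τ u)) (≐-assoc (τ u) Z (rev (τ u))))
                (≐-trans (≐-assoc⁻¹ (rev (τ u)) (τ u) (Z ◅◅ rev (τ u))) (◅◅-congʳ (Z ◅◅ rev (τ u)) (rev-inverseˡ (τ u))))
          transfer : TrivialAt modulus (conjugate (rev (τ u)) (conjugate (τ u) Z)) → TrivialAt modulus Z
          transfer ((o , z) , d) = ((λ ℓ h → R.trans (R.sym (°-cong rev-rev-magnus ℓ)) (o ℓ h)) , (λ i → R.trans (R.sym (°-cong rev-rev-magnus (ω i))) (z i))) ,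
            λ l → subst (+ (p ℕ.^ modulus) ∣_) (trans (net-conjugate (rev (τ u)) (conjugate (τ u) Z) l) (net-conjugate (τ u) Z l)) (d l)

        module _ {g : Automorphism Γ} (g∈ : g ∈ G) (κ : Walk v₀ (g · v₀)) where
          -- Two walks with the same lifted end differ by a closed walk in the kernel. Its image
          -- under `g` lies in the kernel too, as `g` permutes the tested words.
          lift-cong : ∀ {u u′} {W : Walk v₀ u} {W′ : Walk v₀ u′} → pt W ≡ pt W′ → pt (κ ◅◅ actᵂ g W) ≡ pt (κ ◅◅ actᵂ g W′)
          lift-cong {W = W} {W′} e with pt-end {W = W} {W′} e
          ... | refl = trans (sym (pt-≐ expand)) (pt-closed (κ ◅◅ actᵂ g W′) (actᵂ g Z)
                (K.from (Trivial-conjugate s |G| ω ω-length modulus (τ _) (actᵂ g Z) (Trivial-act {g} g∈ modulus Z (Trivial-unconjugate Z closed)))))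
            where
            Z = rev W′ ◅◅ W
            cancel : W′ ◅◅ Z ≐ W
            cancel = ≐-trans (≐-assoc⁻¹ W′ (rev W′) W) (◅◅-congʳ W (rev-inverseʳ W′))
            closed : conjugate (τ _) Z ∈ K.subgroup
            closed = closed-pt W′ Z (trans (pt-≐ cancel) e)
            inner : actᵂ g W′ ◅◅ actᵂ g Z ≐ actᵂ g W
            inner = ≐-trans (◅◅-congˡ (actᵂ g W′) (≐-trans (≡⇒≐ (act-◅◅ g (rev W′) W)) (◅◅-congʳ (actᵂ g W) (same⇒≐ (act-rev g W′)))))
              (≐-trans (≐-assoc⁻¹ (actᵂ g W′) (rev (actᵂ g W′)) (actᵂ g W)) (◅◅-congʳ (actᵂ g W) (rev-inverseʳ (actᵂ g W′))))
            expand : (κ ◅◅ actᵂ g W′) ◅◅ actᵂ g Z ≐ κ ◅◅ actᵂ g W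
            expand = ≐-trans (≐-assoc κ (actᵂ g W′) (actᵂ g Z)) (◅◅-congˡ κ inner)

          liftMap : WalkMap
          liftMap = record
            { F = λ W → pt (κ ◅◅ actᵂ g W)
            ; F-cong = lift-cong
            ; F-step = λ W a → subst (λ Z → AdjΔ (pt (κ ◅◅ actᵂ g W)) (pt Z))
                (trans (◅◅-assoc κ (actᵂ g W) (actAdj g a ◅ ε)) (cong (κ ◅◅_) (sym (act-◅◅ g W (a ◅ ε)))))
                (AdjΔ-step (κ ◅◅ actᵂ g W) (actAdj g a))
            }

        open WalkMap

        lift-inverse : ∀ {g h} (g∈ : g ∈ G) (h∈ : h ∈ G) (gh : ∀ u → g · (h · u) ≡ u) (κ : Walk v₀ (g · v₀)) (κ′ : Walk v₀ (h · v₀)) →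
          Same (actᵂ g κ′) (rev κ) → ∀ {u} (W : Walk v₀ u) → ⟦ liftMap g∈ κ ⟧ (F (liftMap h∈ κ′) W) ≡ pt W
        lift-inverse {g} {h} g∈ h∈ gh κ κ′ S W = trans (⟦pt⟧ (liftMap g∈ κ) (κ′ ◅◅ actᵂ h W)) (trans
          (cong (λ Z → pt (κ ◅◅ Z)) (act-◅◅ g κ′ (actᵂ h W)))
          (trans (same-pt (same-◅◅ (same-refl κ) (same-◅◅ S (same-act² g h gh W))))
            (pt-≐ (≐-trans (≐-assoc⁻¹ κ (rev κ) W) (◅◅-congʳ W (rev-inverseʳ κ))))))

        liftAut : ∀ {g : Automorphism Γ} → g ∈ G → Automorphism Δ
        liftAut {g} g∈ = automorphism (liftMap g∈ κ) (liftMap g′∈ κ′) (lift-inverse g∈ g′∈ (λ u → inverseʳ π) κ κ′ same₁)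
            (lift-inverse g′∈ g∈ (λ u → inverseˡ π) κ′ κ same₂)
          where
          π = Automorphism.perm g
          g′ = g ⁻¹ᴬ
          g′∈ : g′ ∈ G
          g′∈ = Subgroup.⁻¹-closed G g∈
          κ = τ (g · v₀)
          start : g′ · (g · v₀) ≡ v₀
          start = inverseˡ π
          -- The two lifts are inverse only if the walks from `v₀` cancel: `g` must carry `κ′` to
          -- the reverse of `κ`. The transport adjusts its start, which is equal to `v₀` only
          -- propositionally.
          κ′ : Walk v₀ (g′ · v₀)
          κ′ = subst (λ z → Walk z (g′ · v₀)) start (actᵂ g′ (rev κ))
          κ′-same : Same κ′ (actᵂ g′ (rev κ))
          κ′-same = same-subst start (actᵂ g′ (rev κ))
          same₁ : Same (actᵂ g κ′) (rev κ)
          same₁ = same-trans (same-act g κ′-same) (same-act² g g′ (λ u → inverseʳ π) (rev κ))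
          same₂ : Same (actᵂ g′ κ) (rev κ′)
          same₂ = same-sym (same-trans (same-rev κ′-same) (same-trans (same-rev (act-rev g′ κ)) (same-rev-rev (actᵂ g′ κ))))

        liftAut-apply : ∀ {g : Automorphism Γ} (g∈ : g ∈ G) x → liftAut g∈ · x ≡ pt {u = g · base x} (τ (g · v₀) ◅◅ actᵂ g (wk x))
        liftAut-apply g∈ x = refl

        liftAut-base : ∀ {g : Automorphism Γ} (g∈ : g ∈ G) x → base (liftAut g∈ · x) ≡ g · base x
        liftAut-base {g} g∈ x = trans (cong base (liftAut-apply g∈ x)) (base-pt {u = g · base x} (τ (g · v₀) ◅◅ actᵂ g (wk x)))

        lift-to : ∀ {g : Automorphism Γ} (g∈ : g ∈ G) x y → g · base x ≡ base y →
          Σ[ a ∈ Automorphism Δ ] (∀ z → base (a · z) ≡ g · base z) × a · x ≡ y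
        lift-to {g} g∈ x y e = deck Y AutΔ.∙ l , (λ z → trans (deck∈ Y (l · z)) (liftAut-base g∈ z)) , proj₂ d
          where
          l = liftAut g∈
          d = deck-transitive (l · x) y (trans (liftAut-base g∈ x) e)
          Y = proj₁ d

        Δ-vertexTransitive : VertexTransitive (whole (Aut Δ))
        Δ-vertexTransitive x y = proj₁ l , tt , proj₂ (proj₂ l)
          where
          g = vertex-transitive (base x) (base y)
          l = lift-to (proj₁ (proj₂ g)) x y (proj₂ (proj₂ g))

        lift-arc : ∀ {g : Automorphism Γ} (g∈ : g ∈ G) {x y x′ y′} → AdjΔ x y → AdjΔ x′ y′ → g · base x ≡ base x′ → g · base y ≡ base y′ →
          Σ[ a ∈ Automorphism Δ ] a · x ≡ x′ × a · y ≡ y′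
        lift-arc g∈ {x} {y} {x′} {y′} xy xy′ e f = a , ax ,
            AdjΔ-unique (subst (λ z → AdjΔ z (a · y)) ax (Equivalence.to (Automorphism.preserves a x y) xy)) xy′ (trans (proj₁ (proj₂ l) y) f)
          where
          l = lift-to g∈ x x′ e
          a = proj₁ l
          ax = proj₂ (proj₂ l)

        Δ-edgeTransitive : EdgeTransitive (whole (Aut Δ))
        Δ-edgeTransitive {x} {y} {x′} {y′} xy xy′ = case (edge-transitive (AdjΔ-base xy) (AdjΔ-base xy′))
          where
          case : ∃[ g ] g ∈ G × ((g · base x ≡ base x′ × g · base y ≡ base y′) ⊎ (g · base x ≡ base y′ × g · base y ≡ base x′)) →
            ∃[ a ] a ∈ whole (Aut Δ) × ((a · x ≡ x′ × a · y ≡ y′) ⊎ (a · x ≡ y′ × a · y ≡ x′))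
          case (g , g∈ , inj₁ (e , f)) = let a , ax , ay = lift-arc g∈ xy xy′ e f in a , tt , inj₁ (ax , ay)
          case (g , g∈ , inj₂ (e , f)) = let a , ax , ay = lift-arc g∈ xy (AdjΔ-sym xy′) e f in a , tt , inj₂ (ax , ay)

        Δ-notArcTransitive : ¬ ArcTransitive G → ¬ ArcTransitive (whole (Aut Δ))
        Δ-notArcTransitive not-at at = not-at λ {u} {v} {x} {y} uv xy →
          let c , _ , e , f = at (AdjΔ-step (τ u) uv) (AdjΔ-step (τ x) xy)
          in induced c , induced∈G c , trans (cong base e) (base-pt (τ x)) ,
             trans (trans (cong (onBase c) (sym (base-pt (τ u ◅◅ (uv ◅ ε))))) (onBase-base c _)) (trans (cong base f) (base-pt (τ x ◅◅ (xy ◅ ε))))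

        quotient-iso : (Aut Δ / deckGroup by deck-normal) ≅ ⟪ G ⟫
        quotient-iso = (λ c → induced c , induced∈G c) , record
          { isGroupMonomorphism = record
            { isGroupHomomorphism = record
              { isMonoidHomomorphism = record
                { isMagmaHomomorphism = record
                  { isRelHomomorphism = record { cong = λ {c} {d} → same-induced c d }
                  ; homo = onBase-∙ }
                ; ε-homo = λ u → base-pt (τ u) }
              ; ⁻¹-homo = λ c u → refl }
            ; injective = λ {c} {d} → same-coset c d }
          ; surjective = λ (g , g∈) → liftAut g∈ , λ {c} e u → trans (same-induced c (liftAut g∈) e u) (trans (liftAut-base g∈ (pt (τ u))) (cong (g ·_) (base-pt (τ u))))
          }
          where
          same-induced : ∀ c d → (c AutΔ.⁻¹ AutΔ.∙ d) ∈ deckGroup → ∀ u → onBase c u ≡ onBase d u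
          same-induced c d m u = trans (cong (onBase c) (trans (sym (base-pt (τ u))) (sym (m (pt (τ u)))))) (trans (onBase-base c _) (cong base (inverseʳ (Automorphism.perm c))))
          same-coset : ∀ c d → (∀ u → onBase c u ≡ onBase d u) → (c AutΔ.⁻¹ AutΔ.∙ d) ∈ deckGroup
          same-coset c d e x = trans (sym (onBase-base (c AutΔ.⁻¹) (d · x))) (trans (cong (onBase (c AutΔ.⁻¹)) (trans (sym (onBase-base d x)) (sym (e (base x)))))
            (onBase-inverse (c AutΔ.⁻¹) c (λ z → inverseˡ (Automorphism.perm c)) (base x)))

        deck-pGroup : IsPGroup p ⟪ deckGroup ⟫
        deck-pGroup = proj₁ K.index , deck-order

open LiftedAutomorphisms

-- Choice of the modulus and assembly of the cover

open import Data.Nat using (_^_)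

HasHalfArcTransitiveCover : {Γ : Graph} → Subgroup (Aut Γ) → ℕ → Set₁
HasHalfArcTransitiveCover G p =
  Σ[ Δ ∈ Graph ] Connected Δ × Tetravalent Δ × HalfArcTransitive Δ ×
    (Σ[ P ∈ Subgroup (Aut Δ) ] Σ[ P-normal ∈ IsNormal P ]
      IsPGroup p ⟪ P ⟫ × ((Aut Δ / P by P-normal) ≅ ⟪ G ⟫))

module _ (Γ : Graph) (connected : Connected Γ) (tetravalent : Tetravalent Γ)
    (G : Subgroup (Aut Γ)) (half-arc-transitive : IsHalfArcTransitiveOn G)
    {|G| : ℕ} (G-order : HasOrder ⟪ G ⟫ |G|)
    {p : ℕ} (p-prime : Prime p) (coeff : Coefficients p) (v₀ : Graph.Vertex Γ) where

  private
    vertex-transitive : VertexTransitive G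
    vertex-transitive = proj₁ half-arc-transitive

    edge-transitive : EdgeTransitive G
    edge-transitive = proj₁ (proj₂ half-arc-transitive)

  open Rigidity Γ connected tetravalent G edge-transitive G-order p-prime coeff v₀
  open PrimePowerIndex loops coeff
  module N = Normality Γ connected tetravalent G edge-transitive G-order p-prime coeff v₀
  module L = Lifting Γ connected tetravalent G vertex-transitive edge-transitive G-order p-prime coeff v₀

  module _ (coarse : NormalPrimePowerIndex (WordTrivial s |G| ω ω-length)) (modulus : ℕ)
           (fine : NormalPrimePowerIndex (TrivialAt modulus))
           (modulus< : N.radius coarse ℕ.+ N.radius coarse ℕ.+ 2 < p ^ modulus) where
    open NormalPrimePowerIndex fine
    open Covering Γ connected p-prime coeff v₀
    open Kernel subgroup normal (proj₂ index)

    cover-from-kernels : HasHalfArcTransitiveCover G p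
    cover-from-kernels = Δ , Δ-connected , Δ-tetravalent tetravalent ,
      (L.Δ-vertexTransitive modulus fine deck-normal , L.Δ-edgeTransitive modulus fine deck-normal ,
       L.Δ-notArcTransitive modulus fine deck-normal (proj₂ (proj₂ half-arc-transitive))) ,
      deckGroup , deck-normal , L.deck-pGroup modulus fine deck-normal , L.quotient-iso modulus fine deck-normal
      where
      deck-normal : IsNormal deckGroup
      deck-normal = N.deck-normal coarse modulus fine modulus<

  cover-exists : HasHalfArcTransitiveCover G p
  cover-exists = cover-from-kernels coarse modulus (Trivial-index s |G| ω ω-length modulus)
      (n<m^n (ℕ.nonTrivial⇒n>1 p {{prime⇒nonTrivial p-prime}}) modulus)
    where
    coarse = WordTrivial-index s |G| ω ω-length
    -- An exponent of `p`: by `n<m^n` the bound to be exceeded can itself be taken as the exponent.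
    -- The radius comes from the coarse kernel alone, so the choice is not circular.
    modulus = N.radius coarse ℕ.+ N.radius coarse ℕ.+ 2

theorem1p1 : (Γ : Graph) → Connected Γ → Tetravalent Γ →
    (G : Subgroup (Aut Γ)) → IsHalfArcTransitiveOn G →
    (v : Graph.Vertex Γ) → ¬ IsAbelian ⟪ stabilizer G v ⟫ →
    (|Gᵥ| : ℕ) → HasOrder ⟪ stabilizer G v ⟫ |Gᵥ| → 2 ^ 9 ≤ |Gᵥ| →
    (|G| : ℕ) → HasOrder ⟪ G ⟫ |G| →
    (p : ℕ) → Prime p → |G| ≤ p →
    Σ[ Δ ∈ Graph ] Connected Δ × Tetravalent Δ × HalfArcTransitive Δ ×
    (Σ[ P ∈ Subgroup (Aut Δ) ] Σ[ P-normal ∈ IsNormal P ]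
    IsPGroup p ⟪ P ⟫ × ((Aut Δ / P by P-normal) ≅ ⟪ G ⟫))
theorem1p1 Γ connected tetravalent G half-arc-transitive v _ _ _ _ |G| G-order p p-prime _ =
  cover-exists Γ connected tetravalent G half-arc-transitive G-order p-prime (coefficients p p-prime) v
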